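{- Let $\kappa\ge1$, $b\ge0$, $n\ge1$ be integers. Let $ss_{b,\kappa}(n)$ be the number of multiplex siteswap patterns of period $n$ using exactly $b$ balls in which every throw involves at most $\kappa$ balls, and let $jp_{b,\kappa}(n)$ be the number of multiplex juggling patterns with exactly $b$ balls, minimal period $n$, and every throw involving at most $\kappa$ balls. Then \[ ss_{b,\kappa}(n)=\operatorname{tr}(A_{b,\kappa}^n)-\sum_{i=\max\{0,b-\kappa\}}^{b-1}\operatorname{tr}(A_{i,\kappa}^n), \] and \[ jp_{b,\kappa}(n)=\frac1n\sum_{d\mid n}\mu\!\left(\tfrac nd\right)\left(\operatorname{tr}(A_{b,\kappa}^d)-\sum_{i=\max\{0,b-\kappa\}}^{b-1}\operatorname{tr}(A_{i,\kappa}^d)\right), \] where $\mu$ is the Möbius function.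
   Context: A multiplex siteswap pattern of period $n$ is a sequence $(T_0,\ldots,T_{n-1})$ of finite multisets of positive integers (possibly empty) such that for every $t\in\{0,\ldots,n-1\}$, $|T_t|$ equals the number of pairs $(s,h)$, counted with multiplicity, with $s\in\{0,\ldots,n-1\}$, $h\in T_s$, $s+h\equiv t\pmod n$. Its number of balls is $\frac1n\sum_s\sum_{h\in T_s}h$; every throw involves at most $\kappa$ balls means $|T_t|\le\kappa$ for all $t$. Sequences are counted as sequences, not necessarily of minimal period $n$. A pattern has minimal period $n$ if it is not the repetition of a length-$d$ block for a proper divisor $d$ of $n$; juggling patterns of minimal period $n$ are the equivalence classes of such siteswap patterns under cyclic rotation. An ordered partition (composition) of a positive integer $b$ is a finite sequence of positive integers with sum $b$. For ordered partitions $q=(q_1,\ldots,q_k)$, $r=(r_1,\ldots,r_\ell)$ of $b$, a nontrivial embedding of $q$ into $r$ is a choice of indices $1\le i_2<\cdots<i_k\le\ell$ with $q_j\le r_{i_j}$ for $2\le j\le k$ (when $k=1$ there is exactly one, the empty choice). For $b\ge1$, $A_b$ is the matrix indexed by ordered partitions of $b$ whose $(q,r)$ entry is the number of nontrivial embeddings of $q$ into $r$ plus $1$ if $q=r$; $A_0=(1)$. $A_{b,\kappa}$ is the principal submatrix of $A_b$ whose rows and columns are indexed by the ordered partitions of $b$ all of whose parts are at most $\kappa$ (and $A_{0,\kappa}=(1)$). -}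

module Defs where

open import Data.Nat using (ℕ; zero; suc; _+_; _*_; _∸_; _≤_; _<_; _≤?_; NonZero)
open import Data.Nat.Properties using (_≟_)
open import Data.Nat.DivMod using (_%_; _/_; _mod_)
open import Data.Nat.Divisibility using (_∣_; _∣?_)
open import Data.Integer as ℤ using (ℤ; +_; -_)
open import Data.Fin using (Fin; toℕ)
open import Data.Nat.ListAction renaming (sum to sumℕ)
open import Data.List as L using (List; []; _∷_; length; upTo; filter; concatMap)
import Data.List.Properties as LP
open import Data.List.Relation.Unary.All using (All)
open import Data.List.Relation.Unary.Linked using (Linked)
open import Data.Vec as V using (Vec; lookup; tabulate; toList)
import Data.Vec.Relation.Unary.All as VAll
open import Data.Product using (Σ; ∃; _×_; proj₁)
open import Relation.Nullary using (¬_; yes; no)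
open import Relation.Binary.PropositionalEquality using (_≡_)

-- Finite multisets of positive integers, in canonical form:
-- a list of positive integers sorted in non-increasing order.

Multiset : Set
Multiset = Σ (List ℕ) (λ l → All (λ h → 1 ≤ h) l × Linked (λ x y → y ≤ x) l)

size : Multiset → ℕ
size m = length (proj₁ m)

landings : (n : ℕ) .{{_ : NonZero n}} → Vec Multiset n → Fin n → ℕ
landings n T t =
  sumℕ (L.map (λ s → length (filter (λ h → ((toℕ s + h) % n) ≟ toℕ t) (proj₁ (lookup T s))))
               (L.allFin n))

-- total of all throw heights  (= n · number of balls)
totalHeight : ∀ {n} → Vec Multiset n → ℕ
totalHeight T = V.sum (V.map (λ m → sumℕ (proj₁ m)) T)

Siteswap : (n b κ : ℕ) .{{_ : NonZero n}} → Set
Siteswap n b κ =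
  Σ (Vec Multiset n) λ T →
      V.map size T ≡ tabulate (landings n T)
    × totalHeight T ≡ n * b
    × VAll.All (λ m → size m ≤ κ) T

IsRepetitionOf : ∀ {n} → ℕ → Vec Multiset n → Set
IsRepetitionOf d T =
  Σ (List Multiset) λ B → Σ ℕ λ k → length B ≡ d × toList T ≡ L.concat (L.replicate k B)

HasMinimalPeriod : (n : ℕ) → Vec Multiset n → Set
HasMinimalPeriod n T = ∀ d → d ∣ n → d < n → ¬ IsRepetitionOf d T

rotate : (n : ℕ) .{{_ : NonZero n}} → ℕ → Vec Multiset n → Vec Multiset n
rotate n k T = tabulate (λ i → lookup T ((toℕ i + k) mod n))

RotEquiv : (n : ℕ) .{{_ : NonZero n}} → Vec Multiset n → Vec Multiset n → Set
RotEquiv n T U = ∃ λ (k : ℕ) → U ≡ rotate n k T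

MinSiteswap : (n b κ : ℕ) .{{_ : NonZero n}} → Set
MinSiteswap n b κ = Σ (Siteswap n b κ) (λ P → HasMinimalPeriod n (proj₁ P))

private
  compsFuel : ℕ → ℕ → ℕ → List (List ℕ)
  compsFuel κ _ zero = [] ∷ []
  compsFuel κ zero (suc _) = []
  compsFuel κ (suc f) r@(suc _) =
    concatMap (λ j → L.map (suc j ∷_) (compsFuel κ f (r ∸ suc j)))
              (filter (λ j → suc j ≤? κ) (upTo r))

compositions : (b κ : ℕ) → List (List ℕ)
compositions b κ = compsFuel κ b b

embeddings : List ℕ → List ℕ → ℕ
embeddings [] r = 1
embeddings (x ∷ xs) [] = 0
embeddings (x ∷ xs) (y ∷ ys) with x ≤? y
... | yes _ = embeddings xs ys + embeddings (x ∷ xs) ys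
... | no  _ = embeddings (x ∷ xs) ys

nontrivial : List ℕ → List ℕ → ℕ
nontrivial [] r = 0      -- only occurs for b = 0, where A₀ = (1)
nontrivial (q₁ ∷ qs) r = embeddings qs r

δ : List ℕ → List ℕ → ℕ
δ q r with LP.≡-dec _≟_ q r
... | yes _ = 1
... | no  _ = 0

Aentry : List ℕ → List ℕ → ℕ
Aentry q r = nontrivial q r + δ q r

Mat : Set
Mat = List ℕ → List ℕ → ℕ

module _ (I : List (List ℕ)) where
  _·_ : Mat → Mat → Mat
  (M · N) q r = sumℕ (L.map (λ s → M q s * N s r) I)

  _^^_ : Mat → ℕ → Mat
  M ^^ zero = δ
  M ^^ suc k = M · (M ^^ k)

  trace : Mat → ℕ
  trace M = sumℕ (L.map (λ q → M q q) I)

sumℤ : List ℤ → ℤ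
sumℤ = L.foldr ℤ._+_ (+ 0)

trA^ : (b κ d : ℕ) → ℕ
trA^ b κ d = trace I (_^^_ I Aentry d)
  where I = compositions b κ

S : (b κ d : ℕ) → ℤ
S b κ d = + trA^ b κ d ℤ.- sumℤ (L.map (λ i → + trA^ i κ d) (filter (λ i → b ∸ κ ≤? i) (upTo b)))

-- smallest divisor ≥ 2 of m, written as 2 + j (for m ≥ 2 it is the least prime factor)
private
  spf : ℕ → ℕ
  spf m with filter (λ j → suc (suc j) ∣? m) (upTo m)
  ... | [] = 0
  ... | j ∷ _ = j

  mobFuel : ℕ → ℕ → ℤ
  mobFuel zero _ = + 0
  mobFuel (suc f) zero = + 0
  mobFuel (suc f) (suc zero) = + 1
  mobFuel (suc f) m@(suc (suc _)) with (suc (suc (spf m)) * suc (suc (spf m))) ∣? m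
  ... | yes _ = + 0
  ... | no  _ = - mobFuel f (m / suc (suc (spf m)))

μ : ℕ → ℤ
μ m = mobFuel m m

mobiusSum : (b κ n : ℕ) → ℤ
mobiusSum b κ n =
  sumℤ (L.map (λ j → μ (n / suc j) ℤ.* S b κ (suc j)) (filter (λ j → suc j ∣? n) (upTo n)))

{-# OPTIONS --safe #-}

-- The state of a pattern at time t is its schedule: y t j balls are due to land at time t + j, and
-- y t (j + 1) ≤ y (t + 1) j.  Deleting the zeros turns the state into a composition of b with parts
-- at most κ.  A beat without a landing keeps the composition; any other beat removes the first part
-- and embeds the remaining ones into the next composition.  A pattern of period n thus gives a
-- closed walk of length n, and these are counted by tr (A ^ n).  Conversely the choices along a
-- closed walk determine the schedule by recursion on j, and they come from a pattern unless the
-- last part never receives a ball nor gets a later part after it.  Such a last part never lands;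
-- its size is between 1 and κ, and stripping it leaves an arbitrary closed walk with i balls,
-- b − κ ≤ i < b.  This accounts for the subtracted traces.
--
-- Every siteswap is the repetition of a unique block of minimal period, and rotation acts freely
-- on the siteswaps of minimal period, so the count of juggling patterns follows by Möbius
-- inversion.

module Submission where

open import Defs
open import Agda.Builtin.Nat using (div-helper)
open import Algebra.Structures using (IsCommutativeMonoid)
open import Data.Bool using (Bool; false; if_then_else_)
open import Data.Empty using (⊥; ⊥-elim)
open import Data.Fin using (Fin; zero; suc; toℕ)
import Data.Fin.Properties as Fin
import Data.Fin.Permutation as Perm
open import Data.Integer as ℤ using (ℤ; +_; -_)
import Data.Integer.Properties as ℤ
open import Data.List using (List; []; _∷_; _++_; _∷ʳ_; map; filter; upTo; applyUpTo; concatMap; length; replicate; take; drop; allFin; concat)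
import Data.List.Properties as List
open import Data.List.Membership.Propositional using (_∈_; lose; find)
open import Data.List.Membership.Propositional.Properties using (∈-map⁺; ∈-map⁻; ∈-filter⁺; ∈-filter⁻; ∈-upTo⁺; ∈-upTo⁻; ∈-concatMap⁺; ∈-concatMap⁻)
open import Data.List.Relation.Binary.Pointwise as Pointwise using (Pointwise; []; _∷_)
open import Data.List.Relation.Unary.All as All using (All; []; _∷_)
import Data.List.Relation.Unary.All.Properties as All
open import Data.List.Relation.Unary.AllPairs as AllPairs using ([]; _∷_)
import Data.List.Relation.Unary.AllPairs.Properties as AllPairs
open import Data.List.Relation.Unary.Any using (here; there)
open import Data.List.Relation.Unary.Linked as Linked using (Linked; []; [-]; _∷_)
open import Data.List.Relation.Unary.Unique.Propositional using (Unique)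
import Data.List.Relation.Unary.Unique.Propositional.Properties as Unique
open import Data.Maybe using (Maybe; just; nothing)
open import Data.Nat using (ℕ; zero; suc; _+_; _*_; _∸_; _≤_; _<_; _≤?_; _<?_; z≤n; s≤s; NonZero; ≢-nonZero⁻¹; pred)
import Data.Nat.Coprimality as Coprime
open import Data.Nat.Induction using (<-wellFounded; Acc; acc)
open import Data.Nat.DivMod as DivMod using (_/_; _%_; _mod_)
open import Data.Nat.Divisibility as Div using (_∣_; divides; _∣?_)
open import Data.Nat.GCD as GCD using (gcd)
open import Data.Nat.ListAction renaming (sum to sumℕ)
open import Data.Nat.ListAction.Properties using (sum-++)
open import Data.Nat.Properties hiding (_≤?_; _<?_)
open import Data.Product using (Σ; ∃; _×_; _,_; proj₁; proj₂)
open import Data.Product.Function.NonDependent.Propositional using (_×-↔_)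
open import Data.Sum using (_⊎_; inj₁; inj₂; [_,_]′)
open import Data.Sum.Function.Propositional using (_⊎-↔_)
open import Data.Unit using (⊤; tt)
open import Data.Vec as V using (Vec; []; _∷_; lookup; tabulate; toList)
import Data.Vec.Properties as V
import Data.Vec.Relation.Unary.All as VAll
open import Function using (_∘_; id; _∋_)
open import Function.Bundles using (_↔_; _⇔_; Inverse; mk↔ₛ′; mk⇔)
open import Function.Definitions using (Surjective)
open import Function.Properties.Inverse using (↔-sym; ↔-trans)
open import Relation.Binary.PropositionalEquality hiding ([_]; J)
open import Relation.Nullary using (¬_; Dec; yes; no; does; contradiction)
open import Relation.Nullary.Decidable using (¬?; _×-dec_; decidable-stable)
open import Tactic.Cong using (cong!; ⌞_⌟)

-- Why one non-static beat makes all balls land: let `aloft t j` count the balls in the air at time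
-- `t` that do not land within the next `j` beats. Moving to an earlier time with a correspondingly
-- larger `j` never increases it, and at a non-static beat it shrinks unless it is zero. Such a beat
-- recurs in every period, so `b` periods bring all balls down. Hence one horizon `H`, depending
-- only on `n` and `b`, serves all siteswaps and all walks that come from them, and schedules become
-- lists of length `H`. The deleted zeros are the obstacle in passing between the two descriptions:
-- a card speaks of parts, a schedule of times. `sel` and `spread` translate. Sizes are bijections
-- with `Fin`, so the proofs contained in a counted object must be unique, and functions on all
-- times cannot be compared directly. Therefore walks are stored as finite paths, and minimality as
-- the outcome of a decision, `IsMin`. Siteswaps are not enumerated: they are counted as the
-- complement of the topped walks among all closed walks.

-- Finite sums over an initial range in a commutative monoid

module RangeSum {A : Set} (_⊕_ : A → A → A) (𝟘 : A) (isCM : IsCommutativeMonoid _≡_ _⊕_ 𝟘) where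
  open IsCommutativeMonoid isCM using (identityˡ; identityʳ; assoc; comm)
  open ≡-Reasoning

  ∑ : ℕ → (ℕ → A) → A
  ∑ zero    f = 𝟘
  ∑ (suc n) f = f 0 ⊕ ∑ n (f ∘ suc)

  ∑-cong : ∀ n {f g : ℕ → A} → (∀ i → i < n → f i ≡ g i) → ∑ n f ≡ ∑ n g
  ∑-cong zero    h = refl
  ∑-cong (suc n) h = cong₂ _⊕_ (h 0 (s≤s z≤n)) (∑-cong n λ i i<n → h (suc i) (s≤s i<n))

  ∑-zero : ∀ n {f : ℕ → A} → (∀ i → i < n → f i ≡ 𝟘) → ∑ n f ≡ 𝟘
  ∑-zero zero    h = refl
  ∑-zero (suc n) h = trans (cong₂ _⊕_ (h 0 (s≤s z≤n)) (∑-zero n λ i i<n → h (suc i) (s≤s i<n))) (identityˡ 𝟘)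

  ∑-+ : ∀ m n (f : ℕ → A) → ∑ (m + n) f ≡ ∑ m f ⊕ ∑ n (λ i → f (m + i))
  ∑-+ zero    n f = sym (identityˡ _)
  ∑-+ (suc m) n f = trans (cong (f 0 ⊕_) (∑-+ m n (f ∘ suc))) (sym (assoc _ _ _))

  ∑-last : ∀ n (f : ℕ → A) → ∑ (suc n) f ≡ ∑ n f ⊕ f n
  ∑-last zero    f = comm (f 0) 𝟘
  ∑-last (suc n) f = trans (cong (f 0 ⊕_) (∑-last n (f ∘ suc))) (sym (assoc _ _ _))

  interchange : ∀ a b c d → (a ⊕ b) ⊕ (c ⊕ d) ≡ (a ⊕ c) ⊕ (b ⊕ d)
  interchange a b c d = begin
    (a ⊕ b) ⊕ (c ⊕ d) ≡⟨ assoc a b _ ⟩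
    a ⊕ (b ⊕ (c ⊕ d)) ≡⟨ cong (a ⊕_) (sym (assoc b c d)) ⟩
    a ⊕ ((b ⊕ c) ⊕ d) ≡⟨ cong (λ x → a ⊕ (x ⊕ d)) (comm b c) ⟩
    a ⊕ ((c ⊕ b) ⊕ d) ≡⟨ cong (a ⊕_) (assoc c b d) ⟩
    a ⊕ (c ⊕ (b ⊕ d)) ≡⟨ sym (assoc a c _) ⟩
    (a ⊕ c) ⊕ (b ⊕ d) ∎

  ∑-⊕ : ∀ n (f g : ℕ → A) → ∑ n (λ i → f i ⊕ g i) ≡ ∑ n f ⊕ ∑ n g
  ∑-⊕ zero    f g = sym (identityˡ 𝟘)
  ∑-⊕ (suc n) f g = trans (cong ((f 0 ⊕ g 0) ⊕_) (∑-⊕ n (f ∘ suc) (g ∘ suc))) (interchange _ _ _ _)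

  ∑-swap : ∀ m n (f : ℕ → ℕ → A) → ∑ m (λ i → ∑ n (f i)) ≡ ∑ n (λ j → ∑ m (λ i → f i j))
  ∑-swap zero    n f = sym (∑-zero n λ _ _ → refl)
  ∑-swap (suc m) n f = trans (cong (∑ n (f 0) ⊕_) (∑-swap m n (f ∘ suc))) (sym (∑-⊕ n (f 0) _))

  ∑-single : ∀ n {f : ℕ → A} k → k < n → (∀ i → i < n → i ≢ k → f i ≡ 𝟘) → ∑ n f ≡ f k
  ∑-single (suc n) zero    _         h = trans (cong (_ ⊕_) (∑-zero n λ i i<n → h (suc i) (s≤s i<n) λ ())) (identityʳ _)
  ∑-single (suc n) (suc k) (s≤s k<n) h =
    trans (cong₂ _⊕_ (h 0 (s≤s z≤n) λ ()) (∑-single n k k<n λ i i<n i≢k → h (suc i) (s≤s i<n) (i≢k ∘ suc-injective))) (identityˡ _)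

  ∑-extend : ∀ {m n} (f : ℕ → A) → m ≤ n → (∀ i → m ≤ i → i < n → f i ≡ 𝟘) → ∑ n f ≡ ∑ m f
  ∑-extend {m} {n} f m≤n h = begin
    ∑ n f                                 ≡⟨ cong (λ k → ∑ k f) (sym (m+[n∸m]≡n m≤n)) ⟩
    ∑ (m + (n ∸ m)) f                     ≡⟨ ∑-+ m (n ∸ m) f ⟩
    ∑ m f ⊕ ∑ (n ∸ m) (λ i → f (m + i))   ≡⟨ cong (∑ m f ⊕_) (∑-zero (n ∸ m) λ i i<k → h (m + i) (m≤m+n m i)
                                               (subst (m + i <_) (m+[n∸m]≡n m≤n) (+-monoʳ-< m i<k))) ⟩
    ∑ m f ⊕ 𝟘                             ≡⟨ identityʳ _ ⟩
    ∑ m f                                 ∎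

  [_]·_ : {P : Set} → Dec P → A → A
  [ d ]· a = if does d then a else 𝟘

  []·-yes : {P : Set} (d : Dec P) {a : A} → P → [ d ]· a ≡ a
  []·-yes (yes _) p = refl
  []·-yes (no ¬p) p = contradiction p ¬p

  []·-no : {P : Set} (d : Dec P) {a : A} → ¬ P → [ d ]· a ≡ 𝟘
  []·-no (yes p) ¬p = contradiction p ¬p
  []·-no (no _)  ¬p = refl

  []·-zero : {P : Set} (d : Dec P) {a : A} → a ≡ 𝟘 → [ d ]· a ≡ 𝟘
  []·-zero (yes _) e = e
  []·-zero (no _)  e = refl

  []·-cong : {P : Set} (d : Dec P) {a a′ : A} → (P → a ≡ a′) → [ d ]· a ≡ [ d ]· a′
  []·-cong (yes p) h = h p
  []·-cong (no _)  h = refl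

  []·-⇔ : {P Q : Set} (d : Dec P) (e : Dec Q) {a : A} → (P → Q) → (Q → P) → [ d ]· a ≡ [ e ]· a
  []·-⇔ (yes p) e f g = sym ([]·-yes e (f p))
  []·-⇔ (no ¬p) e f g = sym ([]·-no e (¬p ∘ g))

  ∑-[] : ∀ n {P : Set} (d : Dec P) (f : ℕ → A) → ∑ n (λ i → [ d ]· f i) ≡ [ d ]· ∑ n f
  ∑-[] n (yes _) f = refl
  ∑-[] n (no _)  f = ∑-zero n λ _ _ → refl

  UniqueBelow : ℕ → (ℕ → Set) → Set
  UniqueBelow n P = ∃ λ k → k < n × P k × (∀ i → i < n → P i → i ≡ k)

  ∑-[unique] : ∀ n {P : ℕ → Set} (P? : ∀ i → Dec (P i)) (a : A) → UniqueBelow n P → ∑ n (λ i → [ P? i ]· a) ≡ a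
  ∑-[unique] n P? a (k , k<n , Pk , u) =
    trans (∑-single n k k<n λ i i<n i≢k → []·-no (P? i) λ Pi → i≢k (u i i<n Pi)) ([]·-yes (P? k) Pk)

  -- Both sides equal the double sum over the pairs related by R.
  ∑-reindex : ∀ m n {R : ℕ → ℕ → Set} (R? : ∀ i j → Dec (R i j)) (f g : ℕ → A) →
    (∀ i → i < m → f i ≡ 𝟘 ⊎ UniqueBelow n (R i)) →
    (∀ j → j < n → g j ≡ 𝟘 ⊎ UniqueBelow m (λ i → R i j)) →
    (∀ i j → i < m → j < n → R i j → f i ≡ g j) →
    ∑ m f ≡ ∑ n g
  ∑-reindex m n {R} R? f g uf ug fg = begin
    ∑ m f                                   ≡⟨ ∑-cong m (λ i i<m → sym (left i (uf i i<m))) ⟩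
    ∑ m (λ i → ∑ n (λ j → [ R? i j ]· f i)) ≡⟨ ∑-cong m (λ i i<m → ∑-cong n λ j j<n → []·-cong (R? i j) (fg i j i<m j<n)) ⟩
    ∑ m (λ i → ∑ n (λ j → [ R? i j ]· g j)) ≡⟨ ∑-swap m n _ ⟩
    ∑ n (λ j → ∑ m (λ i → [ R? i j ]· g j)) ≡⟨ ∑-cong n (λ j j<n → right j (ug j j<n)) ⟩
    ∑ n g                                   ∎
    where
    left : ∀ i → f i ≡ 𝟘 ⊎ UniqueBelow n (R i) → ∑ n (λ j → [ R? i j ]· f i) ≡ f i
    left i (inj₁ e) = trans (∑-zero n λ j _ → []·-zero (R? i j) e) (sym e)
    left i (inj₂ u) = ∑-[unique] n (R? i) (f i) u
    right : ∀ j → g j ≡ 𝟘 ⊎ UniqueBelow m (λ i → R i j) → ∑ m (λ i → [ R? i j ]· g j) ≡ g j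
    right j (inj₁ e) = trans (∑-zero m λ i _ → []·-zero (R? i j) e) (sym e)
    right j (inj₂ u) = ∑-[unique] m (λ i → R? i j) (g j) u

open RangeSum _+_ 0 +-0-isCommutativeMonoid public

∑-const : ∀ n c → ∑ n (λ _ → c) ≡ n * c
∑-const zero    c = refl
∑-const (suc n) c = cong (λ x → c + x) (∑-const n c)

-- Counting types by bijections with `Fin`

Prop : Set → Set
Prop A = (x y : A) → x ≡ y

Σ-≡ : {A : Set} {B : A → Set} → (∀ a → Prop (B a)) → {x y : Σ A B} → proj₁ x ≡ proj₁ y → x ≡ y
Σ-≡ irr {a , b} {.a , b′} refl = cong (a ,_) (irr a b b′)

×-prop : {A B : Set} → Prop A → Prop B → Prop (A × B)
×-prop p q (a , b) (a′ , b′) = cong₂ _,_ (p a a′) (q b b′)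

≡-prop : {A : Set} {a b : A} → Prop (a ≡ b)
≡-prop refl refl = refl

-- The second inverse law follows from injectivity. The main bijections are built this way:
-- preimages are constructed, and distinctness is proved separately.
section⇒↔ : {A B : Set} (f : A → B) (g : B → A) → (∀ b → f (g b) ≡ b) → (∀ {x y} → f x ≡ f y → x ≡ y) → A ↔ B
section⇒↔ f g fg inj = mk↔ₛ′ f g fg λ a → inj (fg (f a))

size-unique : ∀ {A : Set} {m n} → A ↔ Fin m → A ↔ Fin n → m ≡ n
size-unique s t = Perm.↔⇒≡ (↔-trans (↔-sym s) t)

size-⊎ : ∀ {A B : Set} {m n} → A ↔ Fin m → B ↔ Fin n → (A ⊎ B) ↔ Fin (m + n)
size-⊎ s t = ↔-trans (s ⊎-↔ t) (↔-sym Fin.+↔⊎)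

size-× : ∀ {A B : Set} {m n} → A ↔ Fin m → B ↔ Fin n → (A × B) ↔ Fin (m * n)
size-× s t = ↔-trans (s ×-↔ t) (↔-sym Fin.*↔×)

size-empty : {A : Set} → ¬ A → A ↔ Fin 0
size-empty ¬a = mk↔ₛ′ (⊥-elim ∘ ¬a) (λ ()) (λ ()) (⊥-elim ∘ ¬a)

size-contr : {A : Set} → A → Prop A → A ↔ Fin 1
size-contr a irr = mk↔ₛ′ (λ _ → zero) (λ _ → a) (λ { zero → refl }) (irr a)

size-dec : {A : Set} → Dec A → Prop A → ∃ λ k → A ↔ Fin k
size-dec (yes a) irr = 1 , size-contr a irr
size-dec (no ¬a) irr = 0 , size-empty ¬a

Fin-subset-finite : ∀ n {P : Fin n → Set} → (∀ i → Dec (P i)) → (∀ i → Prop (P i)) → ∃ λ k → Σ (Fin n) P ↔ Fin k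
Fin-subset-finite zero    P? irr = 0 , size-empty λ ()
Fin-subset-finite (suc n) {P} P? irr with size-dec (P? zero) (irr zero) | Fin-subset-finite n (P? ∘ suc) (irr ∘ suc)
... | k , s | l , t = k + l , ↔-trans split (size-⊎ s t)
  where
  split : Σ (Fin (suc n)) P ↔ (P zero ⊎ Σ (Fin n) (P ∘ suc))
  split = mk↔ₛ′ (λ { (zero , p) → inj₁ p ; (suc i , p) → inj₂ (i , p) })
                [ (zero ,_) , (λ { (i , p) → suc i , p }) ]′
                (λ { (inj₁ _) → refl ; (inj₂ _) → refl })
                (λ { (zero , _) → refl ; (suc _ , _) → refl })

subset-finite : ∀ {A : Set} {n} → A ↔ Fin n → {P : A → Set} → (∀ a → Dec (P a)) → (∀ a → Prop (P a)) → ∃ λ k → Σ A P ↔ Fin k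
subset-finite {A} {n} s {P} P? irr with Fin-subset-finite n (P? ∘ Inverse.from s) (irr ∘ Inverse.from s)
... | k , t = k , ↔-trans reindex t
  where
  open Inverse s using (to; from; strictlyInverseˡ; strictlyInverseʳ)
  reindex : Σ A P ↔ Σ (Fin n) (P ∘ from)
  reindex = mk↔ₛ′ (λ { (a , p) → to a , subst P (sym (strictlyInverseʳ a)) p }) (λ { (i , p) → from i , p })
    (λ { (i , _) → Σ-≡ (irr ∘ from) (strictlyInverseˡ i) }) (λ { (a , _) → Σ-≡ irr (strictlyInverseʳ a) })

-- Gives siteswaps a size without enumerating them: they are one summand of a type that is already
-- counted.
left-finite : ∀ {A B : Set} {n} → (A ⊎ B) ↔ Fin n → ∃ λ k → A ↔ Fin k
left-finite {A} {B} s = proj₁ sub , ↔-trans lefts (proj₂ sub)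
  where
  IsLeft : A ⊎ B → Set
  IsLeft (inj₁ _) = ⊤
  IsLeft (inj₂ _) = ⊥
  left? : ∀ x → Dec (IsLeft x)
  left? (inj₁ _) = yes tt
  left? (inj₂ _) = no λ ()
  left-prop : ∀ x → Prop (IsLeft x)
  left-prop (inj₁ _) _ _ = refl
  sub = subset-finite s left? left-prop
  lefts : A ↔ Σ (A ⊎ B) IsLeft
  lefts = mk↔ₛ′ (λ a → inj₁ a , tt) (λ { (inj₁ a , _) → a ; (inj₂ _ , ()) }) (λ { (inj₁ _ , _) → refl ; (inj₂ _ , ()) }) (λ _ → refl)

-- Membership proofs record positions, so a repeated entry of `I` counts as often in the type as in
-- the sum.
size-Σ∈ : ∀ {A : Set} {B : A → Set} {f : A → ℕ} (I : List A) → (∀ a → a ∈ I → B a ↔ Fin (f a)) →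
  Σ A (λ a → a ∈ I × B a) ↔ Fin (sumℕ (map f I))
size-Σ∈ []      s = size-empty λ ()
size-Σ∈ {A} {B} (a ∷ I) s = ↔-trans split (size-⊎ (s a (here refl)) (size-Σ∈ I λ a′ i → s a′ (there i)))
  where
  split : Σ A (λ a′ → a′ ∈ (a ∷ I) × B a′) ↔ (B a ⊎ Σ A (λ a′ → a′ ∈ I × B a′))
  split = mk↔ₛ′ (λ { (_ , here refl , x) → inj₁ x ; (a′ , there i , x) → inj₂ (a′ , i , x) })
                [ (λ x → a , here refl , x) , (λ { (a′ , i , x) → a′ , there i , x }) ]′
                (λ { (inj₁ _) → refl ; (inj₂ _) → refl })
                (λ { (_ , here refl , _) → refl ; (_ , there _ , _) → refl })

unique⇒∈-prop : {A : Set} {I : List A} → Unique I → ∀ a → Prop (a ∈ I)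
unique⇒∈-prop (n ∷ u) a (here refl) (here refl) = refl
unique⇒∈-prop (n ∷ u) a (here refl) (there j)   = contradiction refl (All.lookup n j)
unique⇒∈-prop (n ∷ u) a (there i)   (here refl) = contradiction refl (All.lookup n i)
unique⇒∈-prop (n ∷ u) a (there i)   (there j)   = cong there (unique⇒∈-prop u a i j)

size-Σ : ∀ {A : Set} {B P : A → Set} {f : A → ℕ} (I : List A) → Unique I →
  (∀ a → P a → a ∈ I) → (∀ a → a ∈ I → P a) → (∀ a → Prop (P a)) → (∀ a → P a → B a ↔ Fin (f a)) →
  Σ A (λ a → P a × B a) ↔ Fin (sumℕ (map f I))
size-Σ I u to from irr s = ↔-trans swap (size-Σ∈ I λ a i → s a (from a i))
  where
  swap = mk↔ₛ′ (λ { (a , p , x) → a , to a p , x }) (λ { (a , i , x) → a , from a i , x })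
    (λ { (a , i , x) → cong (λ j → a , j , x) (unique⇒∈-prop u a _ i) })
    (λ { (a , p , x) → cong (λ p′ → a , p′ , x) (irr a _ p) })

-- Compositions with bounded parts

compositions-branches : ∀ κ f → Σ (ℕ → List (List ℕ)) λ X →
  compositions (suc f) κ ≡ concatMap X (filter (λ j → suc j ≤? κ) (upTo (suc f)))
compositions-branches κ f = _ , refl

-- branch κ f j lists the compositions of f ∸ j, generated with fuel f; the generator is private
-- in Defs and is therefore named by unification.
branch : ∀ κ f j → Σ (List (List ℕ)) λ Y → proj₁ (compositions-branches κ f) j ≡ map (suc j ∷_) Y
branch κ f j = _ , refl

module _ (κ : ℕ) (P : ℕ → List (List ℕ) → Set) (base : P 0 ([] ∷ []))
  (step : ∀ r (Y : ℕ → List (List ℕ)) → (∀ i → i ≤ r → P (r ∸ i) (Y i)) →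
    P (suc r) (concatMap (λ i → map (suc i ∷_) (Y i)) (filter (λ j → suc j ≤? κ) (upTo (suc r))))) where

  branch-induction : ∀ f j → P (f ∸ j) (proj₁ (branch κ f j))
  branch-induction zero    zero    = base
  branch-induction zero    (suc j) = base
  branch-induction (suc f) j with suc f ∸ j | m∸n≤m (suc f) j
  ... | zero  | _     = base
  ... | suc r | s≤s r≤f = step r _ sub
    where
    sub : ∀ i → i ≤ r → P (r ∸ i) _
    -- The induction hypothesis speaks of remainders of the form `f ∸ j`; the choice
    -- `j = f ∸ (r ∸ i)` brings `r ∸ i`, which is at most `f`, into that form.
    sub i i≤r with f ∸ (f ∸ (r ∸ i)) | m∸[m∸n]≡n (≤-trans (m∸n≤m r i) r≤f) | branch-induction f (f ∸ (r ∸ i))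
    ... | _ | refl | p = p

  compositions-induction : ∀ b → P b (compositions b κ)
  compositions-induction b = branch-induction b 0

IsComp : ℕ → ℕ → List ℕ → Set
IsComp b κ q = sumℕ q ≡ b × All (λ x → 1 ≤ x × x ≤ κ) q

IsComp-prop : ∀ b κ q → Prop (IsComp b κ q)
IsComp-prop b κ q = ×-prop ≡-prop (All.irrelevant (×-prop ≤-irrelevant ≤-irrelevant))

Lists : ℕ → ℕ → List (List ℕ) → Set
Lists κ b I = Unique I × (∀ q → q ∈ I → IsComp b κ q) × (∀ q → IsComp b κ q → q ∈ I)

compositions-lists : ∀ κ b → Lists κ b (compositions b κ)
compositions-lists κ = compositions-induction κ (Lists κ) base step
  where
  base : Lists κ 0 ([] ∷ [])
  base = [] ∷ [] , (λ { _ (here refl) → refl , [] }) , λ { [] _ → here refl ; (zero ∷ q) (_ , (() , _) ∷ _) }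
  step : ∀ r (Y : ℕ → List (List ℕ)) → (∀ i → i ≤ r → Lists κ (r ∸ i) (Y i)) →
    Lists κ (suc r) (concatMap (λ i → map (suc i ∷_) (Y i)) (filter (λ j → suc j ≤? κ) (upTo (suc r))))
  step r Y h = uniq , sound , complete
    where
    J = filter (λ j → suc j ≤? κ) (upTo (suc r))
    X = λ i → map (suc i ∷_) (Y i)
    J-bound : ∀ {i} → i ∈ J → i ≤ r × suc i ≤ κ
    J-bound i∈J with ∈-filter⁻ (λ j → suc j ≤? κ) i∈J
    ... | i∈ , i≤κ = ≤-pred (∈-upTo⁻ i∈) , i≤κ
    disjoint : ∀ {i j} → i ≢ j → ∀ {q} → ¬ (q ∈ X i × q ∈ X j)
    disjoint {i} {j} i≢j (a , b) with ∈-map⁻ (suc i ∷_) a | ∈-map⁻ (suc j ∷_) b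
    ... | _ , _ , refl | _ , _ , e = i≢j (suc-injective (List.∷-injectiveˡ e))
    uniq : Unique (concatMap X J)
    uniq = Unique.concat⁺
      (All.map⁺ (All.tabulate λ {i} i∈J → Unique.map⁺ List.∷-injectiveʳ (proj₁ (h i (proj₁ (J-bound i∈J))))))
      (AllPairs.map⁺ (AllPairs.map disjoint (Unique.filter⁺ (λ j → suc j ≤? κ) (Unique.upTo⁺ (suc r)))))
    sound : ∀ q → q ∈ concatMap X J → IsComp (suc r) κ q
    sound q q∈ with find (∈-concatMap⁻ X q∈)
    ... | i , i∈J , q∈X with ∈-map⁻ (suc i ∷_) q∈X | J-bound i∈J
    ... | q′ , q′∈ , refl | i≤r , i≤κ with proj₁ (proj₂ (h i i≤r)) q′ q′∈
    ... | e , a = cong suc (trans (cong (λ x → i + x) e) (m+[n∸m]≡n i≤r)) , (s≤s z≤n , i≤κ) ∷ a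
    complete : ∀ q → IsComp (suc r) κ q → q ∈ concatMap X J
    complete (suc i ∷ q) (e , (_ , i≤κ) ∷ a) = ∈-concatMap⁺ X (lose (∈-filter⁺ (λ j → suc j ≤? κ) (∈-upTo⁺ (s≤s i≤r)) i≤κ)
      (∈-map⁺ (suc i ∷_) (proj₂ (proj₂ (h i i≤r)) q (sym (trans (cong (_∸ i) (sym (suc-injective e))) (m+n∸m≡n i (sumℕ q))) , a))))
      where i≤r = m+n≤o⇒m≤o i (≤-reflexive (suc-injective e))

size-comps : ∀ b κ {B : List ℕ → Set} {f : List ℕ → ℕ} → (∀ q → IsComp b κ q → B q ↔ Fin (f q)) →
  Σ (List ℕ) (λ q → IsComp b κ q × B q) ↔ Fin (sumℕ (map f (compositions b κ)))
size-comps b κ with compositions-lists κ b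
... | u , sound , complete = size-Σ (compositions b κ) u complete sound (IsComp-prop b κ)

-- Embeddings, cards, and closed walks as traces

nz : List ℕ → List ℕ
nz []          = []
nz (zero ∷ l)  = nz l
nz (suc x ∷ l) = suc x ∷ nz l

sum-nz : ∀ l → sumℕ (nz l) ≡ sumℕ l
sum-nz []          = refl
sum-nz (zero ∷ l)  = sum-nz l
sum-nz (suc x ∷ l) = cong (λ s → suc x + s) (sum-nz l)

≤*-prop : ∀ {e s} → Prop (Pointwise _≤_ e s)
≤*-prop = Pointwise.irrelevant ≤-irrelevant

-- An embedding is encoded by a list as long as `r` that has the parts of `qs` at their target
-- positions and zeros elsewhere.
Embedding : List ℕ → List ℕ → List ℕ → Set
Embedding qs r e = Pointwise _≤_ e r × nz e ≡ qs

Embedding-prop : ∀ qs r e → Prop (Embedding qs r e)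
Embedding-prop qs r e = ×-prop ≤*-prop ≡-prop

-- The head of the list decides: a zero skips the position, a positive head must be the first part
-- of `qs`. This is the recursion of `embeddings`.
size-embeddings : ∀ qs r → All (1 ≤_) qs → Σ (List ℕ) (Embedding qs r) ↔ Fin (embeddings qs r)
size-embeddings [] r _ = size-contr (zeros r) λ x y → Σ-≡ (Embedding-prop [] r) (trans (sym (unique r x)) (unique r y))
  where
  zeros : ∀ r → Σ (List ℕ) (Embedding [] r)
  zeros []      = [] , [] , refl
  zeros (y ∷ r) with zeros r
  ... | e , p , z = 0 ∷ e , z≤n ∷ p , z
  unique : ∀ r → ((e , _) : Σ (List ℕ) (Embedding [] r)) → proj₁ (zeros r) ≡ e
  unique []      (_ , [] , _) = refl
  unique (y ∷ r) (zero ∷ e , _ ∷ p , z) = cong (0 ∷_) (unique r (e , p , z))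
size-embeddings (x ∷ xs) [] _ = size-empty λ { (_ , [] , ()) }
size-embeddings (suc x ∷ xs) (y ∷ ys) (_ ∷ pos) with suc x ≤? y
... | yes x≤y = ↔-trans split (size-⊎ (size-embeddings xs ys pos) (size-embeddings (suc x ∷ xs) ys (s≤s z≤n ∷ pos)))
  where
  split : Σ (List ℕ) (Embedding (suc x ∷ xs) (y ∷ ys)) ↔ (Σ (List ℕ) (Embedding xs ys) ⊎ Σ (List ℕ) (Embedding (suc x ∷ xs) ys))
  split = mk↔ₛ′
    (λ { (zero ∷ e , _ ∷ p , z) → inj₂ (e , p , z) ; (suc _ ∷ e , _ ∷ p , refl) → inj₁ (e , p , refl) })
    [ (λ { (e , p , z) → suc x ∷ e , x≤y ∷ p , cong (suc x ∷_) z }) , (λ { (e , p , z) → 0 ∷ e , z≤n ∷ p , z }) ]′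
    (λ { (inj₁ (_ , _ , refl)) → refl ; (inj₂ _) → refl })
    (λ { (zero ∷ e , z≤n ∷ p , z) → refl ; (suc _ ∷ e , _ ∷ p , refl) → Σ-≡ (Embedding-prop _ _) refl })
... | no x≰y = ↔-trans split (size-embeddings (suc x ∷ xs) ys (s≤s z≤n ∷ pos))
  where
  split : Σ (List ℕ) (Embedding (suc x ∷ xs) (y ∷ ys)) ↔ Σ (List ℕ) (Embedding (suc x ∷ xs) ys)
  split = mk↔ₛ′
    (λ { (zero ∷ e , _ ∷ p , z) → e , p , z ; (suc _ ∷ e , x≤y ∷ p , refl) → contradiction x≤y x≰y })
    (λ { (e , p , z) → 0 ∷ e , z≤n ∷ p , z })
    (λ _ → refl)
    (λ { (zero ∷ e , z≤n ∷ p , z) → refl ; (suc _ ∷ e , x≤y ∷ p , refl) → contradiction x≤y x≰y })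

-- A card sends the state q to s: `nothing` leaves it unchanged; `just e` lets the first part
-- land, the i-th part of s being made of e i balls already in the air and s i ∸ e i new ones.
Card : Set
Card = Maybe (List ℕ)

-- The head `sumℕ s ∸ sumℕ e` expresses that as many balls are thrown as have landed.
Deals : Card → List ℕ → List ℕ → Set
Deals nothing  q s = q ≡ s
Deals (just e) q s = Pointwise _≤_ e s × q ≡ (sumℕ s ∸ sumℕ e) ∷ nz e

Deals-prop : ∀ c q s → Prop (Deals c q s)
Deals-prop nothing  q s = ≡-prop
Deals-prop (just e) q s = ×-prop ≤*-prop ≡-prop

size-δ : ∀ q s → (q ≡ s) ↔ Fin (δ q s)
size-δ q s with List.≡-dec _≟_ q s
... | yes e = size-contr e ≡-prop
... | no ¬e = size-empty ¬e

-- The two kinds of card match the two summands of a matrix entry. The first part of `q` carries no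
-- choice, because `q` and `s` have the same sum.
size-Deals : ∀ {b κ} q s → IsComp b κ q → IsComp b κ s → Σ Card (λ c → Deals c q s) ↔ Fin (Aentry q s)
size-Deals {b} {κ} q s Cq Cs = ↔-trans split (size-⊎ (nontriv q Cq) (size-δ q s))
  where
  split : Σ Card (λ c → Deals c q s) ↔ (Σ (List ℕ) (λ e → Deals (just e) q s) ⊎ q ≡ s)
  split = mk↔ₛ′ (λ { (just e , d) → inj₁ (e , d) ; (nothing , d) → inj₂ d })
    [ (λ { (e , d) → just e , d }) , (λ d → nothing , d) ]′
    (λ { (inj₁ _) → refl ; (inj₂ _) → refl }) (λ { (just _ , _) → refl ; (nothing , _) → refl })
  nontriv : ∀ q → IsComp b κ q → Σ (List ℕ) (λ e → Deals (just e) q s) ↔ Fin (nontrivial q s)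
  nontriv [] _ = size-empty λ { (_ , _ , ()) }
  nontriv (q₁ ∷ qs) (sq , _ ∷ aq) = ↔-trans swap (size-embeddings qs s (All.map proj₁ aq))
    where
    first : ∀ e → nz e ≡ qs → q₁ ≡ sumℕ s ∸ sumℕ e
    first e refl = sym (trans (cong₂ _∸_ (trans (proj₁ Cs) (sym sq)) (sym (sum-nz e))) (m+n∸n≡m q₁ (sumℕ (nz e))))
    swap : Σ (List ℕ) (λ e → Deals (just e) (q₁ ∷ qs) s) ↔ Σ (List ℕ) (Embedding qs s)
    swap = mk↔ₛ′ (λ { (e , p , d) → e , p , sym (List.∷-injectiveʳ d) })
      (λ { (e , p , z) → e , p , cong₂ _∷_ (first e z) (sym z) })
      (λ _ → Σ-≡ (Embedding-prop qs s) refl) (λ _ → Σ-≡ (λ e → Deals-prop (just e) (q₁ ∷ qs) s) refl)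

module _ (b κ : ℕ) where
  Path : ℕ → List ℕ → List ℕ → Set
  Path zero    q r = q ≡ r
  Path (suc n) q r = Σ (List ℕ) λ s → IsComp b κ s × Σ Card (λ c → Deals c q s) × Path n s r

  size-Path : ∀ n q r → IsComp b κ q → Path n q r ↔ Fin (_^^_ (compositions b κ) Aentry n q r)
  size-Path zero    q r _  = size-δ q r
  size-Path (suc n) q r Cq = size-comps b κ λ s Cs → size-× (size-Deals q s Cq Cs) (size-Path n s r Cs)

  ClosedWalk : ℕ → Set
  ClosedWalk n = Σ (List ℕ) λ q → IsComp b κ q × Path n q q

  size-ClosedWalk : ∀ n → ClosedWalk n ↔ Fin (trA^ b κ n)
  size-ClosedWalk n = size-comps b κ λ q Cq → size-Path n q q Cq

-- Residues and periodic sequences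

module _ (n : ℕ) .{{_ : NonZero n}} where

  mod-cong : ∀ {a b} → a % n ≡ b % n → a mod n ≡ b mod n
  mod-cong {a} {b} e = Fin.toℕ-injective (trans (Fin.toℕ-fromℕ< _) (trans e (sym (Fin.toℕ-fromℕ< _))))

  toℕ-mod : ∀ a → toℕ (a mod n) ≡ a % n
  toℕ-mod a = Fin.toℕ-fromℕ< _

  mod-toℕ : ∀ (i : Fin n) → toℕ i mod n ≡ i
  mod-toℕ i = Fin.toℕ-injective (trans (toℕ-mod (toℕ i)) (DivMod.m<n⇒m%n≡m (Fin.toℕ<n i)))

  %-+ : ∀ a b → (a % n + b) % n ≡ (a + b) % n
  %-+ a b = trans (DivMod.%-distribˡ-+ (a % n) b n)
    (trans (cong (λ x → (x + b % n) % n) (DivMod.m%n%n≡m%n a n)) (sym (DivMod.%-distribˡ-+ a b n)))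

  %-cancel-+ : ∀ a b c → (a + c) % n ≡ (b + c) % n → a % n ≡ b % n
  %-cancel-+ a b c e = trans (sym (shift a)) (trans (cong (λ x → (x + c′) % n) e) (shift b))
    where
    -- The complement of `c` to a multiple of `n` serves as its negative.
    c′ = c * n ∸ c
    c≤cn : c ≤ c * n
    c≤cn = m≤m*n c n
    shift : ∀ x → ((x + c) % n + c′) % n ≡ x % n
    shift x = trans (%-+ (x + c) c′) (trans (cong (_% n) (trans (+-assoc x c c′) (cong (λ y → x + y) (m+[n∸m]≡n c≤cn)))) (DivMod.[m+kn]%n≡m%n x c n))

  module _ {A : Set} where

    Periodic : (ℕ → A) → Set
    Periodic f = ∀ t → f (t + n) ≡ f t

    periodic-* : ∀ {f} → Periodic f → ∀ k t → f (t + k * n) ≡ f t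
    periodic-* {f} p zero t = cong f (+-identityʳ t)
    periodic-* {f} p (suc k) t = trans (cong f (trans (cong (λ x → t + x) (+-comm n (k * n))) (sym (+-assoc t (k * n) n))))
      (trans (p (t + k * n)) (periodic-* p k t))

    periodic-% : ∀ {f} → Periodic f → ∀ t → f (t % n) ≡ f t
    periodic-% {f} p t = trans (sym (periodic-* p (t / n) (t % n))) (cong f (sym (DivMod.m≡m%n+[m/n]*n t n)))

    periodic-≡% : ∀ {f} → Periodic f → ∀ {s t} → s % n ≡ t % n → f s ≡ f t
    periodic-≡% {f} p e = trans (sym (periodic-% p _)) (trans (cong f e) (periodic-% p _))

    -- Patterns are treated as periodic functions on all times, so that throws may cross the end of
    -- the period.
    per : Vec A n → ℕ → A
    per v t = lookup v (t mod n)

    per-toℕ : ∀ v i → per v (toℕ i) ≡ lookup v i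
    per-toℕ v i = cong (lookup v) (mod-toℕ i)

    per-periodic : ∀ v → Periodic (per v)
    per-periodic v t = cong (lookup v) (mod-cong (DivMod.[m+n]%n≡m%n t n))

    unper : (ℕ → A) → Vec A n
    unper f = tabulate (f ∘ toℕ)

    per-unper : ∀ {f} → Periodic f → ∀ t → per (unper f) t ≡ f t
    per-unper {f} p t = trans (V.lookup∘tabulate (f ∘ toℕ) (t mod n)) (trans (cong f (toℕ-mod t)) (periodic-% p t))

    per-injective : ∀ {v w} → (∀ t → per v t ≡ per w t) → v ≡ w
    per-injective {v} {w} h = trans (sym (V.tabulate∘lookup v))
      (trans (V.tabulate-cong λ i → trans (sym (per-toℕ v i)) (trans (h (toℕ i)) (per-toℕ w i))) (V.tabulate∘lookup w))

∑-periodic-suc : ∀ n {f : ℕ → ℕ} → f n ≡ f 0 → ∑ n (f ∘ suc) ≡ ∑ n f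
∑-periodic-suc n {f} e = +-cancelʳ-≡ (f 0) _ _ (begin
  ∑ n (f ∘ suc) + f 0 ≡⟨ +-comm _ (f 0) ⟩
  ∑ (suc n) f         ≡⟨ ∑-last n f ⟩
  ∑ n f + f n         ≡⟨ cong (λ x → ∑ n f + x) e ⟩
  ∑ n f + f 0         ∎)
  where open ≡-Reasoning

-- Multisets of heights and their multiplicities

sum-tabulate : ∀ n {g : Fin n → ℕ} {f : ℕ → ℕ} → (∀ i → g i ≡ f (toℕ i)) → sumℕ (Data.List.tabulate g) ≡ ∑ n f
sum-tabulate zero    h = refl
sum-tabulate (suc n) h = cong₂ _+_ (h zero) (sum-tabulate n (h ∘ suc))

sum-allFin : ∀ n {g : Fin n → ℕ} {f : ℕ → ℕ} → (∀ i → g i ≡ f (toℕ i)) → sumℕ (map g (allFin n)) ≡ ∑ n f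
sum-allFin n {g} h = trans (cong sumℕ (List.map-tabulate {n = n} id g)) (sum-tabulate n h)

Vec-sum : ∀ {A : Set} {n} (g : A → ℕ) (v : Vec A n) {f : ℕ → ℕ} → (∀ i → g (lookup v i) ≡ f (toℕ i)) → V.sum (V.map g v) ≡ ∑ n f
Vec-sum g []      h = refl
Vec-sum g (x ∷ v) h = cong₂ _+_ (h zero) (Vec-sum g v (h ∘ suc))

module _ {A : Set} {P : A → Set} where
  VAll-lookup : ∀ {n} {v : Vec A n} → VAll.All P v → ∀ i → P (lookup v i)
  VAll-lookup (p VAll.∷ ps) zero    = p
  VAll-lookup (p VAll.∷ ps) (suc i) = VAll-lookup ps i

  VAll-tabulate : ∀ {n} {v : Vec A n} → (∀ i → P (lookup v i)) → VAll.All P v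
  VAll-tabulate {v = []}    h = VAll.[]
  VAll-tabulate {v = x ∷ v} h = h zero VAll.∷ VAll-tabulate (h ∘ suc)

  VAll-prop : (∀ a → Prop (P a)) → ∀ {n} {v : Vec A n} → Prop (VAll.All P v)
  VAll-prop irr VAll.[] VAll.[] = refl
  VAll-prop irr (p VAll.∷ ps) (q VAll.∷ qs) = cong₂ VAll._∷_ (irr _ p q) (VAll-prop irr ps qs)

-- Heights are positive, so the index `h` stands for the height `suc h`, here and in all throw
-- functions.
count : ℕ → List ℕ → ℕ
count h []      = 0
count h (x ∷ l) = [ x ≟ suc h ]· 1 + count h l

Between : ℕ → ℕ → Set
Between H x = 1 ≤ x × x ≤ H

-- Turns a count over a list into a sum over heights, which can then be interchanged with a sum over
-- times.
length-filter : ∀ {P : ℕ → Set} (P? : ∀ h → Dec (P h)) H {l} → All (Between H) l →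
  length (filter P? l) ≡ ∑ H (λ h → [ P? (suc h) ]· count h l)
length-filter P? H []       = sym (∑-zero H λ h _ → []·-zero (P? (suc h)) refl)
length-filter {P} P? H {suc x ∷ l} ((_ , x<H) ∷ a) = begin
  length (filter P? (suc x ∷ l))                                           ≡⟨ head-filter (P? (suc x)) refl ⟩
  [ P? (suc x) ]· 1 + length (filter P? l)                                 ≡⟨ cong₂ _+_ (sym point) (length-filter P? H a) ⟩
  ∑ H (λ h → [ P? (suc h) ]· ([ suc x ≟ suc h ]· 1)) + ∑ H (λ h → [ P? (suc h) ]· count h l)
                                                                           ≡⟨ sym (∑-⊕ H _ _) ⟩
  ∑ H (λ h → [ P? (suc h) ]· ([ suc x ≟ suc h ]· 1) + [ P? (suc h) ]· count h l)
                                                                           ≡⟨ ∑-cong H (λ h _ → sym ([]·-+ (P? (suc h)) _ _)) ⟩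
  ∑ H (λ h → [ P? (suc h) ]· count h (suc x ∷ l))                          ∎
  where
  open ≡-Reasoning
  []·-+ : ∀ {Q : Set} (d : Dec Q) a b → [ d ]· (a + b) ≡ [ d ]· a + [ d ]· b
  []·-+ (yes _) a b = refl
  []·-+ (no _)  a b = refl
  head-filter : (d : Dec (P (suc x))) → P? (suc x) ≡ d → length (filter P? (suc x ∷ l)) ≡ [ d ]· 1 + length (filter P? l)
  head-filter (yes p) e = cong length (List.filter-accept P? p)
  head-filter (no ¬p) e = cong length (List.filter-reject P? ¬p)
  point : ∑ H (λ h → [ P? (suc h) ]· ([ suc x ≟ suc h ]· 1)) ≡ [ P? (suc x) ]· 1
  point = trans (∑-single H x x<H λ i _ i≢x → []·-zero (P? (suc i)) ([]·-no (suc x ≟ suc i) λ e → i≢x (sym (suc-injective e))))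
    ([]·-cong (P? (suc x)) λ _ → []·-yes (suc x ≟ suc x) refl)

∑-count : ∀ H {l} → All (Between H) l → ∑ H (λ h → count h l) ≡ length l
∑-count H {l} a = trans (sym (length-filter (λ _ → yes tt) H a)) (cong length (List.filter-all (λ _ → yes tt) (All.universal _ l)))

∑-weighted-count : ∀ H {l} → All (Between H) l → ∑ H (λ h → suc h * count h l) ≡ sumℕ l
∑-weighted-count H []       = ∑-zero H λ h _ → *-zeroʳ h
∑-weighted-count H {suc x ∷ l} ((_ , x<H) ∷ a) = begin
  ∑ H (λ h → suc h * ([ suc x ≟ suc h ]· 1 + count h l))                   ≡⟨ ∑-cong H (λ h _ → *-distribˡ-+ (suc h) ([ suc x ≟ suc h ]· 1) (count h l)) ⟩
  ∑ H (λ h → suc h * ([ suc x ≟ suc h ]· 1) + suc h * count h l)           ≡⟨ ∑-⊕ H _ _ ⟩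
  ∑ H (λ h → suc h * ([ suc x ≟ suc h ]· 1)) + ∑ H (λ h → suc h * count h l)
                                                                           ≡⟨ cong₂ _+_ point (∑-weighted-count H a) ⟩
  suc x + sumℕ l                                                           ∎
  where
  open ≡-Reasoning
  point : ∑ H (λ h → suc h * ([ suc x ≟ suc h ]· 1)) ≡ suc x
  point = trans (∑-single H x x<H λ i _ i≢x → trans (cong (suc i *_) ([]·-no (suc x ≟ suc i) λ e → i≢x (sym (suc-injective e)))) (*-zeroʳ i))
    (trans (cong (suc x *_) ([]·-yes (suc x ≟ suc x) refl)) (*-identityʳ (suc x)))

count-above : ∀ h {l} → All (_≤ h) l → count h l ≡ 0
count-above h []            = refl
count-above h {x ∷ l} (x≤h ∷ a) = cong₂ _+_ ([]·-no (x ≟ suc h) λ { refl → <-irrefl refl x≤h }) (count-above h a)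

Descending : List ℕ → Set
Descending = Linked (λ x y → y ≤ x)

head-max : ∀ {x l} → Descending (x ∷ l) → All (_≤ x) (x ∷ l)
head-max [-]      = ≤-refl ∷ []
head-max (p ∷ ps) = ≤-refl ∷ All.map (λ q → ≤-trans q p) (head-max ps)

tail-descending : ∀ {x l} → Descending (x ∷ l) → Descending l
tail-descending [-]      = []
tail-descending (p ∷ ps) = ps

-- The heads are the largest entries. They agree, since a larger head would be an entry that the
-- other list lacks; cancelling them leaves equal multiplicities.
descending-unique : ∀ {l l′} → All (1 ≤_) l → All (1 ≤_) l′ → Descending l → Descending l′ → (∀ h → count h l ≡ count h l′) → l ≡ l′
descending-unique {[]}        {[]}         _ _ _ _ e = refl
descending-unique {[]}        {zero ∷ l′}  _ (() ∷ _)
descending-unique {zero ∷ l}  {[]}         (() ∷ _)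
descending-unique {[]}        {suc x ∷ l′} _ _ _ _ e = contradiction (trans (e x) (cong (_+ count x l′) ([]·-yes (suc x ≟ suc x) refl))) λ ()
descending-unique {suc x ∷ l} {[]}         _ _ _ _ e = contradiction (trans (sym (e x)) (cong (_+ count x l) ([]·-yes (suc x ≟ suc x) refl))) λ ()
descending-unique {suc x ∷ l} {suc y ∷ l′} (_ ∷ a) (_ ∷ a′) d d′ e =
  subst (λ z → suc x ∷ l ≡ suc z ∷ l′) x≡y (cong (suc x ∷_) (descending-unique a a′ (tail-descending d) (tail-descending d′) rest))
  where
  bound : ∀ {x y l l′} → Descending (suc y ∷ l′) → count x (suc x ∷ l) ≡ count x (suc y ∷ l′) → x ≤ y
  bound {x} {y} {l} {l′} d e with x ≤? y
  ... | yes x≤y = x≤y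
  ... | no x≰y = contradiction (trans (sym (count-above x (All.map (λ p → ≤-trans p (≰⇒> x≰y)) (head-max d))))
                                      (trans (sym e) (cong (_+ count x l) ([]·-yes (suc x ≟ suc x) refl)))) λ ()
  x≡y : x ≡ y
  x≡y = ≤-antisym (bound {l = l} d′ (e x)) (bound {l = l′} d (sym (e y)))
  rest : ∀ h → count h l ≡ count h l′
  rest h = +-cancelˡ-≡ ([ suc x ≟ suc h ]· 1) _ _ (trans (e h) (cong (λ z → [ suc z ≟ suc h ]· 1 + count h l′) (sym x≡y)))

fromCounts : (ℕ → ℕ) → ℕ → List ℕ
fromCounts m zero    = []
fromCounts m (suc k) = replicate (m k) (suc k) ++ fromCounts m k

fromCounts-cong : ∀ {m m′} H → (∀ h → m h ≡ m′ h) → fromCounts m H ≡ fromCounts m′ H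
fromCounts-cong zero    e = refl
fromCounts-cong (suc H) e = cong₂ (λ c l → replicate c (suc H) ++ l) (e H) (fromCounts-cong H e)

count-replicate : ∀ h c k l → count h (replicate c (suc k) ++ l) ≡ [ k ≟ h ]· c + count h l
count-replicate h zero    k l = cong (_+ count h l) (sym ([]·-zero (k ≟ h) refl))
count-replicate h (suc c) k l = trans (cong (λ x → [ suc k ≟ suc h ]· 1 + x) (count-replicate h c k l)) (go (k ≟ h))
  where
  go : Dec (k ≡ h) → [ suc k ≟ suc h ]· 1 + ([ k ≟ h ]· c + count h l) ≡ [ k ≟ h ]· suc c + count h l
  go (yes e) = trans (cong₂ (λ a b → a + (b + count h l)) ([]·-yes (suc k ≟ suc h) (cong suc e)) ([]·-yes (k ≟ h) e))
    (cong (_+ count h l) (sym ([]·-yes (k ≟ h) e)))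
  go (no ¬e) = trans (cong₂ (λ a b → a + (b + count h l)) ([]·-no (suc k ≟ suc h) (¬e ∘ suc-injective)) ([]·-no (k ≟ h) ¬e))
    (cong (_+ count h l) (sym ([]·-no (k ≟ h) ¬e)))

fromCounts-between : ∀ m H → All (Between H) (fromCounts m H)
fromCounts-between m zero    = []
fromCounts-between m (suc H) = All.++⁺ (All.replicate⁺ (m H) (s≤s z≤n , ≤-refl)) (All.map (λ { (p , q) → p , m≤n⇒m≤1+n q }) (fromCounts-between m H))

count-fromCounts : ∀ m H h → h < H → count h (fromCounts m H) ≡ m h
count-fromCounts m (suc H) h (s≤s h≤H) = trans (count-replicate h (m H) H (fromCounts m H)) (split (m≤n⇒m<n∨m≡n h≤H))
  where
  split : h < H ⊎ h ≡ H → [ H ≟ h ]· m H + count h (fromCounts m H) ≡ m h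
  split (inj₁ h<H)  = cong₂ _+_ ([]·-no (H ≟ h) λ { refl → <-irrefl refl h<H }) (count-fromCounts m H h h<H)
  split (inj₂ refl) = trans (cong₂ _+_ ([]·-yes (H ≟ H) refl) (count-above H (All.map proj₂ (fromCounts-between m H)))) (+-identityʳ (m H))

descending-∷ : ∀ {x l} → All (_≤ x) l → Descending l → Descending (x ∷ l)
descending-∷ []      []        = [-]
descending-∷ (p ∷ _) [-]       = p ∷ [-]
descending-∷ (p ∷ _) (q ∷ d)   = p ∷ q ∷ d

fromCounts-descending : ∀ m H → Descending (fromCounts m H)
fromCounts-descending m zero    = []
fromCounts-descending m (suc H) = go (m H)
  where
  below : All (_≤ suc H) (fromCounts m H)
  below = All.map (λ p → m≤n⇒m≤1+n (proj₂ p)) (fromCounts-between m H)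
  go : ∀ c → Descending (replicate c (suc H) ++ fromCounts m H)
  go zero    = fromCounts-descending m H
  go (suc c) = descending-∷ (All.++⁺ (All.replicate⁺ c ≤-refl) below) (go c)

Multiset-≡ : {M N : Multiset} → proj₁ M ≡ proj₁ N → M ≡ N
Multiset-≡ = Σ-≡ λ _ → ×-prop (All.irrelevant ≤-irrelevant) (Linked.irrelevant ≤-irrelevant)

multiset : (ℕ → ℕ) → ℕ → Multiset
multiset m H = fromCounts m H , All.map proj₁ (fromCounts-between m H) , fromCounts-descending m H

-- Siteswaps and their schedules

-- landed m t j counts the balls thrown at the times t, …, t + j ∸ 1 that land at time t + j,
-- where m t h balls are thrown at time t to height suc h.
landed : (ℕ → ℕ → ℕ) → ℕ → ℕ → ℕ
landed m t zero    = 0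
landed m t (suc j) = m t j + landed m (suc t) j

-- The two sides run through the same throws in opposite orders, one by increasing height, the other
-- by increasing time of the throw.
landed-∑ : ∀ m t j → ∑ j (λ h → m (t + (j ∸ suc h)) h) ≡ landed m t j
landed-∑ m t zero    = refl
landed-∑ m t (suc j) = begin
  ∑ (suc j) (λ h → m (t + (suc j ∸ suc h)) h)            ≡⟨ ∑-last j _ ⟩
  ∑ j (λ h → m (t + (j ∸ h)) h) + m (t + (j ∸ j)) j      ≡⟨ cong₂ _+_ (∑-cong j shift) (cong (λ x → m x j) (trans (cong (λ x → t + x) (n∸n≡0 j)) (+-identityʳ t))) ⟩
  ∑ j (λ h → m (suc t + (j ∸ suc h)) h) + m t j          ≡⟨ +-comm _ (m t j) ⟩
  m t j + ∑ j (λ h → m (suc t + (j ∸ suc h)) h)          ≡⟨ cong (λ x → m t j + x) (landed-∑ m (suc t) j) ⟩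
  m t j + landed m (suc t) j                             ∎
  where
  open ≡-Reasoning
  shift : ∀ h → h < j → m (t + (j ∸ h)) h ≡ m (suc t + (j ∸ suc h)) h
  shift h h<j = cong (λ x → m x h) (trans (cong (λ x → t + x) (+-∸-assoc 1 h<j)) (+-suc t (j ∸ suc h)))

landed-cong : ∀ {m m′} → (∀ t h → m t h ≡ m′ t h) → ∀ t j → landed m t j ≡ landed m′ t j
landed-cong e t zero    = refl
landed-cong e t (suc j) = cong₂ _+_ (e t j) (landed-cong e (suc t) j)

landed-shift : ∀ {m} p → (∀ t h → m (t + p) h ≡ m t h) → ∀ t j → landed m (t + p) j ≡ landed m t j
landed-shift p e t zero    = refl
landed-shift p e t (suc j) = cong₂ _+_ (e t j) (landed-shift p e (suc t) j)

-- Both sides concern the same landing time; starting `k` beats earlier can only add throws.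
landed-earlier : ∀ m k t j → landed m (k + t) j ≤ landed m t (k + j)
landed-earlier m zero    t j = ≤-refl
landed-earlier m (suc k) t j = ≤-trans (subst (λ x → landed m x j ≤ landed m (suc t) (k + j)) (+-suc k t) (landed-earlier m k (suc t) j)) (m≤n+m _ (m t (k + j)))

-- y t j is the number of balls in the air at time t that will land at time t + j.
module Dynamics (H : ℕ) (y m : ℕ → ℕ → ℕ)
  (evolve : ∀ t j → y (suc t) j ≡ y t (suc j) + m t j) (finite : ∀ t j → H ≤ j → y t j ≡ 0) where
  open ≡-Reasoning

  ∑-suc : ∀ t → ∑ (suc H) (y t) ≡ ∑ H (y t)
  ∑-suc t = ∑-extend (y t) (n≤1+n H) λ i H≤i _ → finite t i H≤i

  balls-suc : ∀ t → ∑ H (y (suc t)) + y t 0 ≡ ∑ H (y t) + ∑ H (m t)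
  balls-suc t = begin
    ∑ H (y (suc t)) + y t 0                       ≡⟨ cong (_+ y t 0) (trans (∑-cong H λ j _ → evolve t j) (∑-⊕ H _ _)) ⟩
    ∑ H (y t ∘ suc) + ∑ H (m t) + y t 0           ≡⟨ +-comm _ (y t 0) ⟩
    y t 0 + (∑ H (y t ∘ suc) + ∑ H (m t))         ≡⟨ sym (+-assoc (y t 0) _ _) ⟩
    ∑ (suc H) (y t) + ∑ H (m t)                   ≡⟨ cong (_+ ∑ H (m t)) (∑-suc t) ⟩
    ∑ H (y t) + ∑ H (m t)                         ∎

  module _ (thrown : ∀ t → ∑ H (m t) ≡ y t 0) where

    balls-const : ∀ t → ∑ H (y t) ≡ ∑ H (y 0)
    balls-const zero    = refl
    balls-const (suc t) = trans (+-cancelʳ-≡ (y t 0) _ _ (trans (balls-suc t) (cong (λ x → ∑ H (y t) + x) (thrown t)))) (balls-const t)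

    -- A measure of the remaining air time. Each beat lowers it by one per ball and raises it by the
    -- heights thrown; over a period it returns to its value, so the total height is `n` times the
    -- number of balls.
    potential : ℕ → ℕ
    potential t = ∑ H (λ j → suc j * y t j)

    potential-suc : ∀ t → potential (suc t) + ∑ H (y t) ≡ potential t + ∑ H (λ j → suc j * m t j)
    potential-suc t = begin
      potential (suc t) + ∑ H (y t)                                              ≡⟨ cong (_+ ∑ H (y t)) (trans (∑-cong H λ j _ → trans (cong (suc j *_) (evolve t j)) (*-distribˡ-+ (suc j) (y t (suc j)) (m t j))) (∑-⊕ H _ _)) ⟩
      ∑ (suc H) (λ j → j * y t j) + ∑ H (λ j → suc j * m t j) + ∑ H (y t)        ≡⟨ +-comm _ (∑ H (y t)) ⟩
      ∑ H (y t) + (∑ (suc H) (λ j → j * y t j) + ∑ H (λ j → suc j * m t j))      ≡⟨ sym (+-assoc (∑ H (y t)) _ _) ⟩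
      ∑ H (y t) + ∑ (suc H) (λ j → j * y t j) + ∑ H (λ j → suc j * m t j)        ≡⟨ cong (λ x → ∑ H (y t) + x + ∑ H (λ j → suc j * m t j))
                                                                                      (∑-extend _ (n≤1+n H) λ i H≤i _ → trans (cong (i *_) (finite t i H≤i)) (*-zeroʳ i)) ⟩
      ∑ H (y t) + ∑ H (λ j → j * y t j) + ∑ H (λ j → suc j * m t j)              ≡⟨ cong (_+ ∑ H (λ j → suc j * m t j)) (sym (∑-⊕ H (y t) _)) ⟩
      potential t + ∑ H (λ j → suc j * m t j)                                    ∎

    total-height : ∀ n → (∀ j → y n j ≡ y 0 j) → ∑ n (λ t → ∑ H (λ j → suc j * m t j)) ≡ n * ∑ H (y 0)
    total-height n per = sym (+-cancelˡ-≡ (∑ n potential) _ _ (begin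
      ∑ n potential + n * ∑ H (y 0)                          ≡⟨ cong₂ _+_ (sym (∑-periodic-suc n (∑-cong H λ j _ → cong (suc j *_) (per j))))
                                                                  (trans (sym (∑-const n _)) (∑-cong n λ t _ → sym (balls-const t))) ⟩
      ∑ n (potential ∘ suc) + ∑ n (λ t → ∑ H (y t))          ≡⟨ sym (∑-⊕ n _ _) ⟩
      ∑ n (λ t → potential (suc t) + ∑ H (y t))              ≡⟨ ∑-cong n (λ t _ → potential-suc t) ⟩
      ∑ n (λ t → potential t + ∑ H (λ j → suc j * m t j))    ≡⟨ ∑-⊕ n _ _ ⟩
      ∑ n potential + ∑ n (λ t → ∑ H (λ j → suc j * m t j))  ∎))

-- A siteswap seen through its schedule alone: `inherits` makes the throws recoverable as the
-- increments from `y t (suc j)` to `y (suc t) j`.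
record Schedule (n b κ H : ℕ) (y : ℕ → ℕ → ℕ) : Set where
  field
    recurs   : ∀ t j → y (t + n) j ≡ y t j
    inherits : ∀ t j → y t (suc j) ≤ y (suc t) j
    finite   : ∀ t j → H ≤ j → y t j ≡ 0
    total    : ∀ t → ∑ H (y t) ≡ b
    capped   : ∀ t j → y t j ≤ κ

-- The landing condition over all times: if no height exceeds `H`, then looking back `j ≥ H` beats
-- finds every throw that lands at `t + j`.
Balanced : ℕ → (ℕ → List ℕ) → Set
Balanced H F = ∀ t j → H ≤ j → landed (λ s h → count h (F s)) t j ≡ length (F (t + j))

module _ {n : ℕ} .{{_ : NonZero n}} where

  heights : Vec Multiset n → ℕ → List ℕ
  heights T t = proj₁ (per n T t)

  heights-periodic : ∀ T → Periodic n (heights T)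
  heights-periodic T t = cong proj₁ (per-periodic n T t)

  throws : Vec Multiset n → ℕ → ℕ → ℕ
  throws T t h = count h (heights T t)

  -- After interchanging the sums, each height `suc h` leaves a single residue of times, that of the
  -- throw made `suc h` beats before `t + j`.
  landings-landed : ∀ H T → (∀ t → All (Between H) (heights T t)) → ∀ t j → H ≤ j →
    landings n T ((t + j) mod n) ≡ landed (throws T) t j
  landings-landed H T bd t j H≤j = begin
    landings n T u                                                                        ≡⟨ sum-allFin n expand ⟩
    ∑ n (λ s → ∑ j (λ h → [ ((s + suc h) % n) ≟ toℕ u ]· throws T s h))                   ≡⟨ ∑-swap n j _ ⟩
    ∑ j (λ h → ∑ n (λ s → [ ((s + suc h) % n) ≟ toℕ u ]· throws T s h))                   ≡⟨ ∑-cong j source ⟩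
    ∑ j (λ h → throws T (t + (j ∸ suc h)) h)                                              ≡⟨ landed-∑ (throws T) t j ⟩
    landed (throws T) t j                                                                 ∎
    where
    open ≡-Reasoning
    u = (t + j) mod n
    expand : ∀ i → length (filter (λ h → ((toℕ i + h) % n) ≟ toℕ u) (proj₁ (lookup T i))) ≡ ∑ j (λ h → [ ((toℕ i + suc h) % n) ≟ toℕ u ]· throws T (toℕ i) h)
    expand i = trans (cong (λ l → length (filter (λ h → ((toℕ i + h) % n) ≟ toℕ u) l)) (cong proj₁ (sym (per-toℕ n T i))))
      (length-filter (λ h → ((toℕ i + h) % n) ≟ toℕ u) j (All.map (λ { (p , q) → p , ≤-trans q H≤j }) (bd (toℕ i))))
    source : ∀ h → h < j → ∑ n (λ s → [ ((s + suc h) % n) ≟ toℕ u ]· throws T s h) ≡ throws T (t + (j ∸ suc h)) h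
    source h h<j = trans (∑-single n s₀ (DivMod.m%n<n _ n) λ s s<n s≢s₀ → []·-no (((s + suc h) % n) ≟ toℕ u) λ e → s≢s₀ (found s s<n e))
      (trans ([]·-yes (((s₀ + suc h) % n) ≟ toℕ u) lands) (cong (count h) (periodic-% n (heights-periodic T) (t + (j ∸ suc h)))))
      where
      s₀ = (t + (j ∸ suc h)) % n
      back : t + (j ∸ suc h) + suc h ≡ t + j
      back = trans (+-assoc t (j ∸ suc h) (suc h)) (cong (λ x → t + x) (m∸n+n≡m h<j))
      lands : (s₀ + suc h) % n ≡ toℕ u
      lands = trans (%-+ n (t + (j ∸ suc h)) (suc h)) (trans (cong (_% n) back) (sym (toℕ-mod n (t + j))))
      found : ∀ s → s < n → (s + suc h) % n ≡ toℕ u → s ≡ s₀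
      found s s<n e = trans (sym (DivMod.m<n⇒m%n≡m s<n))
        (%-cancel-+ n s (t + (j ∸ suc h)) (suc h) (trans e (trans (toℕ-mod n (t + j)) (cong (_% n) (sym back)))))

  balanced⇒landings : ∀ H T → (∀ t → All (Between H) (heights T t)) → Balanced H (heights T) → V.map size T ≡ tabulate (landings n T)
  balanced⇒landings H T bd bal = trans (sym (V.tabulate∘lookup (V.map size T))) (V.tabulate-cong λ i → begin
    lookup (V.map size T) i                      ≡⟨ V.lookup-map i size T ⟩
    size (lookup T i)                            ≡⟨ cong size (sym (per-toℕ n T i)) ⟩
    -- A look-back of `H * n` beats is at least `H` long and ends in the residue class of `i`.
    length (heights T (toℕ i))                   ≡⟨ cong length (sym (periodic-* n (heights-periodic T) H (toℕ i))) ⟩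
    length (heights T (toℕ i + H * n))           ≡⟨ sym (bal (toℕ i) (H * n) (m≤m*n H n)) ⟩
    landed (throws T) (toℕ i) (H * n)            ≡⟨ sym (landings-landed H T bd (toℕ i) (H * n) (m≤m*n H n)) ⟩
    landings n T ((toℕ i + H * n) mod n)         ≡⟨ cong (landings n T) (trans (mod-cong n (DivMod.[m+kn]%n≡m%n (toℕ i) H n)) (mod-toℕ n i)) ⟩
    landings n T i                               ∎)
    where open ≡-Reasoning

  landings⇒balanced : ∀ H T → (∀ t → All (Between H) (heights T t)) → V.map size T ≡ tabulate (landings n T) → Balanced H (heights T)
  landings⇒balanced H T bd e t j H≤j = begin
    landed (throws T) t j                        ≡⟨ sym (landings-landed H T bd t j H≤j) ⟩
    landings n T ((t + j) mod n)                 ≡⟨ sym (V.lookup∘tabulate (landings n T) _) ⟩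
    lookup (tabulate (landings n T)) ((t + j) mod n) ≡⟨ cong (λ v → lookup v ((t + j) mod n)) (sym e) ⟩
    lookup (V.map size T) ((t + j) mod n)        ≡⟨ V.lookup-map _ size T ⟩
    length (heights T (t + j))                   ∎
    where open ≡-Reasoning

  totalHeight-∑ : ∀ T → totalHeight T ≡ ∑ n (λ t → sumℕ (heights T t))
  totalHeight-∑ T = Vec-sum (λ M → sumℕ (proj₁ M)) T λ i → cong (sumℕ ∘ proj₁) (sym (per-toℕ n T i))

  heights-between : ∀ {h} T → totalHeight T ≡ h → ∀ t → All (Between h) (heights T t)
  heights-between T refl t = All.zipWith id (proj₁ (proj₂ (per n T t)) , All.tabulate bound)
    where
    element-≤ : ∀ {x l} → x ∈ l → x ≤ sumℕ l
    element-≤ (here refl) = m≤m+n _ _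
    element-≤ (there i)   = ≤-trans (element-≤ i) (m≤n+m _ _)
    term-≤ : ∀ n (f : ℕ → ℕ) k → k < n → f k ≤ ∑ n f
    term-≤ (suc n) f zero    _         = m≤m+n (f 0) _
    term-≤ (suc n) f (suc k) (s≤s k<n) = ≤-trans (term-≤ n (f ∘ suc) k k<n) (m≤n+m _ (f 0))
    bound : ∀ {x} → x ∈ heights T t → x ≤ totalHeight T
    bound i = ≤-trans (element-≤ i) (≤-trans (≤-reflexive (cong sumℕ (sym (periodic-% n (heights-periodic T) t))))
      (≤-trans (term-≤ n (λ s → sumℕ (heights T s)) (t % n) (DivMod.m%n<n t n)) (≤-reflexive (sym (totalHeight-∑ T)))))

  -- As many balls land at `t + j` as are thrown then. Subtracting those thrown from time `t` on
  -- leaves the ones already in the air at time `t`.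
  schedule : Vec Multiset n → ℕ → ℕ → ℕ
  schedule T t j = length (heights T (t + j)) ∸ landed (throws T) t j

  module _ {b κ : ℕ} (P : Siteswap n b κ) (H : ℕ) (nb≤H : n * b ≤ H) where
    private
      T     = proj₁ P
      lands = proj₁ (proj₂ P)
      total = proj₁ (proj₂ (proj₂ P))
      caps  = proj₂ (proj₂ (proj₂ P))
      m = throws T
      y = schedule T

    between : ∀ t → All (Between H) (heights T t)
    between t = All.map (λ { (p , q) → p , ≤-trans q nb≤H }) (heights-between T total t)

    balanced : Balanced H (heights T)
    balanced = landings⇒balanced H T between lands

    -- Makes the truncated subtraction in `schedule` exact. Moved `H` periods later, the window can
    -- be extended backwards to length at least `H`, where the landing condition applies.
    landed-≤ : ∀ t j → landed m t j ≤ length (heights T (t + j))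
    landed-≤ t j = begin
      landed m t j                             ≡⟨ sym (landed-shift (H * n) (λ s h → cong (count h) (periodic-* n (heights-periodic T) H s)) t j) ⟩
      landed m (t + H * n) j                   ≡⟨ cong (λ x → landed m x j) (+-comm t (H * n)) ⟩
      landed m (H * n + t) j                   ≤⟨ landed-earlier m (H * n) t j ⟩
      landed m t (H * n + j)                   ≡⟨ balanced t (H * n + j) (≤-trans (m≤m*n H n) (m≤m+n (H * n) j)) ⟩
      length (heights T (t + (H * n + j)))     ≡⟨ cong (length ∘ heights T) (trans (cong (λ x → t + x) (+-comm (H * n) j)) (sym (+-assoc t j (H * n)))) ⟩
      length (heights T (t + j + H * n))       ≡⟨ cong length (periodic-* n (heights-periodic T) H (t + j)) ⟩
      length (heights T (t + j))               ∎
      where open ≤-Reasoning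

    schedule-evolve : ∀ t j → y (suc t) j ≡ y t (suc j) + m t j
    schedule-evolve t j = begin
      N ∸ landed m (suc t) j                                 ≡⟨ cong (_∸ landed m (suc t) j) (sym (m∸n+n≡m L≤N)) ⟩
      N ∸ (m t j + L) + (m t j + L) ∸ L                      ≡⟨ cong (_∸ L) (sym (+-assoc (N ∸ (m t j + L)) (m t j) L)) ⟩
      N ∸ (m t j + L) + m t j + L ∸ L                        ≡⟨ m+n∸n≡m _ L ⟩
      N ∸ (m t j + L) + m t j                                ≡⟨ cong (λ x → length (heights T x) ∸ (m t j + L) + m t j) (sym (+-suc t j)) ⟩
      y t (suc j) + m t j                                    ∎
      where
      open ≡-Reasoning
      N = length (heights T (suc t + j))
      L = landed m (suc t) j
      L≤N : m t j + L ≤ N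
      L≤N = subst (λ x → m t j + L ≤ length (heights T x)) (+-suc t j) (landed-≤ t (suc j))

    schedule-zero : ∀ t → y t 0 ≡ length (heights T t)
    schedule-zero t = cong (length ∘ heights T) (+-identityʳ t)

    schedule-finite : ∀ t j → H ≤ j → y t j ≡ 0
    schedule-finite t j H≤j = trans (cong (length (heights T (t + j)) ∸_) (balanced t j H≤j)) (n∸n≡0 (length (heights T (t + j))))

    schedule-periodic : ∀ t j → y (t + n) j ≡ y t j
    schedule-periodic t j = cong₂ _∸_
      (cong length (trans (cong (heights T) (trans (+-assoc t n j) (trans (cong (λ x → t + x) (+-comm n j)) (sym (+-assoc t j n))))) (heights-periodic T (t + j))))
      (landed-shift n (λ s h → cong (count h) (heights-periodic T s)) t j)

    private
      module D = Dynamics H y m schedule-evolve schedule-finite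
      thrown : ∀ t → ∑ H (m t) ≡ y t 0
      thrown t = trans (∑-count H (between t)) (sym (schedule-zero t))

    schedule-is-Schedule : Schedule n b κ H y
    schedule-is-Schedule = record
      { recurs   = schedule-periodic
      ; inherits = λ t j → ≤-trans (m≤m+n _ (m t j)) (≤-reflexive (sym (schedule-evolve t j)))
      ; finite   = schedule-finite
      ; total    = λ t → trans (D.balls-const thrown t) (*-cancelˡ-≡ _ b n (begin
          n * ∑ H (y 0)                                    ≡⟨ sym (D.total-height thrown n (schedule-periodic 0)) ⟩
          ∑ n (λ t → ∑ H (λ j → suc j * m t j))            ≡⟨ ∑-cong n (λ t _ → ∑-weighted-count H (between t)) ⟩
          ∑ n (λ t → sumℕ (heights T t))                   ≡⟨ sym (totalHeight-∑ T) ⟩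
          totalHeight T                                    ≡⟨ total ⟩
          n * b                                            ∎))
      ; capped   = λ t j → ≤-trans (m∸n≤m _ (landed m t j)) (VAll-lookup caps ((t + j) mod n))
      }
      where open ≡-Reasoning

  -- The increments of the schedule are the multiplicities of the heights, and these determine a
  -- descending list.
  schedule-injective : ∀ {b κ} (S S′ : Siteswap n b κ) → (∀ t j → schedule (proj₁ S) t j ≡ schedule (proj₁ S′) t j) → S ≡ S′
  schedule-injective {b} {κ} S S′ e = Σ-≡ (λ T → ×-prop ≡-prop (×-prop ≡-prop (VAll-prop λ _ → ≤-irrelevant)))
    (per-injective n λ t → Multiset-≡ (descending-unique
      (proj₁ (proj₂ (per n (proj₁ S) t))) (proj₁ (proj₂ (per n (proj₁ S′) t)))
      (proj₂ (proj₂ (per n (proj₁ S) t))) (proj₂ (proj₂ (per n (proj₁ S′) t))) λ h →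
      +-cancelˡ-≡ (schedule (proj₁ S) t (suc h)) _ _ (trans (sym (schedule-evolve S (n * b) ≤-refl t h))
        (trans (e (suc t) h) (trans (schedule-evolve S′ (n * b) ≤-refl t h) (cong (_+ throws (proj₁ S′) t h) (sym (e t (suc h)))))))))

  module FromSchedule {b κ H : ℕ} {y : ℕ → ℕ → ℕ} (Y : Schedule n b κ H y) where
    open Schedule Y
    open ≡-Reasoning

    thrown : ℕ → ℕ → ℕ
    thrown t j = y (suc t) j ∸ y t (suc j)

    evolve : ∀ t j → y (suc t) j ≡ y t (suc j) + thrown t j
    evolve t j = sym (m+[n∸m]≡n (inherits t j))

    pattern-at : ℕ → Multiset
    pattern-at t = multiset (thrown t) H

    pattern-periodic : Periodic n pattern-at
    pattern-periodic t = Multiset-≡ (fromCounts-cong H λ h → cong₂ _∸_ (recurs (suc t) h) (recurs t (suc h)))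

    sites : Vec Multiset n
    sites = unper n pattern-at

    heights-sites : ∀ t → heights sites t ≡ fromCounts (thrown t) H
    heights-sites t = cong proj₁ (per-unper n pattern-periodic t)

    throws-sites : ∀ t h → throws sites t h ≡ thrown t h
    throws-sites t h = trans (cong (count h) (heights-sites t)) (split (h <? H))
      where
      split : Dec (h < H) → count h (fromCounts (thrown t) H) ≡ thrown t h
      split (yes h<H) = count-fromCounts (thrown t) H h h<H
      split (no h≮H)  = trans (count-above h (All.map (λ p → ≤-trans (proj₂ p) (≮⇒≥ h≮H)) (fromCounts-between (thrown t) H)))
        (sym (trans (cong (_∸ y t (suc h)) (finite (suc t) h (≮⇒≥ h≮H))) (0∸n≡0 (y t (suc h)))))

    private
      module D = Dynamics H y thrown evolve finite

    -- The number of balls in the air is constant, so what lands is thrown again.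
    ∑-thrown : ∀ t → ∑ H (thrown t) ≡ y t 0
    ∑-thrown t = sym (+-cancelˡ-≡ b _ _ (trans (cong (_+ y t 0) (sym (total (suc t)))) (trans (D.balls-suc t) (cong (_+ ∑ H (thrown t)) (total t)))))

    sites-between : ∀ t → All (Between H) (heights sites t)
    sites-between t = subst (All (Between H)) (sym (heights-sites t)) (fromCounts-between (thrown t) H)

    length-sites : ∀ t → length (heights sites t) ≡ y t 0
    length-sites t = trans (sym (∑-count H (sites-between t))) (trans (∑-cong H λ h _ → throws-sites t h) (∑-thrown t))

    schedule+landed : ∀ t j → y t j + landed (throws sites) t j ≡ length (heights sites (t + j))
    schedule+landed t zero    = trans (+-identityʳ (y t 0)) (trans (sym (length-sites t)) (cong (length ∘ heights sites) (sym (+-identityʳ t))))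
    schedule+landed t (suc j) = begin
      y t (suc j) + (throws sites t j + landed (throws sites) (suc t) j) ≡⟨ sym (+-assoc (y t (suc j)) _ _) ⟩
      y t (suc j) + throws sites t j + landed (throws sites) (suc t) j   ≡⟨ cong (_+ landed (throws sites) (suc t) j) (trans (cong (λ x → y t (suc j) + x) (throws-sites t j)) (sym (evolve t j))) ⟩
      y (suc t) j + landed (throws sites) (suc t) j                      ≡⟨ schedule+landed (suc t) j ⟩
      length (heights sites (suc t + j))                                 ≡⟨ cong (length ∘ heights sites) (sym (+-suc t j)) ⟩
      length (heights sites (t + suc j))                                 ∎

    schedule-sites : ∀ t j → schedule sites t j ≡ y t j
    schedule-sites t j = trans (cong (_∸ landed (throws sites) t j) (sym (schedule+landed t j))) (m+n∸n≡m (y t j) (landed (throws sites) t j))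

    siteswap : Siteswap n b κ
    siteswap = sites , balanced⇒landings H sites sites-between bal , height , VAll-tabulate λ i →
      ≤-trans (≤-reflexive (trans (cong size (sym (per-toℕ n sites i))) (length-sites (toℕ i)))) (capped (toℕ i) 0)
      where
      bal : Balanced H (heights sites)
      bal t j H≤j = trans (cong (_+ landed (throws sites) t j) (sym (finite t j H≤j))) (schedule+landed t j)
      height : totalHeight sites ≡ n * b
      height = begin
        totalHeight sites                                  ≡⟨ totalHeight-∑ sites ⟩
        ∑ n (λ t → sumℕ (heights sites t))                 ≡⟨ ∑-cong n (λ t _ → sym (∑-weighted-count H (sites-between t))) ⟩
        ∑ n (λ t → ∑ H (λ h → suc h * throws sites t h))   ≡⟨ ∑-cong n (λ t _ → ∑-cong H λ h _ → cong (suc h *_) (throws-sites t h)) ⟩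
        ∑ n (λ t → ∑ H (λ h → suc h * thrown t h))         ≡⟨ D.total-height ∑-thrown n (recurs 0) ⟩
        n * ∑ H (y 0)                                      ≡⟨ cong (n *_) (total 0) ⟩
        n * b                                              ∎

-- Cards acting on lists with zeros

_≤*_ : List ℕ → List ℕ → Set
_≤*_ = Pointwise _≤_

≤*-sum : ∀ {e s} → e ≤* s → sumℕ e ≤ sumℕ s
≤*-sum []      = z≤n
≤*-sum (p ∷ q) = +-mono-≤ p (≤*-sum q)

≤*-sum-≡ : ∀ {e s} → e ≤* s → sumℕ s ≤ sumℕ e → e ≡ s
≤*-sum-≡ []      _ = refl
≤*-sum-≡ {x ∷ e} {z ∷ s} (p ∷ q) h = cong₂ _∷_ (≤-antisym p (+-cancelʳ-≤ (sumℕ e) z x (≤-trans (+-monoʳ-≤ z (≤*-sum q)) h)))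
  (≤*-sum-≡ q (+-cancelˡ-≤ x (sumℕ s) (sumℕ e) (≤-trans (+-monoˡ-≤ (sumℕ s) p) h)))

nz-++ : ∀ l l′ → nz (l ++ l′) ≡ nz l ++ nz l′
nz-++ []          l′ = refl
nz-++ (zero ∷ l)  l′ = nz-++ l l′
nz-++ (suc x ∷ l) l′ = cong (suc x ∷_) (nz-++ l l′)

All-nz : ∀ {κ} l → All (_≤ κ) l → All (λ x → 1 ≤ x × x ≤ κ) (nz l)
All-nz []          []      = []
All-nz (zero ∷ l)  (_ ∷ a) = All-nz l a
All-nz (suc x ∷ l) (p ∷ a) = (s≤s z≤n , p) ∷ All-nz l a

All-nz⁻ : ∀ {κ} l → All (_≤ κ) (nz l) → All (_≤ κ) l
All-nz⁻ []          _       = []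
All-nz⁻ (zero ∷ l)  a       = z≤n ∷ All-nz⁻ l a
All-nz⁻ (suc x ∷ l) (p ∷ a) = p ∷ All-nz⁻ l a

-- Times are translated into parts and back: `sel` carries a list indexed by times over to the parts
-- of `nz a`, and `spread` carries a card over to the times of `a`.
sel : List ℕ → List ℕ → List ℕ
sel (zero ∷ a)  (_ ∷ b) = sel a b
sel (suc _ ∷ a) (x ∷ b) = x ∷ sel a b
sel _           _       = []

spread : List ℕ → List ℕ → List ℕ
spread e       []          = []
spread e       (zero ∷ a)  = 0 ∷ spread e a
-- A default: along a walk the card is never shorter than the list of parts it acts on.
spread []      (suc _ ∷ a) = 0 ∷ spread [] a
spread (x ∷ e) (suc _ ∷ a) = x ∷ spread e a

sel-≤* : ∀ {a b} → b ≤* a → sel a b ≤* nz a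
sel-≤* []                    = []
sel-≤* {zero ∷ _}  (_ ∷ q)   = sel-≤* q
sel-≤* {suc _ ∷ _} (p ∷ q)   = p ∷ sel-≤* q

nz-sel : ∀ {a b} → b ≤* a → nz (sel a b) ≡ nz b
nz-sel []                              = refl
nz-sel {zero ∷ _}  {zero ∷ _}  (_ ∷ q) = nz-sel q
nz-sel {suc _ ∷ _} {zero ∷ _}  (_ ∷ q) = nz-sel q
nz-sel {suc _ ∷ _} {suc x ∷ _} (_ ∷ q) = cong (suc x ∷_) (nz-sel q)

sum-sel : ∀ {a b} → b ≤* a → sumℕ (sel a b) ≡ sumℕ b
sum-sel {a} {b} q = trans (sym (sum-nz (sel a b))) (trans (cong sumℕ (nz-sel q)) (sum-nz b))

spread-sel : ∀ {a b} → b ≤* a → spread (sel a b) a ≡ b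
spread-sel []                             = refl
spread-sel {zero ∷ _}  {zero ∷ _} (_ ∷ q) = cong (0 ∷_) (spread-sel q)
spread-sel {suc _ ∷ _} {x ∷ _}    (_ ∷ q) = cong (x ∷_) (spread-sel q)

sel-spread : ∀ e a → length e ≡ length (nz a) → sel a (spread e a) ≡ e
sel-spread []      []          _ = refl
sel-spread e       (zero ∷ a)  h = sel-spread e a h
sel-spread (x ∷ e) (suc _ ∷ a) h = cong (x ∷_) (sel-spread e a (suc-injective h))

length-spread : ∀ e a → length (spread e a) ≡ length a
length-spread e       []          = refl
length-spread e       (zero ∷ a)  = cong suc (length-spread e a)
length-spread []      (suc _ ∷ a) = cong suc (length-spread [] a)
length-spread (x ∷ e) (suc _ ∷ a) = cong suc (length-spread e a)

take-spread : ∀ e a j → take j (spread e a) ≡ spread e (take j a)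
take-spread e       a           zero    = refl
take-spread e       []          (suc j) = refl
take-spread e       (zero ∷ a)  (suc j) = cong (0 ∷_) (take-spread e a j)
take-spread []      (suc _ ∷ a) (suc j) = cong (0 ∷_) (take-spread [] a j)
take-spread (x ∷ e) (suc _ ∷ a) (suc j) = cong (x ∷_) (take-spread e a j)

-- `e₁` is the portion of the card used up by the known times `a`; `e₂` acts on the parts whose
-- landing time is not yet known.
record Split (e a rest : List ℕ) : Set where
  field
    e₁ e₂    : List ℕ
    e≡       : e ≡ e₁ ++ e₂
    e₂≤      : e₂ ≤* rest
    spread≤  : spread e a ≤* a
    nzspread : nz (spread e a) ≡ nz e₁

split : ∀ {e} a {rest} → e ≤* (nz a ++ rest) → Split e a rest
split []          q = record { e₁ = [] ; e₂ = _ ; e≡ = refl ; e₂≤ = q ; spread≤ = [] ; nzspread = refl }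
split (zero ∷ a)  q = let open Split (split a q) in
  record { e₁ = e₁ ; e₂ = e₂ ; e≡ = e≡ ; e₂≤ = e₂≤ ; spread≤ = z≤n ∷ spread≤ ; nzspread = nzspread }
split {x ∷ e} (suc y ∷ a) (p ∷ q) = let open Split (split a q) in
  record { e₁ = x ∷ e₁ ; e₂ = e₂ ; e≡ = cong (x ∷_) e≡ ; e₂≤ = e₂≤ ; spread≤ = p ∷ spread≤ ; nzspread = nz-∷ x nzspread }
  where
  nz-∷ : ∀ x {l l′} → nz l ≡ nz l′ → nz (x ∷ l) ≡ nz (x ∷ l′)
  nz-∷ zero    h = h
  nz-∷ (suc x) h = cong (suc x ∷_) h

lastPart : List ℕ → ℕ
lastPart []          = 0
lastPart (x ∷ [])    = x
lastPart (x ∷ y ∷ l) = lastPart (y ∷ l)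

lastPart-++ : ∀ l x l′ → lastPart (l ++ x ∷ l′) ≡ lastPart (x ∷ l′)
lastPart-++ []          x l′ = refl
lastPart-++ (y ∷ [])    x l′ = refl
lastPart-++ (y ∷ z ∷ l) x l′ = lastPart-++ (z ∷ l) x l′

-- The top group neither receives a ball nor gets a new group above it.
Static : Card → List ℕ → Set
Static nothing  s = ⊤
Static (just e) s = lastPart e ≡ lastPart s

Static? : ∀ c s → Dec (Static c s)
Static? nothing  s = yes tt
Static? (just e) s = lastPart e ≟ lastPart s

record Walk (n b κ : ℕ) (c : ℕ → Card) (r : ℕ → List ℕ) : Set where
  field
    comp     : ∀ t → IsComp b κ (r t)
    deals    : ∀ t → Deals (c t) (r t) (r (suc t))
    c-recurs : ∀ t → c (t + n) ≡ c t
    r-recurs : ∀ t → r (t + n) ≡ r t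

cardOf : ℕ → List ℕ → Card
cardOf zero    e = nothing
cardOf (suc _) e = just e

-- The number of balls that land now, namely those that the card does not carry over.
first : ℕ → Card → ℕ
first b nothing  = 0
first b (just e) = b ∸ sumℕ e

spreadCard : Card → List ℕ → List ℕ
spreadCard nothing  p = p
spreadCard (just e) p = spread e p

-- A prefix of length suc j of the schedule at time t depends only on the prefix of
-- length j at time suc t, so the cards determine the schedule by recursion on j.
prefix : ℕ → (ℕ → Card) → ℕ → ℕ → List ℕ
prefix b c t zero    = []
prefix b c t (suc j) = first b (c t) ∷ spreadCard (c t) (prefix b c (suc t) j)

prefix-cong : ∀ b {c c′} → (∀ t → c t ≡ c′ t) → ∀ t j → prefix b c t j ≡ prefix b c′ t j
prefix-cong b e t zero    = refl
prefix-cong b e t (suc j) = cong₂ (λ x p → first b x ∷ spreadCard x p) (e t) (prefix-cong b e (suc t) j)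

prefix-shift : ∀ b {c} n → (∀ t → c (t + n) ≡ c t) → ∀ t j → prefix b c (t + n) j ≡ prefix b c t j
prefix-shift b n e t zero    = refl
prefix-shift b n e t (suc j) = cong₂ (λ x p → first b x ∷ spreadCard x p) (e t) (prefix-shift b n e (suc t) j)

length-prefix : ∀ b c t j → length (prefix b c t j) ≡ j
length-prefix b c t zero    = refl
length-prefix b c t (suc j) = cong suc (go (c t))
  where
  go : ∀ x → length (spreadCard x (prefix b c (suc t) j)) ≡ j
  go nothing  = length-prefix b c (suc t) j
  go (just e) = trans (length-spread e (prefix b c (suc t) j)) (length-prefix b c (suc t) j)

take-spreadCard : ∀ x a j → take j (spreadCard x a) ≡ spreadCard x (take j a)
take-spreadCard nothing  a j = refl
take-spreadCard (just e) a j = take-spread e a j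

take-prefix : ∀ b c t j → take j (prefix b c t (suc j)) ≡ prefix b c t j
take-prefix b c t zero    = refl
take-prefix b c t (suc j) = cong (first b (c t) ∷_)
  (trans (take-spreadCard (c t) _ j) (cong (spreadCard (c t)) (take-prefix b c (suc t) j)))

nth : List ℕ → ℕ → ℕ
nth []      _       = 0
nth (x ∷ l) zero    = x
nth (x ∷ l) (suc i) = nth l i

take-nth : ∀ j l → length l ≡ suc j → l ≡ take j l ∷ʳ nth l j
take-nth zero    (x ∷ []) _ = refl
take-nth (suc j) (x ∷ l)  h = cong (x ∷_) (take-nth j l (suc-injective h))

unrolled : ℕ → (ℕ → Card) → ℕ → ℕ → ℕ
unrolled b c t j = nth (prefix b c t (suc j)) j

prefix-∷ʳ : ∀ b c t j → prefix b c t (suc j) ≡ prefix b c t j ∷ʳ unrolled b c t j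
prefix-∷ʳ b c t j = trans (take-nth j _ (length-prefix b c t (suc j))) (cong (_∷ʳ unrolled b c t j) (take-prefix b c t j))

prefix-unrolled : ∀ b c t j → prefix b c t j ≡ applyUpTo (unrolled b c t) j
prefix-unrolled b c t zero    = refl
prefix-unrolled b c t (suc j) = trans (prefix-∷ʳ b c t j) (trans (cong (_∷ʳ unrolled b c t j) (prefix-unrolled b c t j)) (List.applyUpTo-∷ʳ (unrolled b c t) j))

sum-applyUpTo : ∀ (f : ℕ → ℕ) j → sumℕ (applyUpTo f j) ≡ ∑ j f
sum-applyUpTo f zero    = refl
sum-applyUpTo f (suc j) = cong (λ x → f 0 + x) (sum-applyUpTo (f ∘ suc) j)

nth-applyUpTo : ∀ (f : ℕ → ℕ) {i j} → i < j → nth (applyUpTo f j) i ≡ f i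
nth-applyUpTo f {zero}  (s≤s _)   = refl
nth-applyUpTo f {suc i} (s≤s i<j) = nth-applyUpTo (f ∘ suc) i<j

nth-≤* : ∀ {a b} → a ≤* b → ∀ i → nth a i ≤ nth b i
nth-≤* []      i       = z≤n
nth-≤* (p ∷ q) zero    = p
nth-≤* (p ∷ q) (suc i) = nth-≤* q i

applyUpTo-≤* : ∀ {f g : ℕ → ℕ} j → (∀ i → f i ≤ g i) → applyUpTo f j ≤* applyUpTo g j
applyUpTo-≤* zero    h = []
applyUpTo-≤* (suc j) h = h 0 ∷ applyUpTo-≤* j (h ∘ suc)

applyUpTo-All : ∀ {P : ℕ → Set} {f : ℕ → ℕ} j → (∀ i → P (f i)) → All P (applyUpTo f j)
applyUpTo-All zero    h = []
applyUpTo-All (suc j) h = h 0 ∷ applyUpTo-All j (h ∘ suc)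

take-applyUpTo : ∀ (f : ℕ → ℕ) {i j} → i ≤ j → take i (applyUpTo f j) ≡ applyUpTo f i
take-applyUpTo f z≤n       = refl
take-applyUpTo f (s≤s i≤j) = cong (f 0 ∷_) (take-applyUpTo (f ∘ suc) i≤j)

applyUpTo-cong : ∀ {f g : ℕ → ℕ} j → (∀ i → f i ≡ g i) → applyUpTo f j ≡ applyUpTo g j
applyUpTo-cong zero    h = refl
applyUpTo-cong (suc j) h = cong₂ _∷_ (h 0) (applyUpTo-cong j (h ∘ suc))

-- The walk of a schedule

module ScheduleWalk {n b κ H : ℕ} {y : ℕ → ℕ → ℕ} (Y : Schedule n b κ H y) where
  open Schedule Y

  now later : ℕ → List ℕ
  now t   = applyUpTo (y t) H
  later t = applyUpTo (y t ∘ suc) H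

  state : ℕ → List ℕ
  state t = nz (now t)

  card : ℕ → Card
  card t = cardOf (y t 0) (sel (now (suc t)) (later t))

  later≤now : ∀ t → later t ≤* now (suc t)
  later≤now t = applyUpTo-≤* H (inherits t)

  sum-now : ∀ t → sumℕ (now t) ≡ b
  sum-now t = trans (sum-applyUpTo (y t) H) (total t)

  now+0 : ∀ t → y t 0 ∷ later t ≡ now t ∷ʳ 0
  now+0 t = trans (sym (List.applyUpTo-∷ʳ (y t) H)) (cong (now t ∷ʳ_) (finite t H ≤-refl))

  sum-later : ∀ t → y t 0 + sumℕ (later t) ≡ b
  sum-later t = trans (cong sumℕ (now+0 t)) (trans (sum-++ (now t) (0 ∷ [])) (trans (+-identityʳ _) (sum-now t)))

  state≡ : ∀ t → state t ≡ nz (y t 0 ∷ later t)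
  state≡ t = sym (trans (cong nz (now+0 t)) (trans (nz-++ (now t) (0 ∷ [])) (List.++-identityʳ _)))

  sum-state : ∀ t → sumℕ (state t) ≡ b
  sum-state t = trans (sum-nz (now t)) (sum-now t)

  sum-card : ∀ t → b ∸ sumℕ (sel (now (suc t)) (later t)) ≡ y t 0
  sum-card t = trans (cong₂ _∸_ (sym (sum-later t)) (sum-sel (later≤now t))) (m+n∸n≡m (y t 0) (sumℕ (later t)))

  -- Without a landing the sums agree, and a pointwise inequality between lists of equal sum is an
  -- equality.
  later≡now : ∀ t → y t 0 ≡ 0 → later t ≡ now (suc t)
  later≡now t e = ≤*-sum-≡ (later≤now t) (≤-reflexive (trans (sum-now (suc t)) (trans (sym (sum-later t)) (cong (_+ sumℕ (later t)) e))))

  card-deals : ∀ t → Deals (card t) (state t) (state (suc t))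
  card-deals t = go (y t 0) refl
    where
    go : ∀ q → y t 0 ≡ q → Deals (cardOf q (sel (now (suc t)) (later t))) (state t) (state (suc t))
    go zero    e = trans (state≡ t) (trans (cong (λ x → nz (x ∷ later t)) e) (cong nz (later≡now t e)))
    go (suc q) e = sel-≤* (later≤now t) , trans (state≡ t) (trans (cong (λ x → nz (x ∷ later t)) e)
      (cong₂ _∷_ (sym (trans (cong (_∸ sumℕ (sel (now (suc t)) (later t))) (sum-state (suc t))) (trans (sum-card t) e))) (sym (nz-sel (later≤now t)))))

  walk : Walk n b κ card state
  walk = record
    { comp     = λ t → sum-state t , All-nz (now t) (applyUpTo-All H (capped t))
    ; deals    = card-deals
    ; c-recurs = λ t → cong₂ cardOf (recurs t 0) (cong₂ sel (applyUpTo-cong H (recurs (suc t))) (applyUpTo-cong H λ j → recurs t (suc j)))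
    ; r-recurs = λ t → cong nz (applyUpTo-cong H (recurs t))
    }

  -- `spread` undoes `sel`, so the recursion along the cards reproduces the schedule. Injectivity of
  -- the passage to walks rests on this.
  prefix-card : ∀ t j → j ≤ H → prefix b card t (suc j) ≡ applyUpTo (y t) (suc j)
  prefix-card t j j≤H = cong₂ _∷_ (head (y t 0) refl) (trans (cong (spreadCard (card t)) (ih j j≤H)) (tail (y t 0) refl))
    where
    ih : ∀ j → j ≤ H → prefix b card (suc t) j ≡ applyUpTo (y (suc t)) j
    ih zero    _   = refl
    ih (suc j) j<H = prefix-card (suc t) j (<⇒≤ j<H)
    head : ∀ q → y t 0 ≡ q → first b (cardOf q (sel (now (suc t)) (later t))) ≡ y t 0
    head zero    e = sym e
    head (suc q) e = sum-card t
    tail : ∀ q → y t 0 ≡ q → spreadCard (cardOf q (sel (now (suc t)) (later t))) (applyUpTo (y (suc t)) j) ≡ applyUpTo (y t ∘ suc) j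
    tail q e = trans (cong (spreadCard x) (sym (take-applyUpTo (y (suc t)) j≤H)))
      (trans (sym (take-spreadCard x (now (suc t)) j)) (trans (cong (take j) (whole q e)) (take-applyUpTo (y t ∘ suc) j≤H)))
      where
      x = cardOf q (sel (now (suc t)) (later t))
      whole : ∀ q → y t 0 ≡ q → spreadCard (cardOf q (sel (now (suc t)) (later t))) (now (suc t)) ≡ later t
      whole zero    e = sym (later≡now t e)
      whole (suc q) e = spread-sel (later≤now t)

  unrolled-card : ∀ t j → j ≤ H → unrolled b card t j ≡ y t j
  unrolled-card t j j≤H = trans (cong (λ l → nth l j) (prefix-card t j j≤H)) (nth-applyUpTo (y t) ≤-refl)

  ZeroFrom : ℕ → ℕ → Set
  ZeroFrom t k = ∀ j → k ≤ j → y t j ≡ 0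

  drop-sum : ∀ (f : ℕ → ℕ) k h → (∀ j → k ≤ j → f j ≡ 0) → sumℕ (drop k (applyUpTo f h)) ≡ 0
  drop-sum f zero    h       z = trans (sum-applyUpTo f h) (∑-zero h λ i _ → z i z≤n)
  drop-sum f (suc k) zero    z = refl
  drop-sum f (suc k) (suc h) z = drop-sum (f ∘ suc) k h λ j k≤j → z (suc j) (s≤s k≤j)

  drop-sum⁻ : ∀ (f : ℕ → ℕ) k h → sumℕ (drop k (applyUpTo f h)) ≡ 0 → ∀ j → k ≤ j → j < h → f j ≡ 0
  drop-sum⁻ f zero    (suc h) e zero    _ _ = m+n≡0⇒m≡0 (f 0) e
  drop-sum⁻ f zero    (suc h) e (suc j) _ (s≤s j<h) = drop-sum⁻ (f ∘ suc) zero h (m+n≡0⇒n≡0 (f 0) e) j z≤n j<h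
  drop-sum⁻ f (suc k) (suc h) e (suc j) (s≤s k≤j) (s≤s j<h) = drop-sum⁻ (f ∘ suc) k h e j k≤j j<h

  nz-pos : ∀ l → lastPart (nz l) ≡ 0 → sumℕ l ≡ 0
  nz-pos []          _ = refl
  nz-pos (zero ∷ l)  e = nz-pos l e
  nz-pos (suc x ∷ l) e with nz l in eq
  nz-pos (suc x ∷ l) () | []
  ... | z ∷ l′ = contradiction (trans (sym (cong sumℕ eq)) (trans (sum-nz l) (nz-pos l (trans (cong lastPart eq) e)))) (λ h → pos l eq (m+n≡0⇒m≡0 z h))
    where
    pos : ∀ l {z l′} → nz l ≡ z ∷ l′ → z ≢ 0
    pos (zero ∷ l)  e = pos l e
    pos (suc x ∷ l) refl ()

  sel-zero : ∀ a b → sumℕ b ≡ 0 → lastPart (sel a b) ≡ 0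
  sel-zero []          b           _ = refl
  sel-zero (zero ∷ a)  []          _ = refl
  sel-zero (suc _ ∷ a) []          _ = refl
  sel-zero (zero ∷ a)  (x ∷ b)     e = sel-zero a b (m+n≡0⇒n≡0 x e)
  sel-zero (suc _ ∷ a) (x ∷ b)     e with sel a b | sel-zero a b (m+n≡0⇒n≡0 x e)
  ... | []    | _ = m+n≡0⇒m≡0 x e
  ... | _ ∷ _ | h = h

  -- If `a` had a positive entry from position `k` on, so would its last positive entry lie there.
  -- The equation of last parts makes it equal to the entry of `b` at that place, which is zero.
  top-not-static : ∀ k {a b} → b ≤* a → lastPart (sel a b) ≡ lastPart (nz a) → sumℕ (drop k b) ≡ 0 → sumℕ (drop k a) ≡ 0
  top-not-static zero    {a} {b} q e z = nz-pos a (trans (sym e) (sel-zero a b z))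
  top-not-static (suc k) []                e z = refl
  top-not-static (suc k) {zero ∷ a}  (_ ∷ q) e z = top-not-static k q e z
  top-not-static (suc k) {suc x ∷ a} {_ ∷ b} (_ ∷ q) e z with sel a b | nz a | sel-≤* q | top-not-static k q | nz-pos a
  ... | []    | []    | [] | _  | np = drop-zero k a (np refl)
    where
    drop-zero : ∀ k l → sumℕ l ≡ 0 → sumℕ (drop k l) ≡ 0
    drop-zero zero    l       e = e
    drop-zero (suc k) []      e = refl
    drop-zero (suc k) (x ∷ l) e = drop-zero k l (m+n≡0⇒n≡0 x e)
  ... | _ ∷ _ | _ ∷ _ | _  | ih | _ = ih e z

  -- A static card preserves the absolute time `t + suc k` from which nothing is due to land.
  static-ZeroFrom : ∀ t k → Static (card t) (state (suc t)) → ZeroFrom t (suc k) → ZeroFrom (suc t) k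
  static-ZeroFrom t k st z j k≤j with j <? H
  ... | no j≮H  = finite (suc t) j (≮⇒≥ j≮H)
  ... | yes j<H = go (y t 0) refl st
    where
    go : ∀ q → y t 0 ≡ q → Static (cardOf q (sel (now (suc t)) (later t))) (state (suc t)) → y (suc t) j ≡ 0
    go zero    e _  = trans (sym (nth-applyUpTo (y (suc t)) j<H)) (trans (cong (λ l → nth l j) (sym (later≡now t e)))
      (trans (nth-applyUpTo (y t ∘ suc) j<H) (z (suc j) (s≤s k≤j))))
    go (suc q) e st = drop-sum⁻ (y (suc t)) k H (top-not-static k (later≤now t) st (drop-sum (y t ∘ suc) k H λ i k≤i → z (suc i) (s≤s k≤i))) j k≤j j<H

  -- At time `0` nothing is due from time `H` on. If all cards are static this remains so until time
  -- `H` itself, when no ball can be left in the air.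
  all-static⇒empty : (∀ t → Static (card t) (state (suc t))) → b ≡ 0
  all-static⇒empty st = trans (sym (total (H + 0))) (∑-zero H λ i _ → go H 0 (λ j → finite 0 j) i z≤n)
    where
    go : ∀ k t → ZeroFrom t k → ZeroFrom (k + t) 0
    go zero    t z = z
    go (suc k) t z = subst (λ x → ZeroFrom x 0) (+-suc k t) (go k (suc t) (static-ZeroFrom t k (st t) z))

nz-∷⁺ : ∀ {x} l → 1 ≤ x → nz (x ∷ l) ≡ x ∷ nz l
nz-∷⁺ {suc x} l _ = refl

-- The schedule of a walk

module WalkSchedule {n b κ : ℕ} .{{_ : NonZero n}} {c : ℕ → Card} {r : ℕ → List ℕ} (W : Walk n b κ c r) where
  open Walk W

  private
    p : ℕ → ℕ → List ℕ
    p = prefix b c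

  -- `rest` holds the parts of the state that do not land within the first `j` beats, possibly
  -- never.
  Landing : ℕ → ℕ → List ℕ → Set
  Landing t j rest = r t ≡ nz (p t j) ++ rest

  -- The card splits along the prefix, and its second portion acts on `rest`. If no ball is lost
  -- there, that portion equals `rest`; the last part is then kept whole, which makes the card
  -- static.
  landing-suc : ∀ t j {rest} → Landing (suc t) j rest →
    Σ (List ℕ) λ rest′ → Landing t (suc j) rest′ × spreadCard (c t) (p (suc t) j) ≤* p (suc t) j × sumℕ rest′ ≤ sumℕ rest ×
      (¬ Static (c t) (r (suc t)) → rest ≢ [] → sumℕ rest′ < sumℕ rest)
  landing-suc t j {rest} l = go (c t) (deals t)
    where
    ≤*-refl : ∀ a → a ≤* a
    ≤*-refl []      = []
    ≤*-refl (x ∷ a) = ≤-refl ∷ ≤*-refl a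
    go : ∀ x → Deals x (r t) (r (suc t)) →
      Σ (List ℕ) λ rest′ → r t ≡ nz (first b x ∷ spreadCard x (p (suc t) j)) ++ rest′ × spreadCard x (p (suc t) j) ≤* p (suc t) j ×
        sumℕ rest′ ≤ sumℕ rest × (¬ Static x (r (suc t)) → rest ≢ [] → sumℕ rest′ < sumℕ rest)
    go nothing  d = rest , trans d l , ≤*-refl _ , ≤-refl , λ ¬st → contradiction tt ¬st
    go (just e) (e≤ , d) = nz e₂ , eq , spread≤ , ≤-trans (≤-reflexive (sum-nz e₂)) (≤*-sum e₂≤) , strict
      where
      open Split (split {e} (p (suc t) j) (subst (e ≤*_) l e≤))
      d′ : r t ≡ (b ∸ sumℕ e) ∷ nz e
      d′ = trans d (cong (λ s → (s ∸ sumℕ e) ∷ nz e) (proj₁ (comp (suc t))))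
      pos : 1 ≤ b ∸ sumℕ e
      pos with subst (All _) d′ (proj₂ (comp t))
      ... | (h , _) ∷ _ = h
      eq : r t ≡ nz ((b ∸ sumℕ e) ∷ spread e (p (suc t) j)) ++ nz e₂
      eq = trans d′ (trans (cong ((b ∸ sumℕ e) ∷_) (trans (cong nz e≡) (trans (nz-++ e₁ e₂) (cong (_++ nz e₂) (sym nzspread)))))
        (cong (_++ nz e₂) (sym (nz-∷⁺ (spread e (p (suc t) j)) pos))))
      last-≡ : ∀ {e₂ rest} → rest ≢ [] → e₂ ≡ rest → e ≡ e₁ ++ e₂ → Landing (suc t) j rest → lastPart e ≡ lastPart (r (suc t))
      last-≡ {rest = []}    ne _    _  _ = contradiction refl ne
      last-≡ {rest = x ∷ l} ne refl e≡ q = trans (cong lastPart e≡) (trans (lastPart-++ e₁ x l) (sym (trans (cong lastPart q) (lastPart-++ (nz (p (suc t) j)) x l))))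
      strict : ¬ Static (just e) (r (suc t)) → rest ≢ [] → sumℕ (nz e₂) < sumℕ rest
      strict ¬st ne = ≰⇒> λ h → ¬st (last-≡ ne (≤*-sum-≡ e₂≤ (≤-trans h (≤-reflexive (sum-nz e₂)))) e≡ l)

  landing : ∀ t j → Σ (List ℕ) (Landing t j)
  landing t zero    = r t , refl
  landing t (suc j) with landing-suc t j (proj₂ (landing (suc t) j))
  ... | rest , l , _ = rest , l

  aloft : ℕ → ℕ → ℕ
  aloft t j = sumℕ (proj₁ (landing t j))

  prefix+aloft : ∀ t j → sumℕ (p t j) + aloft t j ≡ b
  prefix+aloft t j = trans (cong (_+ aloft t j) (sym (sum-nz (p t j)))) (trans (sym (sum-++ (nz (p t j)) _)) (trans (cong sumℕ (sym (proj₂ (landing t j)))) (proj₁ (comp t))))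

  aloft≡ : ∀ t j → aloft t j ≡ b ∸ sumℕ (p t j)
  aloft≡ t j = sym (trans (cong (_∸ sumℕ (p t j)) (sym (prefix+aloft t j))) (m+n∸m≡n (sumℕ (p t j)) (aloft t j)))

  aloft-suc : ∀ t j → aloft t (suc j) ≤ aloft (suc t) j
  aloft-suc t j with landing-suc t j (proj₂ (landing (suc t) j))
  ... | _ , _ , _ , h , _ = h

  aloft-drop : ∀ t j → ¬ Static (c t) (r (suc t)) → aloft t (suc j) < aloft (suc t) j ⊎ aloft t (suc j) ≡ 0
  aloft-drop t j ¬st with landing (suc t) j
  ... | rest , l with landing-suc t j l
  aloft-drop t j ¬st | []       , l | _ , _ , _ , h , _ = inj₂ (n≤0⇒n≡0 h)
  aloft-drop t j ¬st | (_ ∷ _)  , l | _ , _ , _ , _ , s = inj₁ (s ¬st λ ())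

  aloft-later : ∀ k t j → aloft t (k + j) ≤ aloft (k + t) j
  aloft-later zero    t j = ≤-refl
  aloft-later (suc k) t j = ≤-trans (aloft-suc t (k + j)) (subst (λ x → aloft (suc t) (k + j) ≤ aloft x j) (+-suc k t) (aloft-later k (suc t) j))

  aloft-periodic : ∀ j → Periodic n (λ t → aloft t j)
  aloft-periodic j t = trans (aloft≡ (t + n) j) (trans (cong (λ l → b ∸ sumℕ l) (prefix-shift b n c-recurs t j)) (sym (aloft≡ t j)))

  sum-prefix-suc : ∀ t j → sumℕ (p t (suc j)) ≡ sumℕ (p t j) + unrolled b c t j
  sum-prefix-suc t j = trans (cong sumℕ (prefix-∷ʳ b c t j)) (trans (sum-++ (p t j) _) (cong (λ x → sumℕ (p t j) + x) (+-identityʳ _)))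

  aloft-antitone : ∀ t {i j} → i ≤ j → aloft t j ≤ aloft t i
  aloft-antitone t {i} {j} i≤j = subst (λ x → aloft t x ≤ aloft t i) (m∸n+n≡m i≤j) (go (j ∸ i))
    where
    go : ∀ k → aloft t (k + i) ≤ aloft t i
    go zero    = ≤-refl
    go (suc k) = ≤-trans (≤-trans (≤-reflexive (aloft≡ t (suc k + i))) (≤-trans (∸-monoʳ-≤ b (≤-trans (m≤m+n (sumℕ (p t (k + i))) _) (≤-reflexive (sym (sum-prefix-suc t (k + i)))))) (≤-reflexive (sym (aloft≡ t (k + i)))))) (go k)

  module _ (t₀ : ℕ) (¬st : ¬ Static (c t₀) (r (suc t₀))) where

    -- Going once around the period the count never rises, and the card at `t₀` makes it drop unless
    -- nothing remains.
    aloft-period : ∀ j → aloft t₀ (n + j) < aloft t₀ j ⊎ aloft t₀ (n + j) ≡ 0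
    aloft-period j = subst (λ x → aloft t₀ (x + j) < aloft t₀ j ⊎ aloft t₀ (x + j) ≡ 0) (suc-pred n) (go (aloft-drop t₀ (pred n + j) ¬st))
      where
      later : aloft (suc t₀) (pred n + j) ≤ aloft t₀ j
      later = ≤-trans (aloft-later (pred n) (suc t₀) j)
        (≤-reflexive (trans (cong (λ x → aloft x j) (trans (+-suc (pred n) t₀) (trans (cong (_+ t₀) (suc-pred n)) (+-comm n t₀)))) (aloft-periodic j t₀)))
      go : aloft t₀ (suc (pred n + j)) < aloft (suc t₀) (pred n + j) ⊎ aloft t₀ (suc (pred n + j)) ≡ 0 → _
      go (inj₁ h) = inj₁ (≤-trans h later)
      go (inj₂ h) = inj₂ h

    aloft-periods : ∀ k → aloft t₀ (k * n) ≤ b ∸ k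
    aloft-periods zero    = ≤-reflexive (proj₁ (comp t₀))
    aloft-periods (suc k) with aloft-period (k * n)
    ... | inj₁ h = ≤-trans (pred-mono-≤ (≤-trans h (aloft-periods k))) (≤-reflexive (pred[m∸n]≡m∸[1+n] b k))
    ... | inj₂ h = ≤-trans (≤-reflexive h) z≤n

    -- From any time within the period, wait until the card of `t₀` is played; `b` further periods
    -- suffice from there.
    all-land : ∀ {H} → (∀ t → t < n → t₀ + (t * n ∸ t) + b * n ≤ H) → ∀ t → aloft t H ≡ 0
    all-land {H} bound t = n≤0⇒n≡0 (begin
      aloft t H                          ≡⟨ sym (periodic-% n (aloft-periodic H) t) ⟩
      aloft s H                          ≤⟨ aloft-antitone s (bound s (DivMod.m%n<n t n)) ⟩
      aloft s (k + b * n)                ≤⟨ aloft-later k s (b * n) ⟩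
      aloft (k + s) (b * n)              ≡⟨ cong (λ x → aloft x (b * n)) (trans (+-assoc t₀ (s * n ∸ s) s) (cong (λ x → t₀ + x) (m∸n+n≡m (m≤m*n s n)))) ⟩
      aloft (t₀ + s * n) (b * n)         ≡⟨ periodic-* n (aloft-periodic (b * n)) s t₀ ⟩
      aloft t₀ (b * n)                   ≤⟨ aloft-periods b ⟩
      b ∸ b                              ≡⟨ n∸n≡0 b ⟩
      0                                  ∎)
      where
      open ≤-Reasoning
      s = t % n
      -- Chosen so that `k + s = t₀ + s * n`, a time congruent to `t₀`.
      k = t₀ + (s * n ∸ s)

  no-balls-land : b ≡ 0 → ∀ H t → aloft t H ≡ 0
  no-balls-land refl H t = n≤0⇒n≡0 (≤-trans (m≤n+m _ (sumℕ (p t H))) (≤-reflexive (prefix+aloft t H)))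

  module _ {H : ℕ} (lands : ∀ t → aloft t H ≡ 0) where
    private
      y = unrolled b c

    sum-prefix : ∀ t → sumℕ (p t H) ≡ b
    sum-prefix t = trans (sym (+-identityʳ _)) (trans (cong (λ x → sumℕ (p t H) + x) (sym (lands t))) (prefix+aloft t H))

    nz-prefix : ∀ t → nz (p t H) ≡ r t
    nz-prefix t with landing t H | lands t
    ... | []       , l | _ = sym (trans l (List.++-identityʳ _))
    ... | x ∷ rest , l | h with All.++⁻ʳ (nz (p t H)) (subst (All _) l (proj₂ (comp t)))
    ... | (pos , _) ∷ _ = contradiction (m+n≡0⇒m≡0 x h) λ { refl → contradiction pos λ () }

    spread-unrolled : ∀ t j → spreadCard (c t) (p (suc t) j) ≡ applyUpTo (y t ∘ suc) j
    spread-unrolled t j = List.∷-injectiveʳ (prefix-unrolled b c t (suc j))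

    unrolled-Schedule : Schedule n b κ H y
    unrolled-Schedule = record
      { recurs   = λ t j → cong (λ l → nth l j) (prefix-shift b n c-recurs t (suc j))
      ; inherits = inherits
      ; finite   = finite
      ; total    = λ t → trans (sym (sum-applyUpTo (y t) H)) (trans (cong sumℕ (sym (prefix-unrolled b c t H))) (sum-prefix t))
      ; capped   = capped
      }
      where
      inherits : ∀ t j → y t (suc j) ≤ y (suc t) j
      inherits t j with landing-suc t (suc j) (proj₂ (landing (suc t) (suc j)))
      ... | _ , _ , h , _ = ≤-trans (≤-reflexive (sym (trans (cong (λ l → nth l j) (spread-unrolled t (suc j))) (nth-applyUpTo (y t ∘ suc) ≤-refl)))) (nth-≤* h j)
      finite : ∀ t j → H ≤ j → y t j ≡ 0
      finite t j H≤j = n≤0⇒n≡0 (+-cancelˡ-≤ b _ _ (begin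
        b + y t j                          ≡⟨ cong (_+ y t j) (sym (trans (sym (+-identityʳ _)) (trans (cong (λ x → sumℕ (p t j) + x) (sym done)) (prefix+aloft t j)))) ⟩
        sumℕ (p t j) + y t j               ≡⟨ sym (sum-prefix-suc t j) ⟩
        sumℕ (p t (suc j))                 ≤⟨ m≤m+n _ _ ⟩
        sumℕ (p t (suc j)) + aloft t (suc j) ≡⟨ trans (prefix+aloft t (suc j)) (sym (+-identityʳ b)) ⟩
        b + 0                              ∎))
        where
        open ≤-Reasoning
        done : aloft t j ≡ 0
        done = n≤0⇒n≡0 (≤-trans (aloft-antitone t H≤j) (≤-reflexive (lands t)))
      capped : ∀ t j → y t j ≤ κ
      capped t j = last-≤ (p t j) (subst (All (_≤ κ)) (prefix-∷ʳ b c t j) (All-nz⁻ (p t (suc j)) (All.++⁻ˡ (nz (p t (suc j)))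
        (subst (All (_≤ κ)) (proj₂ (landing t (suc j))) (All.map proj₂ (proj₂ (comp t)))))))
        where
        last-≤ : ∀ l → All (_≤ κ) (l ∷ʳ y t j) → y t j ≤ κ
        last-≤ l a with All.++⁻ʳ l a
        ... | q ∷ [] = q

    open ScheduleWalk unrolled-Schedule using (card; state; now; later)

    now≡ : ∀ t → now t ≡ p t H
    now≡ t = sym (prefix-unrolled b c t H)

    state-unrolled : ∀ t → state t ≡ r t
    state-unrolled t = trans (cong nz (now≡ t)) (nz-prefix t)

    -- A card of the form `just` lets at least one ball land, because parts are positive; so the
    -- first entry of the schedule tells the two kinds of card apart.
    card-unrolled : ∀ t → card t ≡ c t
    card-unrolled t = trans (cong₂ (λ a l → cardOf (y t 0) (sel a l)) (now≡ (suc t)) (sym (spread-unrolled t H))) (go (c t) refl (deals t))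
      where
      go : ∀ x → c t ≡ x → Deals x (r t) (r (suc t)) → cardOf (first b (c t)) (sel (p (suc t) H) (spreadCard (c t) (p (suc t) H))) ≡ c t
      go nothing  e _ = trans (cong (λ x → cardOf (first b x) (sel (p (suc t) H) (spreadCard x (p (suc t) H)))) e) (sym e)
      go (just e′) e (e≤ , d) = trans (cong (λ x → cardOf (first b x) (sel (p (suc t) H) (spreadCard x (p (suc t) H)))) e)
        (trans (cong₂ cardOf first≡ (sel-spread e′ (p (suc t) H) (trans (Pointwise.Pointwise-length e≤) (cong length (sym (nz-prefix (suc t))))))) (sym e))
        where
        head-pos : 1 ≤ sumℕ (r (suc t)) ∸ sumℕ e′
        head-pos with subst (All _) d (proj₂ (comp t))
        ... | (h , _) ∷ _ = h
        first≡ : b ∸ sumℕ e′ ≡ suc (pred (b ∸ sumℕ e′))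
        first≡ with b ∸ sumℕ e′ | subst (λ s → 1 ≤ s ∸ sumℕ e′) (proj₁ (comp (suc t))) head-pos
        ... | suc _ | _ = refl

-- Closed paths as periodic walks

module _ {b κ : ℕ} where

  states : ∀ {n q z} → Path b κ n q z → ℕ → List ℕ
  states {zero}  {q} _ _ = q
  states {suc n} {q} _ zero = q
  states {suc n} (_ , _ , _ , p) (suc i) = states p i

  cards : ∀ {n q z} → Path b κ n q z → ℕ → Card
  -- The default beyond the last step is a card that `onTop` leaves unchanged.
  cards {zero}  _ _ = nothing
  cards {suc n} (_ , _ , (c , _) , _) zero = c
  cards {suc n} (_ , _ , _ , p) (suc i) = cards p i

  states-start : ∀ n {q z} (p : Path b κ n q z) → states p 0 ≡ q
  states-start zero    p = refl
  states-start (suc n) p = refl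

  states-end : ∀ n {q z} (p : Path b κ n q z) → states p n ≡ z
  states-end zero    p = p
  states-end (suc n) (_ , _ , _ , p) = states-end n p

  states-comp : ∀ n {q z} (p : Path b κ n q z) → IsComp b κ q → ∀ i → IsComp b κ (states p i)
  states-comp zero    p Cq i       = Cq
  states-comp (suc n) p Cq zero    = Cq
  states-comp (suc n) (_ , Cs , _ , p) Cq (suc i) = states-comp n p Cs i

  cards-deal : ∀ n {q z} (p : Path b κ n q z) → ∀ i → i < n → Deals (cards p i) (states p i) (states p (suc i))
  cards-deal (suc n) {q} (_ , _ , (c , d) , p) zero _ = subst (Deals c q) (sym (states-start n p)) d
  cards-deal (suc n) (_ , _ , _ , p) (suc i) (s≤s i<n) = cards-deal n p i i<n

  Path-≡ : ∀ n {q z} {p p′ : Path b κ n q z} → (∀ i → i < n → cards p i ≡ cards p′ i) → (∀ i → i ≤ n → states p i ≡ states p′ i) → p ≡ p′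
  Path-≡ zero    _ _ = ≡-prop _ _
  Path-≡ (suc n) {q} {z} {s , Cs , (c , d) , p} {s′ , Cs′ , (c′ , d′) , p′} ec es =
    go (trans (sym (states-start n p)) (trans (es 1 (s≤s z≤n)) (states-start n p′))) (ec 0 (s≤s z≤n)) (λ i i<n → ec (suc i) (s≤s i<n)) (λ i i≤n → es (suc i) (s≤s i≤n))
    where
    go : ∀ {s s′ Cs Cs′ c c′ d d′ p p′} → s ≡ s′ → c ≡ c′ → (∀ i → i < n → cards {n} {s} {z} p i ≡ cards {n} {s′} {z} p′ i) → (∀ i → i ≤ n → states p i ≡ states p′ i) →
      _≡_ {A = Path b κ (suc n) q z} (s , Cs , (c , d) , p) (s′ , Cs′ , (c′ , d′) , p′)
    go {s} {Cs = Cs} {Cs′} {c} {d = d} {d′} {p} {p′} refl refl ec es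
      rewrite IsComp-prop b κ s Cs Cs′ | Deals-prop c q s d d′ | Path-≡ n {p = p} {p′} ec es = refl

  ClosedWalk-≡ : ∀ n {w w′ : ClosedWalk b κ n} →
    (∀ i → i < n → cards (proj₂ (proj₂ w)) i ≡ cards (proj₂ (proj₂ w′)) i) → (∀ i → i ≤ n → states (proj₂ (proj₂ w)) i ≡ states (proj₂ (proj₂ w′)) i) → w ≡ w′
  ClosedWalk-≡ n {q , Cq , p} {q′ , Cq′ , p′} ec es = go (trans (sym (states-start n p)) (trans (es 0 z≤n) (states-start n p′))) ec es
    where
    go : ∀ {q q′ Cq Cq′ p p′} → q ≡ q′ → (∀ i → i < n → cards {n} {q} {q} p i ≡ cards {n} {q′} {q′} p′ i) → (∀ i → i ≤ n → states p i ≡ states p′ i) →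
      _≡_ {A = ClosedWalk b κ n} (q , Cq , p) (q′ , Cq′ , p′)
    go {q} {Cq = Cq} {Cq′} refl ec es = cong₂ (λ C p → q , C , p) (IsComp-prop b κ q Cq Cq′) (Path-≡ n ec es)

  module _ {n : ℕ} {c : ℕ → Card} {r : ℕ → List ℕ} (W : Walk n b κ c r) where
    open Walk W

    path : ∀ k t {z} → r (t + k) ≡ z → Path b κ k (r t) z
    path zero    t e = trans (cong r (sym (+-identityʳ t))) e
    path (suc k) t e = r (suc t) , comp (suc t) , (c t , deals t) , path k (suc t) (trans (cong r (sym (+-suc t k))) e)

    path-cards : ∀ k t {z} (e : r (t + k) ≡ z) i → i < k → cards (path k t e) i ≡ c (t + i)
    path-cards (suc k) t e zero    _         = cong c (sym (+-identityʳ t))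
    path-cards (suc k) t e (suc i) (s≤s i<k) = trans (path-cards k (suc t) _ i i<k) (cong c (sym (+-suc t i)))

    path-states : ∀ k t {z} (e : r (t + k) ≡ z) i → i ≤ k → states (path k t e) i ≡ r (t + i)
    path-states zero    t e zero    _         = cong r (sym (+-identityʳ t))
    path-states (suc k) t e zero    _         = cong r (sym (+-identityʳ t))
    path-states (suc k) t e (suc i) (s≤s i≤k) = trans (path-states k (suc t) _ i i≤k) (cong r (sym (+-suc t i)))

    close : ClosedWalk b κ n
    close = r 0 , comp 0 , path n 0 (r-recurs 0)

  unroll : ∀ {n} .{{_ : NonZero n}} ((q , Cq , p) : ClosedWalk b κ n) → Walk n b κ (λ t → cards p (t % n)) (λ t → states p (t % n))
  unroll {n} (q , Cq , p) = record
    { comp     = λ t → states-comp n p Cq (t % n)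
    ; deals    = λ t → subst (Deals (cards p (t % n)) (states p (t % n))) (wrap t) (cards-deal n p (t % n) (DivMod.m%n<n t n))
    ; c-recurs = λ t → cong (cards p) (DivMod.[m+n]%n≡m%n t n)
    ; r-recurs = λ t → cong (states p) (DivMod.[m+n]%n≡m%n t n)
    }
    where
    suc-% : ∀ t → suc (t % n) % n ≡ suc t % n
    suc-% t = trans (cong (_% n) (+-comm 1 (t % n))) (trans (%-+ n t 1) (cong (_% n) (+-comm t 1)))
    wrap : ∀ t → states p (suc (t % n)) ≡ states p (suc t % n)
    wrap t with m≤n⇒m<n∨m≡n (DivMod.m%n<n t n)
    ... | inj₁ h = cong (states p) (trans (sym (DivMod.m<n⇒m%n≡m h)) (suc-% t))
    -- The last step of the period leads back to the start of the path.
    ... | inj₂ h = trans (cong (states p) h) (trans (states-end n p) (trans (sym (states-start n p))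
                     (cong (states p) (trans (sym (DivMod.n%n≡0 n)) (trans (cong (_% n) (sym h)) (suc-% t))))))

-- Static walks and their top part

sum-∷ʳ : ∀ l j → sumℕ (l ∷ʳ j) ≡ sumℕ l + j
sum-∷ʳ l j = trans (sum-++ l (j ∷ [])) (cong (λ x → sumℕ l + x) (+-identityʳ j))

nz-∷ʳ : ∀ l {j} → 1 ≤ j → nz (l ∷ʳ j) ≡ nz l ∷ʳ j
nz-∷ʳ l {suc j} _ = nz-++ l (suc j ∷ [])

lastPart-∷ʳ : ∀ l j → lastPart (l ∷ʳ j) ≡ j
lastPart-∷ʳ l j = lastPart-++ l j []

≤*-∷ʳ : ∀ {e s j} → e ≤* s → (e ∷ʳ j) ≤* (s ∷ʳ j)
≤*-∷ʳ []      = ≤-refl ∷ []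
≤*-∷ʳ (p ∷ q) = p ∷ ≤*-∷ʳ q

onTop : ℕ → Card → Card
onTop j nothing  = nothing
onTop j (just e) = just (e ∷ʳ j)

onTop-injective : ∀ j {c c′} → onTop j c ≡ onTop j c′ → c ≡ c′
onTop-injective j {nothing} {nothing} _ = refl
onTop-injective j {just e} {just e′} h = cong just (List.∷ʳ-injectiveˡ e e′ (just-injective h))
  where
  just-injective : ∀ {x y : List ℕ} → just x ≡ just y → x ≡ y
  just-injective refl = refl

-- The added part cancels in `sumℕ s ∸ sumℕ e`, so the same number of balls lands.
onTop-deals : ∀ {j} → 1 ≤ j → ∀ c {q s} → Deals c q s → Deals (onTop j c) (q ∷ʳ j) (s ∷ʳ j)
onTop-deals 1≤j nothing  refl = refl
onTop-deals {j} 1≤j (just e) {s = s} (e≤s , refl) = ≤*-∷ʳ e≤s , cong₂ _∷_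
  (sym (trans (cong₂ _∸_ (sum-∷ʳ s j) (sum-∷ʳ e j)) (trans (cong₂ _∸_ (+-comm (sumℕ s) j) (+-comm (sumℕ e) j)) ([m+n]∸[m+o]≡n∸o j (sumℕ s) (sumℕ e)))))
  (sym (nz-∷ʳ e 1≤j))

onTop-static : ∀ j c s → Static (onTop j c) (s ∷ʳ j)
onTop-static j nothing  s = tt
onTop-static j (just e) s = trans (lastPart-∷ʳ e j) (sym (lastPart-∷ʳ s j))

-- A static card acts below the top group of the state it is played on.
Below : Card → List ℕ → ℕ → List ℕ → Set
Below c q j s = Σ (List ℕ) λ s′ → Σ Card λ c′ → s ≡ s′ ∷ʳ j × c ≡ onTop j c′ × Deals c′ q s′

unsnoc : ∀ l → 1 ≤ lastPart l → Σ (List ℕ) λ l′ → l ≡ l′ ∷ʳ lastPart l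
unsnoc (x ∷ [])    _ = [] , refl
unsnoc (x ∷ y ∷ l) h with unsnoc (y ∷ l) h
... | l′ , e = x ∷ l′ , cong (x ∷_) e

lastPart-pos : ∀ {κ} x l → All (λ x → 1 ≤ x × x ≤ κ) (x ∷ l) → 1 ≤ lastPart (x ∷ l)
lastPart-pos x []      ((h , _) ∷ _) = h
lastPart-pos x (y ∷ l) (_ ∷ a)       = lastPart-pos y l a

≤*-∷ʳ⁻ : ∀ e s {i j} → (e ∷ʳ i) ≤* (s ∷ʳ j) → e ≤* s
≤*-∷ʳ⁻ []      []          _       = []
≤*-∷ʳ⁻ []      (_ ∷ [])    (_ ∷ ())
≤*-∷ʳ⁻ []      (_ ∷ _ ∷ _) (_ ∷ ())
≤*-∷ʳ⁻ (_ ∷ [])    []      (_ ∷ ())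
≤*-∷ʳ⁻ (_ ∷ _ ∷ _) []      (_ ∷ ())
≤*-∷ʳ⁻ (_ ∷ e) (_ ∷ s)     (p ∷ q) = p ∷ ≤*-∷ʳ⁻ e s q

-- Being static, `e` and `s` end with the same part `j₀`. Comparing last parts in the equation for
-- `q ∷ʳ j` gives `j = j₀`, and this part can be removed on both sides.
static-below : ∀ {b κ} c q j s → IsComp b κ s → 1 ≤ b → Static c s → Deals c (q ∷ʳ j) s → Below c q j s
static-below nothing  q j s _ _ _ d = q , nothing , sym d , refl , refl
static-below (just e) q j [] (refl , _) () _ _
static-below {b} {κ} (just e) q j (x ∷ s) (_ , a) _ st (e≤s , d) = go e s₁ j₀ j₀≥1 (proj₂ e-split) (proj₂ s-split) e≤s d
  where
  j₀ = lastPart (x ∷ s)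
  j₀≥1 = lastPart-pos x s a
  s-split = unsnoc (x ∷ s) j₀≥1
  s₁ = proj₁ s-split
  e-split : Σ (List ℕ) λ e′ → e ≡ e′ ∷ʳ j₀
  e-split with unsnoc e (subst (1 ≤_) (sym st) j₀≥1)
  ... | e′ , eq = e′ , trans eq (cong (e′ ∷ʳ_) st)
  go : ∀ e {e′} s′ j₀ {s} → 1 ≤ j₀ → e ≡ e′ ∷ʳ j₀ → s ≡ s′ ∷ʳ j₀ → e ≤* s → q ∷ʳ j ≡ (sumℕ s ∸ sumℕ e) ∷ nz e → Below (just e) q j s
  go _ {e′} s′ j₀ h refl refl e≤s d with List.∷ʳ-injective q ((sumℕ s′ ∸ sumℕ e′) ∷ nz e′)
    (trans d (cong₂ _∷_ (trans (cong₂ _∸_ (trans (sum-∷ʳ s′ j₀) (+-comm (sumℕ s′) j₀)) (trans (sum-∷ʳ e′ j₀) (+-comm (sumℕ e′) j₀))) ([m+n]∸[m+o]≡n∸o j₀ (sumℕ s′) (sumℕ e′))) (nz-∷ʳ e′ h)))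
  ... | refl , refl = s′ , just e′ , refl , refl , ≤*-∷ʳ⁻ e′ s′ e≤s , refl

IsComp-∷ʳ : ∀ {i j b κ q} → i + j ≡ b → 1 ≤ j → j ≤ κ → IsComp i κ q → IsComp b κ (q ∷ʳ j)
IsComp-∷ʳ {j = j} {q = q} refl 1≤j j≤κ (refl , a) = sum-∷ʳ q j , All.++⁺ a ((1≤j , j≤κ) ∷ [])

IsComp-∷ʳ⁻ : ∀ {i j b κ} q → i + j ≡ b → IsComp b κ (q ∷ʳ j) → IsComp i κ q
IsComp-∷ʳ⁻ {i} {j} q refl (e , a) = +-cancelʳ-≡ j _ i (trans (sym (sum-∷ʳ q j)) e) , All.++⁻ˡ q a

module _ {i j b κ : ℕ} (i+j≡b : i + j ≡ b) (1≤j : 1 ≤ j) (j≤κ : j ≤ κ) where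

  topPath : ∀ n {q z} → Path i κ n q z → Path b κ n (q ∷ʳ j) (z ∷ʳ j)
  topPath zero    refl = refl
  topPath (suc n) (s , Cs , (c , d) , p) = s ∷ʳ j , IsComp-∷ʳ i+j≡b 1≤j j≤κ Cs , (onTop j c , onTop-deals 1≤j c d) , topPath n p

  topPath-cards : ∀ n {q z} (p : Path i κ n q z) k → cards (topPath n p) k ≡ onTop j (cards p k)
  topPath-cards zero    refl k       = refl
  topPath-cards (suc n) p    zero    = refl
  topPath-cards (suc n) (_ , _ , _ , p) (suc k) = topPath-cards n p k

  topPath-states : ∀ n {q z} (p : Path i κ n q z) k → states (topPath n p) k ≡ states p k ∷ʳ j
  topPath-states zero    refl k       = refl
  topPath-states (suc n) p    zero    = refl
  topPath-states (suc n) (_ , _ , _ , p) (suc k) = topPath-states n p k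

  topWalk : ∀ n → ClosedWalk i κ n → ClosedWalk b κ n
  topWalk n (q , Cq , p) = q ∷ʳ j , IsComp-∷ʳ i+j≡b 1≤j j≤κ Cq , topPath n p

  topWalk-injective : ∀ n {w w′} → topWalk n w ≡ topWalk n w′ → w ≡ w′
  topWalk-injective n {q , Cq , p} {q′ , Cq′ , p′} e = ClosedWalk-≡ n
    (λ k _ → onTop-injective j (trans (sym (topPath-cards n p k)) (trans (cong (λ w → cards (proj₂ (proj₂ w)) k) e) (topPath-cards n p′ k))))
    (λ k _ → List.∷ʳ-injectiveˡ (states p k) (states p′ k) (trans (sym (topPath-states n p k)) (trans (cong (λ w → states (proj₂ (proj₂ w)) k) e) (topPath-states n p′ k))))

  -- Each static card hands the same top part `j` on to the next state, so it can be removed along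
  -- the whole path.
  strip : ∀ n {q z} (p : Path b κ n (q ∷ʳ j) z) → (∀ k → k < n → Static (cards p k) (states p (suc k))) →
    Σ (List ℕ) λ z′ → Σ (Path i κ n q z′) λ p′ →
      (∀ k → cards p k ≡ onTop j (cards p′ k)) × (∀ k → states p k ≡ states p′ k ∷ʳ j)
  strip zero    {q} refl _ = q , refl , (λ _ → refl) , λ _ → refl
  strip (suc n) {q} (s , Cs , (c , d) , p) st
    with static-below c q j s Cs (≤-trans 1≤j (≤-trans (m≤n+m j i) (≤-reflexive i+j≡b))) (subst (Static c) (states-start n p) (st 0 (s≤s z≤n))) d
  ... | s′ , c′ , refl , refl , d′ with strip n p (λ k k<n → st (suc k) (s≤s k<n))
  ... | z′ , p′ , ec , es = z′ , (s′ , IsComp-∷ʳ⁻ s′ i+j≡b Cs , (c′ , d′) , p′) ,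
    (λ { zero → refl ; (suc k) → ec k }) , λ { zero → refl ; (suc k) → es k }

StaticWalk : ∀ {b κ n} → ClosedWalk b κ n → Set
StaticWalk {n = n} (_ , _ , p) = ∀ k → k < n → Static (cards p k) (states p (suc k))

topWalk-static : ∀ {i j b κ n} (e : i + j ≡ b) (1≤j : 1 ≤ j) (j≤κ : j ≤ κ) (w : ClosedWalk i κ n) → StaticWalk (topWalk e 1≤j j≤κ n w)
topWalk-static {j = j} {n = n} e 1≤j j≤κ (_ , _ , p) k k<n = subst₂ Static (sym (topPath-cards e 1≤j j≤κ n p k)) (sym (topPath-states e 1≤j j≤κ n p (suc k)))
  (onTop-static j (cards p k) (states p (suc k)))

static⇒topWalk : ∀ {b κ n} → 1 ≤ b → (w : ClosedWalk b κ n) → StaticWalk w →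
  Σ ℕ λ i → Σ ℕ λ j → Σ (i + j ≡ b) λ e → Σ (1 ≤ j) λ 1≤j → Σ (j ≤ κ) λ j≤κ → Σ (ClosedWalk i κ n) λ w′ → topWalk e 1≤j j≤κ n w′ ≡ w
static⇒topWalk () ([] , (refl , _) , p)
static⇒topWalk {b} {κ} {n} 1≤b (x ∷ q , Cq@(_ , a) , p) st = go (proj₂ (unsnoc (x ∷ q) j≥1)) Cq p st
  where
  j≥1 = lastPart-pos x q a
  go : ∀ {q q′ j} → q ≡ q′ ∷ʳ j → (Cq : IsComp b κ q) (p : Path b κ n q q) → StaticWalk (q , Cq , p) →
    Σ ℕ λ i → Σ ℕ λ j → Σ (i + j ≡ b) λ e → Σ (1 ≤ j) λ 1≤j → Σ (j ≤ κ) λ j≤κ → Σ (ClosedWalk i κ n) λ w′ → topWalk e 1≤j j≤κ n w′ ≡ (q , Cq , p)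
  go {q′ = q′} {j} refl Cq p st with All.++⁻ʳ q′ (proj₂ Cq)
  ... | (1≤j , j≤κ) ∷ [] with trans (sym (sum-∷ʳ q′ j)) (proj₁ Cq)
  ... | e with strip e 1≤j j≤κ n p st
  -- Stripping produces its own end point; it is `q′`, because the original path ends at `q′ ∷ʳ j`.
  ... | z′ , p′ , ec , es with List.∷ʳ-injectiveˡ q′ z′ (trans (sym (states-end n p)) (trans (es n) (cong (_∷ʳ j) (states-end n p′))))
  ... | refl = sumℕ q′ , j , e , 1≤j , j≤κ , (q′ , IsComp-∷ʳ⁻ q′ e Cq , p′) , ClosedWalk-≡ n
    (λ k _ → trans (topPath-cards e 1≤j j≤κ n p′ k) (sym (ec k))) (λ k _ → trans (topPath-states e 1≤j j≤κ n p′ k) (sym (es k)))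

module _ {n b κ H : ℕ} {y y′ : ℕ → ℕ → ℕ} (Y : Schedule n b κ H y) (Y′ : Schedule n b κ H y′) (e : ∀ t j → y t j ≡ y′ t j) where

  card-cong : ∀ t → ScheduleWalk.card Y t ≡ ScheduleWalk.card Y′ t
  card-cong t = cong₂ cardOf (e t 0) (cong₂ sel (applyUpTo-cong H (e (suc t))) (applyUpTo-cong H λ j → e t (suc j)))

  state-cong : ∀ t → ScheduleWalk.state Y t ≡ ScheduleWalk.state Y′ t
  state-cong t = cong nz (applyUpTo-cong H (e t))

topWalk-irrelevant : ∀ {i j j′ b κ n} (w : ClosedWalk i κ n) {e : i + j ≡ b} {e′ : i + j′ ≡ b} {1≤j 1≤j′ j≤κ j′≤κ} → j ≡ j′ →
  topWalk e 1≤j j≤κ n w ≡ topWalk e′ 1≤j′ j′≤κ n w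
topWalk-irrelevant w {e} {e′} {p} {p′} {q} {q′} refl rewrite ≡-prop e e′ | ≤-irrelevant p p′ | ≤-irrelevant q q′ = refl

-- The number of siteswaps

module SiteswapCount (n b κ : ℕ) .{{_ : NonZero n}} where

  private
    -- The first term covers the time of a non-static card in the period, `n * n` the wait for it
    -- from another time, and `b * n` the periods until all balls have landed. The last term also
    -- bounds every height.
    H = n + n * n + b * n

    nb≤H : n * b ≤ H
    nb≤H = ≤-trans (≤-reflexive (*-comm n b)) (m≤n+m (b * n) _)

    Y : (S : Siteswap n b κ) → Schedule n b κ H (schedule (proj₁ S))
    Y S = schedule-is-Schedule S H nb≤H

    module SW (S : Siteswap n b κ) = ScheduleWalk (Y S)

  siteswapWalk : Siteswap n b κ → ClosedWalk b κ n
  siteswapWalk S = close (SW.walk S)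

  private
    walk-cards : ∀ S i → i < n → cards (proj₂ (proj₂ (siteswapWalk S))) i ≡ SW.card S i
    walk-cards S i = path-cards (SW.walk S) n 0 (Walk.r-recurs (SW.walk S) 0) i

    walk-states : ∀ S i → i ≤ n → states (proj₂ (proj₂ (siteswapWalk S))) i ≡ SW.state S i
    walk-states S i = path-states (SW.walk S) n 0 (Walk.r-recurs (SW.walk S) 0) i

  siteswapWalk-injective : ∀ {S S′} → siteswapWalk S ≡ siteswapWalk S′ → S ≡ S′
  siteswapWalk-injective {S} {S′} e = schedule-injective S S′ same-schedule
    where
    same-card : ∀ t → SW.card S t ≡ SW.card S′ t
    same-card t = begin
      SW.card S t                                         ≡⟨ sym (periodic-% n (Walk.c-recurs (SW.walk S)) t) ⟩
      SW.card S (t % n)                                   ≡⟨ sym (walk-cards S (t % n) (DivMod.m%n<n t n)) ⟩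
      cards (proj₂ (proj₂ (siteswapWalk S))) (t % n)      ≡⟨ cong (λ w → cards (proj₂ (proj₂ w)) (t % n)) e ⟩
      cards (proj₂ (proj₂ (siteswapWalk S′))) (t % n)     ≡⟨ walk-cards S′ (t % n) (DivMod.m%n<n t n) ⟩
      SW.card S′ (t % n)                                  ≡⟨ periodic-% n (Walk.c-recurs (SW.walk S′)) t ⟩
      SW.card S′ t                                        ∎
      where open ≡-Reasoning
    same-schedule : ∀ t j → schedule (proj₁ S) t j ≡ schedule (proj₁ S′) t j
    same-schedule t j = go (j ≤? H)
      where
      go : Dec (j ≤ H) → schedule (proj₁ S) t j ≡ schedule (proj₁ S′) t j
      go (yes j≤H) = trans (sym (SW.unrolled-card S t j j≤H)) (trans (cong (λ l → nth l j) (prefix-cong b same-card t (suc j))) (SW.unrolled-card S′ t j j≤H))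
      go (no j≰H)  = trans (Schedule.finite (Y S) t j (<⇒≤ (≰⇒> j≰H))) (sym (Schedule.finite (Y S′) t j (<⇒≤ (≰⇒> j≰H))))

  siteswapWalk-not-static : ∀ S → 1 ≤ b → ¬ StaticWalk (siteswapWalk S)
  siteswapWalk-not-static S 1≤b st = contradiction (subst (1 ≤_) (SW.all-static⇒empty S static) 1≤b) λ ()
    where
    suc-% : ∀ t → suc (t % n) % n ≡ suc t % n
    suc-% t = trans (cong (_% n) (+-comm 1 (t % n))) (trans (%-+ n t 1) (cong (_% n) (+-comm t 1)))
    static : ∀ t → Static (SW.card S t) (SW.state S (suc t))
    static t = subst₂ Static
      (trans (walk-cards S (t % n) (DivMod.m%n<n t n)) (periodic-% n (Walk.c-recurs (SW.walk S)) t))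
      (trans (walk-states S (suc (t % n)) (DivMod.m%n<n t n)) (periodic-≡% n (Walk.r-recurs (SW.walk S)) (suc-% t)))
      (st (t % n) (DivMod.m%n<n t n))

  sitting : (w : ClosedWalk b κ n) → (∀ t → WalkSchedule.aloft (unroll w) t H ≡ 0) → Σ (Siteswap n b κ) λ S → siteswapWalk S ≡ w
  sitting w@(q , Cq , p) lands = U-swap , ClosedWalk-≡ n
    (λ i i<n → trans (walk-cards U-swap i i<n) (trans (card-cong (Y U-swap) U same i) (trans (WalkSchedule.card-unrolled (unroll w) {H} lands i) (cong (cards p) (DivMod.m<n⇒m%n≡m i<n)))))
    (λ i i≤n → trans (walk-states U-swap i i≤n) (trans (state-cong (Y U-swap) U same i) (trans (WalkSchedule.state-unrolled (unroll w) {H} lands i) (wrap i (m≤n⇒m<n∨m≡n i≤n)))))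
    where
    U = WalkSchedule.unrolled-Schedule (unroll w) {H} lands
    U-swap = FromSchedule.siteswap U
    same = FromSchedule.schedule-sites U
    wrap : ∀ i → i < n ⊎ i ≡ n → states p (i % n) ≡ states p i
    wrap i (inj₁ i<n)  = cong (states p) (DivMod.m<n⇒m%n≡m i<n)
    wrap i (inj₂ refl) = trans (cong (states p) (DivMod.n%n≡0 n)) (trans (states-start n p) (sym (states-end n p)))

  lower : List ℕ
  lower = filter (λ i → b ∸ κ ≤? i) (upTo b)

  Topped : Set
  Topped = Σ ℕ λ i → i ∈ lower × ClosedWalk i κ n

  module _ {i : ℕ} (i∈ : i ∈ lower) where
    i<b : i < b
    i<b = ∈-upTo⁻ (proj₁ (∈-filter⁻ (λ i → b ∸ κ ≤? i) i∈))

    top-sum : i + (b ∸ i) ≡ b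
    top-sum = m+[n∸m]≡n (<⇒≤ i<b)

    top-pos : 1 ≤ b ∸ i
    top-pos = m<n⇒0<n∸m i<b

    top-cap : b ∸ i ≤ κ
    top-cap = m≤n+o⇒m∸n≤o b i (≤-trans (m≤n+m∸n b κ) (≤-trans (+-monoʳ-≤ κ (proj₂ (∈-filter⁻ (λ i → b ∸ κ ≤? i) {xs = upTo b} i∈))) (≤-reflexive (+-comm κ i))))

  toppedWalk : Topped → ClosedWalk b κ n
  toppedWalk (i , i∈ , w) = topWalk (top-sum i∈) (top-pos i∈) (top-cap i∈) n w

  toppedWalk-injective : ∀ {x x′} → toppedWalk x ≡ toppedWalk x′ → x ≡ x′
  toppedWalk-injective {i , i∈ , w} {i′ , i∈′ , w′} e = go i≡i′ i∈ i∈′ w w′ e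
    where
    i≡i′ : i ≡ i′
    -- The last part of the initial state is `b ∸ i`, which determines `i`.
    i≡i′ = trans (sym (m∸[m∸n]≡n (<⇒≤ (i<b i∈)))) (trans (cong (b ∸_) (List.∷ʳ-injectiveʳ (proj₁ w) (proj₁ w′) (cong proj₁ e))) (m∸[m∸n]≡n (<⇒≤ (i<b i∈′))))
    go : ∀ {i i′} → i ≡ i′ → (i∈ : i ∈ lower) (i∈′ : i′ ∈ lower) (w : ClosedWalk i κ n) (w′ : ClosedWalk i′ κ n) →
      toppedWalk (i , i∈ , w) ≡ toppedWalk (i′ , i∈′ , w′) → _≡_ {A = Topped} (i , i∈ , w) (i′ , i∈′ , w′)
    go {i} refl i∈ i∈′ w w′ e = cong₂ (λ i∈ w → i , i∈ , w) (unique⇒∈-prop (Unique.filter⁺ (λ i → b ∸ κ ≤? i) (Unique.upTo⁺ b)) i i∈ i∈′)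
      (topWalk-injective (top-sum i∈) (top-pos i∈) (top-cap i∈) n (trans e (topWalk-irrelevant w′ refl)))

  walkOf : Siteswap n b κ ⊎ Topped → ClosedWalk b κ n
  walkOf = [ siteswapWalk , toppedWalk ]′

  walkOf-injective : ∀ {x x′} → walkOf x ≡ walkOf x′ → x ≡ x′
  walkOf-injective {inj₁ S} {inj₁ S′} e = cong inj₁ (siteswapWalk-injective e)
  walkOf-injective {inj₂ x} {inj₂ x′} e = cong inj₂ (toppedWalk-injective e)
  -- Topped walks are static, whereas those of siteswaps with at least one ball are not; `i < b`
  -- supplies the ball.
  walkOf-injective {inj₁ S} {inj₂ (i , i∈ , w)} e = contradiction
    (subst StaticWalk (sym e) (topWalk-static (top-sum i∈) (top-pos i∈) (top-cap i∈) w)) (siteswapWalk-not-static S (≤-trans (s≤s z≤n) (i<b i∈)))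
  walkOf-injective {inj₂ (i , i∈ , w)} {inj₁ S} e = contradiction
    (subst StaticWalk e (topWalk-static (top-sum i∈) (top-pos i∈) (top-cap i∈) w)) (siteswapWalk-not-static S (≤-trans (s≤s z≤n) (i<b i∈)))

  private
    Preimage : ClosedWalk b κ n → Set
    Preimage w = Σ (Siteswap n b κ ⊎ Topped) λ x → walkOf x ≡ w

    seated : ∀ {w} → (Σ (Siteswap n b κ) λ T → siteswapWalk T ≡ w) → Preimage w
    seated (T , e) = inj₁ T , e

    topped : ∀ {w} → (Σ ℕ λ i → Σ ℕ λ j → Σ (i + j ≡ b) λ e → Σ (1 ≤ j) λ 1≤j → Σ (j ≤ κ) λ j≤κ → Σ (ClosedWalk i κ n) λ w′ → topWalk e 1≤j j≤κ n w′ ≡ w) → Preimage w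
    topped (i , j , i+j≡b , 1≤j , j≤κ , w′ , e) = inj₂ (i , i∈ , w′) , trans (topWalk-irrelevant w′ (trans (cong (_∸ i) (sym i+j≡b)) (m+n∸m≡n i j))) e
      where
      i∈ : i ∈ lower
      i∈ = ∈-filter⁺ (λ i → b ∸ κ ≤? i) (∈-upTo⁺ (≤-trans (≤-trans (≤-reflexive (+-comm 1 i)) (+-monoʳ-≤ i 1≤j)) (≤-reflexive i+j≡b)))
        (m≤n+o⇒m∸n≤o b κ (≤-trans (≤-reflexive (trans (sym i+j≡b) (+-comm i j))) (+-monoˡ-≤ i j≤κ)))

    moving : ∀ ((q , Cq , p) : ClosedWalk b κ n) k → k < n → ¬ Static (cards p k) (states p (suc k)) → Preimage (q , Cq , p)
    moving w@(q , Cq , p) k k<n ¬st = seated (sitting w (WalkSchedule.all-land (unroll w) k ¬st′ {H} bound))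
      where
      wrap : suc k < n ⊎ suc k ≡ n → states p (suc k % n) ≡ states p (suc k)
      wrap (inj₁ h)    = cong (states p) (DivMod.m<n⇒m%n≡m h)
      wrap (inj₂ refl) = trans (cong (states p) (DivMod.n%n≡0 n)) (trans (states-start n p) (sym (states-end n p)))
      ¬st′ : ¬ Static (cards p (k % n)) (states p (suc k % n))
      ¬st′ st = ¬st (subst₂ Static (cong (cards p) (DivMod.m<n⇒m%n≡m k<n)) (wrap (m≤n⇒m<n∨m≡n k<n)) st)
      bound : ∀ t → t < n → k + (t * n ∸ t) + b * n ≤ H
      bound t t<n = +-monoˡ-≤ (b * n) (+-mono-≤ (<⇒≤ k<n) (≤-trans (m∸n≤m (t * n) t) (*-monoˡ-≤ n (<⇒≤ t<n))))

  -- With no balls every walk is static and still comes from a siteswap, as there is no top part to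
  -- strip; hence the separate case `b = 0`.
  walkOf-surjective : ∀ w → Σ (Siteswap n b κ ⊎ Topped) λ x → walkOf x ≡ w
  walkOf-surjective w@(q , Cq , p) = go (b ≟ 0) (anyUpTo? (λ k → ¬? (Static? (cards p k) (states p (suc k)))) n)
    where
    go : Dec (b ≡ 0) → Dec (∃ λ k → k < n × ¬ Static (cards p k) (states p (suc k))) → Preimage w
    go (yes b≡0) _                     = seated (sitting w (WalkSchedule.no-balls-land (unroll w) b≡0 H))
    go (no b≢0)  (yes (k , k<n , ¬st)) = moving w k k<n ¬st
    go (no b≢0)  (no all) = topped (static⇒topWalk (n≢0⇒n>0 b≢0) w λ k k<n →
      decidable-stable (Static? (cards p k) (states p (suc k))) λ ¬st → all (k , k<n , ¬st))

  siteswaps⊎topped : (Siteswap n b κ ⊎ Topped) ↔ Fin (trA^ b κ n)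
  siteswaps⊎topped = ↔-trans (section⇒↔ walkOf (proj₁ ∘ walkOf-surjective) (proj₂ ∘ walkOf-surjective) walkOf-injective) (size-ClosedWalk b κ n)

  size-Topped : Topped ↔ Fin (sumℕ (map (λ i → trA^ i κ n) lower))
  size-Topped = size-Σ∈ lower λ i _ → size-ClosedWalk i κ n

  private
    left-part : ∃ λ k → Siteswap n b κ ↔ Fin k
    left-part = left-finite siteswaps⊎topped

  abstract
    ss : ℕ
    ss = proj₁ left-part

    size-Siteswap : Siteswap n b κ ↔ Fin ss
    size-Siteswap = proj₂ left-part

  ss≡S : + ss ≡ S b κ n
  ss≡S = begin
    + ss                                                   ≡⟨ sym (ℤ.+-identityʳ (+ ss)) ⟩
    + ss ℤ.+ (+ 0)                                         ≡⟨ cong (λ x → + ss ℤ.+ x) (sym (ℤ.+-inverseʳ (+ M))) ⟩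
    + ss ℤ.+ (+ M ℤ.- + M)                                 ≡⟨ sym (ℤ.+-assoc (+ ss) (+ M) (- + M)) ⟩
    + (ss + M) ℤ.- + M                                     ≡⟨ cong₂ (λ x z → + x ℤ.- z) (size-unique (size-⊎ size-Siteswap size-Topped) siteswaps⊎topped) (sum-+ lower) ⟩
    S b κ n                                                ∎
    where
    open ≡-Reasoning
    M = sumℕ (map (λ i → trA^ i κ n) lower)
    sum-+ : ∀ l → + sumℕ (map (λ i → trA^ i κ n) l) ≡ sumℤ (map (λ i → + trA^ i κ n) l)
    sum-+ []      = refl
    sum-+ (i ∷ l) = cong (λ x → + trA^ i κ n ℤ.+ x) (sum-+ l)

-- The Möbius function and Möbius inversion

-- `mobFuel` and `spf` are private in Defs, so terms convertible to them are obtained by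
-- unification.  The presentations force μ u to unfold inside a solved metavariable; `cong!`
-- anti-unifies two unfoldings that differ in one argument and so abstracts that argument;
-- `with` abstracts the divisor list and `div-helper`, which isolates `spf` inside the quotient.
data Tag {A : Set} : A → Set where
  tag : (x : A) → Tag x

data Box : Set where
  box : ℤ → Box

data TagBox : Box → Set where
  tagBox : ∀ {z} → Tag z → TagBox (box z)

data Same {A : Set} (a : A) : {B : Set} → B → Set where
  same : Same a a

μ-presentation : ((m : ℕ) → Tag (μ m)) → Σ (ℕ → Box) λ b → ∀ u → TagBox (b u)
μ-presentation v with tt
... | _ = (λ u → box _) , λ u → tagBox (v u)

μ-presentation′ : ((m : ℕ) → Tag (μ m)) → Σ (ℕ → Box) λ b → ∀ u → Σ ℕ λ y → TagBox (b y) × y ≡ u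
μ-presentation′ v with tt
... | _ = (λ u → box _) , λ u → _ , tagBox (v ⌞ u ⌟) , refl

mobFuel-name : Σ (ℕ → ℕ → ℤ) λ g → ∀ u (p : ⌞ u ⌟ ≡ u) → Σ ℤ λ a → Σ ℤ λ b →
  (box a ≡ proj₁ (μ-presentation′ (λ m → tag (μ m))) u) × (box b ≡ proj₁ (μ-presentation (λ m → tag (μ m))) u)
  × Σ (a ≡ b) λ q → Same q (cong (g u) p)
mobFuel-name = _ , λ u p → _ , _ , refl , refl , cong! p , same

mobF : ℕ → ℕ → ℤ
mobF = proj₁ mobFuel-name

-- `2` and `3` are squarefree, so the clause with the quotient unfolds. Written as `2 + k` they
-- differ only in `k`, which `step` then abstracts.
step₂ step₃ : Σ (ℕ → Box) λ b → ∀ f → Σ ℕ λ y → TagBox (b y) × y ≡ f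
step₂ = (λ f → box _) , λ f → _ , tagBox (tag (mobF (suc f) 2)) , refl
step₃ = (λ f → box _) , λ f → _ , tagBox (tag (mobF (suc f) 3)) , refl

step : Σ (ℕ → ℕ → ℤ) λ g → ∀ f (p : 0 ≡ 1) → Σ ℤ λ a → Σ ℤ λ b →
  (box a ≡ proj₁ step₂ f) × (box b ≡ proj₁ step₃ f) × Σ (a ≡ b) λ q → Same q (cong (g f) p)
step = _ , λ f p → _ , _ , refl , refl , cong! p , same

quotient-name : Σ (ℕ → ℕ) λ w → ∀ f k → proj₁ step f k ≡ - mobF f (w k)
quotient-name = _ , λ f k → refl

divisors₂ : ℕ → List ℕ
divisors₂ m = filter (λ j → suc (suc j) ∣? m) (upTo m)

split-divisors : ∀ k → Σ (List ℕ → ℕ) λ c → Tag (proj₁ quotient-name k) → Tag (c (divisors₂ (2 + k))) × Tag c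
split-divisors k = _ , aux
  where
  aux : let c = (List ℕ → ℕ) ∋ _ in Tag (proj₁ quotient-name k) → Tag (c (divisors₂ (2 + k))) × Tag c
  aux v with divisors₂ (2 + k)
  ... | w = v , tag _

spf-name : ∀ k → Σ (List ℕ → ℕ) λ s → ∀ w → Tag (proj₁ (split-divisors k) w) →
  Tag (div-helper 0 (suc (s w)) (suc k) (s w)) × Tag s
spf-name k = _ , aux
  where
  aux : let s = (List ℕ → ℕ) ∋ _ in ∀ w → Tag (proj₁ (split-divisors k) w) →
    Tag (div-helper 0 (suc (s w)) (suc k) (s w)) × Tag s
  aux w v with div-helper
  ... | h = v , tag _

-- Convertible to spf (2 + k).
sp : ℕ → ℕ
sp k = proj₁ (spf-name k) (divisors₂ (2 + k))

sp-first : ∀ k {j l} → divisors₂ (2 + k) ≡ j ∷ l → sp k ≡ j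
sp-first k e with divisors₂ (2 + k)
sp-first k refl | _ = refl

mobF-square : ∀ f k → (2 + sp k) * (2 + sp k) ∣ 2 + k → mobF (suc f) (2 + k) ≡ + 0
mobF-square f k d with ((2 + sp k) * (2 + sp k)) ∣? (2 + k)
... | yes _ = refl
... | no ¬d = contradiction d ¬d

mobF-squarefree : ∀ f k → ¬ (2 + sp k) * (2 + sp k) ∣ 2 + k → mobF (suc f) (2 + k) ≡ - mobF f ((2 + k) / (2 + sp k))
mobF-squarefree f k ¬d with ((2 + sp k) * (2 + sp k)) ∣? (2 + k)
... | yes d = contradiction d ¬d
... | no _ = refl

first-of-filter : ∀ {P : ℕ → Set} (P? : ∀ j → Dec (P j)) (f : ℕ → ℕ) n {j l} → filter P? (applyUpTo f n) ≡ j ∷ l →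
  ∃ λ i → j ≡ f i × P j × (∀ i′ → i′ < i → ¬ P (f i′))
first-of-filter {P} P? f (suc n) {j} e = go (P? (f 0))
  where
  go : Dec (P (f 0)) → ∃ λ i → j ≡ f i × P j × (∀ i′ → i′ < i → ¬ P (f i′))
  go (yes p) with trans (sym (List.filter-accept P? p)) e
  ... | refl = 0 , refl , p , λ _ ()
  go (no ¬p) with first-of-filter P? (f ∘ suc) n (trans (sym (List.filter-reject P? ¬p)) e)
  ... | i , j≡ , Pj , least = suc i , j≡ , Pj , λ { zero _ → ¬p ; (suc i′) (s≤s h) → least i′ h }

least-factor : ∀ k → 2 + sp k ∣ 2 + k × (∀ d → 2 ≤ d → d ∣ 2 + k → 2 + sp k ≤ d)
least-factor k = go (divisors₂ (2 + k)) refl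
  where
  go : ∀ l → divisors₂ (2 + k) ≡ l → 2 + sp k ∣ 2 + k × (∀ d → 2 ≤ d → d ∣ 2 + k → 2 + sp k ≤ d)
  -- The list cannot be empty, since `2 + k` divides itself.
  go [] e = contradiction (subst (k ∈_) e (∈-filter⁺ (λ j → suc (suc j) ∣? (2 + k)) (∈-upTo⁺ (s≤s (n≤1+n k))) Div.∣-refl)) λ ()
  go (j ∷ l) e with first-of-filter (λ j → suc (suc j) ∣? (2 + k)) id (2 + k) e
  ... | i , refl , div , least = subst (λ x → 2 + x ∣ 2 + k) (sym (sp-first k e)) div ,
    λ { (suc zero) (s≤s ()) _ ; (suc (suc d)) _ d∣ → s≤s (s≤s (≮⇒≥ λ d<s → least d (subst (d <_) (sp-first k e) d<s) d∣)) }

quotient-bounds : ∀ k → 1 ≤ (2 + k) / (2 + sp k) × (2 + k) / (2 + sp k) ≤ suc k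
quotient-bounds k = DivMod.m≥n⇒m/n>0 (Div.∣⇒≤ (proj₁ (least-factor k))) , ≤-pred (DivMod.m/n<m (2 + k) (2 + sp k) (s≤s (s≤s z≤n)))

-- Each quotient is smaller than its argument, so fuel that is at least the argument never runs out.
mobF-fuel : ∀ f g m → 1 ≤ m → m ≤ f → m ≤ g → mobF f m ≡ mobF g m
mobF-fuel (suc f) (suc g) (suc zero)    _ _ _ = refl
mobF-fuel (suc f) (suc g) (suc (suc k)) _ (s≤s m≤f) (s≤s m≤g) = go ((2 + sp k) * (2 + sp k) ∣? (2 + k))
  where
  go : Dec ((2 + sp k) * (2 + sp k) ∣ 2 + k) → mobF (suc f) (2 + k) ≡ mobF (suc g) (2 + k)
  go (yes d) = trans (mobF-square f k d) (sym (mobF-square g k d))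
  go (no ¬d) = trans (mobF-squarefree f k ¬d) (trans (cong -_ (mobF-fuel f g _ (proj₁ (quotient-bounds k))
    (≤-trans (proj₂ (quotient-bounds k)) m≤f) (≤-trans (proj₂ (quotient-bounds k)) m≤g))) (sym (mobF-squarefree g k ¬d)))

μ-square : ∀ k → (2 + sp k) * (2 + sp k) ∣ 2 + k → μ (2 + k) ≡ + 0
μ-square k = mobF-square (suc k) k

μ-squarefree : ∀ k → ¬ (2 + sp k) * (2 + sp k) ∣ 2 + k → μ (2 + k) ≡ - μ ((2 + k) / (2 + sp k))
μ-squarefree k ¬d = trans (mobF-squarefree (suc k) k ¬d)
  (cong -_ (mobF-fuel (suc k) _ ((2 + k) / (2 + sp k)) (proj₁ (quotient-bounds k)) (proj₂ (quotient-bounds k)) ≤-refl))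

/-exact : ∀ {a c} b .{{_ : NonZero b}} → a ≡ c * b → a / b ≡ c
/-exact {c = c} b refl = DivMod.m*n/n≡m c b

module ℤ-Sum = RangeSum ℤ._+_ (+ 0) ℤ.+-0-isCommutativeMonoid
open ℤ-Sum using () renaming (∑ to ∑ℤ; [_]·_ to [_]ℤ_)

∑ℤ-neg : ∀ n (f : ℕ → ℤ) → ∑ℤ n (λ i → - f i) ≡ - ∑ℤ n f
∑ℤ-neg zero    f = refl
∑ℤ-neg (suc n) f = trans (cong (λ x → - f 0 ℤ.+ x) (∑ℤ-neg n (f ∘ suc))) (sym (ℤ.neg-distrib-+ (f 0) _))

∑ℤ-* : ∀ n (f : ℕ → ℤ) a → ∑ℤ n (λ i → f i ℤ.* a) ≡ ∑ℤ n f ℤ.* a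
∑ℤ-* zero    f a = refl
∑ℤ-* (suc n) f a = trans (cong (λ x → f 0 ℤ.* a ℤ.+ x) (∑ℤ-* n (f ∘ suc) a)) (sym (ℤ.*-distribʳ-+ a (f 0) _))

[]ℤ-* : {P : Set} (d : Dec P) (a x : ℤ) → [ d ]ℤ (a ℤ.* x) ≡ ([ d ]ℤ a) ℤ.* x
[]ℤ-* (yes _) a x = refl
[]ℤ-* (no _)  a x = refl

divisorSum : (ℕ → ℤ) → ℕ → ℤ
divisorSum f N = ∑ℤ N (λ i → [ suc i ∣? N ]ℤ f (suc i))

-- Pair each divisor c prime to the least prime factor p with the divisor p c.
module _ (k : ℕ) where
  private
    N p : ℕ
    N = 2 + k
    p = 2 + sp k
    p∣N : p ∣ N
    p∣N = proj₁ (least-factor k)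

    -- A smaller factor of `2 + i` would also divide `N`.
    least-in : ∀ i → 2 + i ∣ N → p ∣ 2 + i → 2 + sp i ≡ p
    least-in i c∣N p∣c = ≤-antisym (proj₂ (least-factor i) p (s≤s (s≤s z≤n)) p∣c)
      (proj₂ (least-factor k) (2 + sp i) (s≤s (s≤s z≤n)) (Div.∣-trans (proj₁ (least-factor i)) c∣N))

    -- A common divisor of `p` and `suc j` other than `1` is a factor of `N`, hence at least `p`,
    -- hence `p` itself. So the two are coprime, and `p` divides the cofactor of `suc j`.
    coprime : ∀ j → suc j ∣ N → ¬ p ∣ suc j → p * suc j ∣ N
    coprime j (divides q eq) p∤j = go (Coprime.coprime-divisor cop (subst (p ∣_) (trans eq (*-comm q (suc j))) p∣N))
      where
      go : p ∣ q → p * suc j ∣ N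
      go (divides r refl) = divides r (trans eq (*-assoc r p (suc j)))
      cop : Coprime.Coprime p (suc j)
      cop {zero}        (d∣p , d∣j) = contradiction (Div.0∣⇒≡0 d∣p) λ ()
      cop {suc zero}    _ = refl
      cop {suc (suc d)} (d∣p , d∣j) = contradiction
        (subst (_∣ suc j) (≤-antisym (Div.∣⇒≤ d∣p) (proj₂ (least-factor k) (2 + d) (s≤s (s≤s z≤n)) (Div.∣-trans d∣p p∣N))) d∣j) p∤j

    f : ℕ → ℤ
    f i = [ suc i ∣? N ]ℤ μ (suc i)
    f₁ f₂ : ℕ → ℤ
    f₁ i = [ ¬? (p ∣? suc i) ]ℤ f i
    f₂ i = [ p ∣? suc i ]ℤ f i

    split-f : ∀ i → f i ≡ f₁ i ℤ.+ f₂ i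
    split-f i = go (p ∣? suc i)
      where
      go : (d : Dec (p ∣ suc i)) → f i ≡ ([ ¬? d ]ℤ f i) ℤ.+ ([ d ]ℤ f i)
      go (yes _) = sym (ℤ.+-identityˡ (f i))
      go (no _)  = sym (ℤ.+-identityʳ (f i))

    μ-times : ∀ i j → suc i ≡ p * suc j → suc i ∣ N → ¬ p ∣ suc j → μ (suc i) ≡ - μ (suc j)
    μ-times zero    j e = contradiction (subst (2 ≤_) (sym e) (≤-trans (s≤s (s≤s z≤n)) (m≤m*n p (suc j)))) λ { (s≤s ()) }
    μ-times (suc i) j e c∣N p∤j = trans (μ-squarefree i free) (cong (-_ ∘ μ) quot)
      where
      s≡ : 2 + sp i ≡ p
      s≡ = least-in i c∣N (divides (suc j) (trans e (*-comm p (suc j))))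
      free : ¬ (2 + sp i) * (2 + sp i) ∣ 2 + i
      free d = p∤j (Div.*-cancelˡ-∣ p (subst₂ _∣_ (cong₂ _*_ s≡ s≡) e d))
      quot : (2 + i) / (2 + sp i) ≡ suc j
      quot = /-exact (2 + sp i) (trans e (trans (*-comm p (suc j)) (cong (suc j *_) (sym s≡))))

    μ-times-square : ∀ i j → suc i ≡ p * suc j → suc i ∣ N → p ∣ suc j → μ (suc i) ≡ + 0
    μ-times-square zero    j e = contradiction (subst (2 ≤_) (sym e) (≤-trans (s≤s (s≤s z≤n)) (m≤m*n p (suc j)))) λ { (s≤s ()) }
    μ-times-square (suc i) j e c∣N p∣j = μ-square i (subst₂ _∣_ (cong₂ _*_ (sym s≡) (sym s≡)) (sym e) (Div.*-monoʳ-∣ p p∣j))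
      where
      s≡ : 2 + sp i ≡ p
      s≡ = least-in i c∣N (divides (suc j) (trans e (*-comm p (suc j))))

    -- When `p` divides `suc j` both sides vanish: the square of `p` divides `p * suc j`, and `f₁`
    -- omits `suc j`.
    pairing : ∑ℤ N f₂ ≡ ∑ℤ N (λ j → - f₁ j)
    pairing = ℤ-Sum.∑-reindex N N (λ i j → suc i ≟ p * suc j) f₂ (λ j → - f₁ j) partner partner′ agree
      where
      partner : ∀ i → i < N → f₂ i ≡ + 0 ⊎ ℤ-Sum.UniqueBelow N (λ j → suc i ≡ p * suc j)
      partner i i<N = go (p ∣? suc i)
        where
        go : Dec (p ∣ suc i) → f₂ i ≡ + 0 ⊎ ℤ-Sum.UniqueBelow N (λ j → suc i ≡ p * suc j)
        go (no p∤i) = inj₁ (ℤ-Sum.[]·-no (p ∣? suc i) p∤i)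
        go (yes (divides (suc j) e)) = inj₂ (j , ≤-trans (≤-trans (m≤m*n (suc j) p) (≤-reflexive (sym e))) i<N , trans e (*-comm (suc j) p) ,
          λ j′ _ e′ → suc-injective (*-cancelˡ-≡ (suc j′) (suc j) p (trans (sym e′) (trans e (*-comm (suc j) p)))))
      partner′ : ∀ j → j < N → - f₁ j ≡ + 0 ⊎ ℤ-Sum.UniqueBelow N (λ i → suc i ≡ p * suc j)
      partner′ j j<N = go (p ∣? suc j) (suc j ∣? N)
        where
        go : Dec (p ∣ suc j) → Dec (suc j ∣ N) → - f₁ j ≡ + 0 ⊎ ℤ-Sum.UniqueBelow N (λ i → suc i ≡ p * suc j)
        go (yes p∣j) _ = inj₁ (cong -_ (ℤ-Sum.[]·-no (¬? (p ∣? suc j)) λ p∤j → p∤j p∣j))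
        go (no p∤j) (no j∤N) = inj₁ (cong -_ (ℤ-Sum.[]·-zero (¬? (p ∣? suc j)) (ℤ-Sum.[]·-no (suc j ∣? N) j∤N)))
        go (no p∤j) (yes j∣N) = inj₂ (pred (p * suc j) , Div.∣⇒≤ (coprime j j∣N p∤j) , refl , λ i _ e → suc-injective e)
      agree : ∀ i j → i < N → j < N → suc i ≡ p * suc j → f₂ i ≡ - f₁ j
      agree i j _ _ e = trans (ℤ-Sum.[]·-yes (p ∣? suc i) (divides (suc j) (trans e (*-comm p (suc j))))) (go (p ∣? suc j) (suc i ∣? N))
        where
        j∣i : suc j ∣ suc i
        j∣i = divides p e
        go : Dec (p ∣ suc j) → Dec (suc i ∣ N) → f i ≡ - f₁ j
        go (yes p∣j) (no i∤N) = trans (ℤ-Sum.[]·-no (suc i ∣? N) i∤N) (sym (cong -_ (ℤ-Sum.[]·-no (¬? (p ∣? suc j)) λ p∤j → p∤j p∣j)))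
        go (yes p∣j) (yes i∣N) = trans (ℤ-Sum.[]·-zero (suc i ∣? N) (μ-times-square i j e i∣N p∣j)) (sym (cong -_ (ℤ-Sum.[]·-no (¬? (p ∣? suc j)) λ p∤j → p∤j p∣j)))
        go (no p∤j) (no i∤N) = trans (ℤ-Sum.[]·-no (suc i ∣? N) i∤N)
          (sym (cong -_ (ℤ-Sum.[]·-zero (¬? (p ∣? suc j)) (ℤ-Sum.[]·-no (suc j ∣? N) λ j∣N → i∤N (subst (_∣ N) (sym e) (coprime j j∣N p∤j))))))
        go (no p∤j) (yes i∣N) = trans (ℤ-Sum.[]·-yes (suc i ∣? N) i∣N) (trans (μ-times i j e i∣N p∤j)
          (cong -_ (sym (trans (ℤ-Sum.[]·-yes (¬? (p ∣? suc j)) p∤j) (ℤ-Sum.[]·-yes (suc j ∣? N) (Div.∣-trans j∣i i∣N))))))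

  divisorSum-μ : divisorSum μ (2 + k) ≡ + 0
  divisorSum-μ = begin
    ∑ℤ N f                            ≡⟨ ℤ-Sum.∑-cong N (λ i _ → split-f i) ⟩
    ∑ℤ N (λ i → f₁ i ℤ.+ f₂ i)        ≡⟨ ℤ-Sum.∑-⊕ N f₁ f₂ ⟩
    ∑ℤ N f₁ ℤ.+ ∑ℤ N f₂               ≡⟨ cong (λ x → ∑ℤ N f₁ ℤ.+ x) (trans pairing (∑ℤ-neg N f₁)) ⟩
    ∑ℤ N f₁ ℤ.- ∑ℤ N f₁               ≡⟨ ℤ.+-inverseʳ (∑ℤ N f₁) ⟩
    + 0                               ∎
    where open ≡-Reasoning

module _ (a q : ℕ → ℤ) (n′ : ℕ) (a-sum : ∀ d → a (suc d) ≡ divisorSum q (suc d)) where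
  private
    n = suc n′

    inner : ℕ → ℤ
    inner e = ∑ℤ n (λ j → [ suc j ∣? n ]ℤ ([ suc e ∣? suc j ]ℤ μ (n / suc j)))

    -- Replacing each divisor of `n` by its cofactor turns the multiples of `suc e` into the
    -- divisors of `N`.
    inner-cofactor : ∀ e N → n ≡ suc e * N → inner e ≡ divisorSum μ N
    inner-cofactor e N n≡ = ℤ-Sum.∑-reindex n N (λ j i → suc j * suc i ≟ n) _ _ partner partner′ agree
      where
      partner : ∀ j → j < n → _ ≡ + 0 ⊎ ℤ-Sum.UniqueBelow N (λ i → suc j * suc i ≡ n)
      partner j j<n = go (suc j ∣? n) (suc e ∣? suc j)
        where
        go : Dec (suc j ∣ n) → Dec (suc e ∣ suc j) → [ suc j ∣? n ]ℤ ([ suc e ∣? suc j ]ℤ μ (n / suc j)) ≡ + 0 ⊎ ℤ-Sum.UniqueBelow N (λ i → suc j * suc i ≡ n)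
        go (no j∤n) _ = inj₁ (ℤ-Sum.[]·-no (suc j ∣? n) j∤n)
        go (yes _) (no e∤j) = inj₁ (ℤ-Sum.[]·-zero (suc j ∣? n) (ℤ-Sum.[]·-no (suc e ∣? suc j) e∤j))
        go (yes (divides (suc i) eq)) (yes e∣j) = inj₂ (i , *-cancelˡ-≤ (suc e) (begin
            suc e * suc i ≤⟨ *-monoˡ-≤ (suc i) (Div.∣⇒≤ e∣j) ⟩
            suc j * suc i ≡⟨ trans (*-comm (suc j) (suc i)) (trans (sym eq) n≡) ⟩
            suc e * N     ∎) , trans (*-comm (suc j) (suc i)) (sym eq) ,
            λ i′ _ e′ → suc-injective (*-cancelˡ-≡ (suc i′) (suc i) (suc j) (trans e′ (trans eq (*-comm (suc i) (suc j))))))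
          where open ≤-Reasoning
      partner′ : ∀ i → i < N → [ suc i ∣? N ]ℤ μ (suc i) ≡ + 0 ⊎ ℤ-Sum.UniqueBelow n (λ j → suc j * suc i ≡ n)
      partner′ i i<N = go (suc i ∣? N)
        where
        go : Dec (suc i ∣ N) → [ suc i ∣? N ]ℤ μ (suc i) ≡ + 0 ⊎ ℤ-Sum.UniqueBelow n (λ j → suc j * suc i ≡ n)
        go (no i∤N) = inj₁ (ℤ-Sum.[]·-no (suc i ∣? N) i∤N)
        go (yes (divides zero refl)) = contradiction (trans n≡ (*-zeroʳ (suc e))) λ ()
        go (yes (divides (suc r) refl)) = inj₂ (pred (suc e * suc r) , ≤-trans (m≤m*n (suc e * suc r) (suc i)) (≤-reflexive prod) , prod ,
          λ j′ _ e′ → suc-injective (*-cancelʳ-≡ (suc j′) (suc e * suc r) (suc i) (trans e′ (sym prod))))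
          where
          prod : suc e * suc r * suc i ≡ n
          prod = trans (*-assoc (suc e) (suc r) (suc i)) (sym n≡)
      agree : ∀ j i → j < n → i < N → suc j * suc i ≡ n → [ suc j ∣? n ]ℤ ([ suc e ∣? suc j ]ℤ μ (n / suc j)) ≡ [ suc i ∣? N ]ℤ μ (suc i)
      agree j i _ _ eq = trans (ℤ-Sum.[]·-yes (suc j ∣? n) (divides (suc i) (trans (sym eq) (*-comm (suc j) (suc i)))))
        (trans (ℤ-Sum.[]·-⇔ (suc e ∣? suc j) (suc i ∣? N) to from)
          (cong (λ x → [ suc i ∣? N ]ℤ μ x) (/-exact {c = suc i} (suc j) (trans (sym eq) (*-comm (suc j) (suc i))))))
        where
        to : suc e ∣ suc j → suc i ∣ N
        to (divides r j≡) = divides r (*-cancelˡ-≡ N (r * suc i) (suc e) (trans (sym n≡) (trans (sym eq) (trans (cong (_* suc i) (trans j≡ (*-comm r (suc e)))) (*-assoc (suc e) r (suc i))))))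
        from : suc i ∣ N → suc e ∣ suc j
        from (divides r refl) = divides r (*-cancelʳ-≡ (suc j) (r * suc e) (suc i) (trans eq (trans n≡ (trans (sym (*-assoc (suc e) r (suc i))) (cong (_* suc i) (*-comm (suc e) r))))))

    inner-last : inner n′ ≡ + 1
    inner-last = inner-cofactor n′ 1 (sym (*-identityʳ n))

    inner-other : ∀ e → e < n → e ≢ n′ → inner e ≡ + 0
    inner-other e e<n e≢ = go (suc e ∣? n)
      where
      go : Dec (suc e ∣ n) → inner e ≡ + 0
      go (no e∤n) = ℤ-Sum.∑-zero n λ j _ → term {j} {μ (n / suc j)} (suc j ∣? n) (suc e ∣? suc j)
        where
        term : ∀ {j x} (d : Dec (suc j ∣ n)) (d′ : Dec (suc e ∣ suc j)) → [ d ]ℤ ([ d′ ]ℤ x) ≡ + 0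
        term (yes j∣n) (yes e∣j) = contradiction (Div.∣-trans e∣j j∣n) e∤n
        term (yes _)   (no _)    = refl
        term (no _)    _         = refl
      go (yes (divides (suc zero) eq)) = contradiction (suc-injective (trans (sym (*-identityˡ (suc e))) (sym eq))) e≢
      -- The cofactor is at least `2`, where the divisor sum of the Möbius function vanishes.
      go (yes (divides (suc (suc r)) eq)) = trans (inner-cofactor e (2 + r) (trans eq (*-comm (2 + r) (suc e)))) (divisorSum-μ r)

  möbius-inversion : ∑ℤ n (λ j → [ suc j ∣? n ]ℤ (μ (n / suc j) ℤ.* a (suc j))) ≡ q n
  möbius-inversion = begin
    ∑ℤ n (λ j → [ suc j ∣? n ]ℤ (μ (n / suc j) ℤ.* a (suc j)))                                               ≡⟨ ℤ-Sum.∑-cong n expand ⟩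
    ∑ℤ n (λ j → ∑ℤ n (λ e → ([ suc j ∣? n ]ℤ ([ suc e ∣? suc j ]ℤ μ (n / suc j))) ℤ.* q (suc e)))            ≡⟨ ℤ-Sum.∑-swap n n (λ j e → ([ suc j ∣? n ]ℤ ([ suc e ∣? suc j ]ℤ μ (n / suc j))) ℤ.* q (suc e)) ⟩
    ∑ℤ n (λ e → ∑ℤ n (λ j → ([ suc j ∣? n ]ℤ ([ suc e ∣? suc j ]ℤ μ (n / suc j))) ℤ.* q (suc e)))            ≡⟨ ℤ-Sum.∑-cong n {g = λ e → inner e ℤ.* q (suc e)} (λ e _ → ∑ℤ-* n (λ j → ([ suc j ∣? n ]ℤ ([ suc e ∣? suc j ]ℤ μ (n / suc j)))) (q (suc e))) ⟩
    ∑ℤ n (λ e → inner e ℤ.* q (suc e))                                                                       ≡⟨ ℤ-Sum.∑-single n n′ ≤-refl (λ e e<n e≢ → cong (ℤ._* q (suc e)) (inner-other e e<n e≢)) ⟩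
    inner n′ ℤ.* q n                                                                                         ≡⟨ cong (ℤ._* q n) inner-last ⟩
    + 1 ℤ.* q n                                                                                              ≡⟨ ℤ.*-identityˡ (q n) ⟩
    q n                                                                                                      ∎
    where
    open ≡-Reasoning
    expand : ∀ j → j < n → [ suc j ∣? n ]ℤ (μ (n / suc j) ℤ.* a (suc j)) ≡ ∑ℤ n (λ e → ([ suc j ∣? n ]ℤ ([ suc e ∣? suc j ]ℤ μ (n / suc j))) ℤ.* q (suc e))
    expand j j<n = begin
      [ suc j ∣? n ]ℤ (m ℤ.* a (suc j))                                                ≡⟨ cong (λ x → [ suc j ∣? n ]ℤ (m ℤ.* x)) (trans (a-sum j) (sym (ℤ-Sum.∑-extend (λ e → [ suc e ∣? suc j ]ℤ q (suc e)) j<n beyond))) ⟩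
      [ suc j ∣? n ]ℤ (m ℤ.* ∑ℤ n (λ e → [ suc e ∣? suc j ]ℤ q (suc e)))               ≡⟨ cong ([ suc j ∣? n ]ℤ_) (trans (ℤ.*-comm m _) (trans (sym (∑ℤ-* n (λ e → [ suc e ∣? suc j ]ℤ q (suc e)) m)) (ℤ-Sum.∑-cong n λ e _ → rearrange (suc e ∣? suc j) (q (suc e))))) ⟩
      [ suc j ∣? n ]ℤ (∑ℤ n (λ e → ([ suc e ∣? suc j ]ℤ m) ℤ.* q (suc e)))             ≡⟨ sym (ℤ-Sum.∑-[] n (suc j ∣? n) (λ e → ([ suc e ∣? suc j ]ℤ m) ℤ.* q (suc e))) ⟩
      ∑ℤ n (λ e → [ suc j ∣? n ]ℤ (([ suc e ∣? suc j ]ℤ m) ℤ.* q (suc e)))             ≡⟨ ℤ-Sum.∑-cong n (λ e _ → []ℤ-* (suc j ∣? n) ([ suc e ∣? suc j ]ℤ m) (q (suc e))) ⟩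
      ∑ℤ n (λ e → ([ suc j ∣? n ]ℤ ([ suc e ∣? suc j ]ℤ m)) ℤ.* q (suc e))             ∎
      where
      m = μ (n / suc j)
      beyond : ∀ e → suc j ≤ e → e < n → [ suc e ∣? suc j ]ℤ q (suc e) ≡ + 0
      beyond e j<e _ = ℤ-Sum.[]·-no (suc e ∣? suc j) λ d → <⇒≱ (s≤s j<e) (Div.∣⇒≤ d)
      rearrange : ∀ {P : Set} (d : Dec P) x → ([ d ]ℤ x) ℤ.* m ≡ ([ d ]ℤ m) ℤ.* x
      rearrange (yes _) x = ℤ.*-comm x m
      rearrange (no _)  x = refl

-- Periods of sequences and of patterns

sumℤ-filter : ∀ {P : ℕ → Set} (P? : ∀ j → Dec (P j)) (g : ℕ → ℤ) (f : ℕ → ℕ) n →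
  sumℤ (map g (filter P? (applyUpTo f n))) ≡ ∑ℤ n (λ i → [ P? (f i) ]ℤ g (f i))
sumℤ-filter P? g f zero    = refl
sumℤ-filter {P} P? g f (suc n) = go (P? (f 0))
  where
  rest = sumℤ-filter P? g (f ∘ suc) n
  go : Dec (P (f 0)) → sumℤ (map g (filter P? (f 0 ∷ applyUpTo (f ∘ suc) n))) ≡ ([ P? (f 0) ]ℤ g (f 0)) ℤ.+ ∑ℤ n (λ i → [ P? (f (suc i)) ]ℤ g (f (suc i)))
  go (yes p) = trans (cong (sumℤ ∘ map g) (List.filter-accept P? p)) (cong₂ ℤ._+_ (sym (ℤ-Sum.[]·-yes (P? (f 0)) p)) rest)
  go (no ¬p) = trans (cong (sumℤ ∘ map g) (List.filter-reject P? ¬p)) (trans rest (trans (sym (ℤ.+-identityˡ _))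
    (cong (ℤ._+ ∑ℤ n (λ i → [ P? (f (suc i)) ]ℤ g (f (suc i)))) (sym (ℤ-Sum.[]·-no (P? (f 0)) ¬p)))))

∑-periods : ∀ d (f : ℕ → ℕ) → (∀ t → f (t + d) ≡ f t) → ∀ k → ∑ (k * d) f ≡ k * ∑ d f
∑-periods d f p zero    = refl
∑-periods d f p (suc k) = trans (∑-+ d (k * d) f) (cong (λ x → ∑ d f + x)
  (trans (∑-cong (k * d) λ i _ → trans (cong f (+-comm d i)) (p i)) (∑-periods d f p k)))

∑-rotate : ∀ n (f : ℕ → ℕ) → (∀ t → f (t + n) ≡ f t) → ∀ k → ∑ n (λ t → f (t + k)) ≡ ∑ n f
∑-rotate n f p zero    = ∑-cong n λ t _ → cong f (+-identityʳ t)
∑-rotate n f p (suc k) = trans (∑-cong n λ t _ → cong f (+-suc t k))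
  (trans (∑-periodic-suc n {λ t → f (t + k)} (trans (cong f (+-comm n k)) (p k))) (∑-rotate n f p k))

landed-rotate : ∀ m k t j → landed (λ s → m (s + k)) t j ≡ landed m (t + k) j
landed-rotate m k t zero    = refl
landed-rotate m k t (suc j) = cong (λ x → m (t + k) j + x) (landed-rotate m k (suc t) j)

module _ {A : Set} where

  Recurs : ℕ → (ℕ → A) → Set
  Recurs n f = ∀ t → f (t + n) ≡ f t

  recurs-* : ∀ {f} c → Recurs c f → ∀ k t → f (t + k * c) ≡ f t
  recurs-* {f} c p zero    t = cong f (+-identityʳ t)
  recurs-* {f} c p (suc k) t = trans (cong f (trans (cong (λ z → t + z) (+-comm c (k * c))) (sym (+-assoc t (k * c) c)))) (trans (p (t + k * c)) (recurs-* c p k t))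

  -- By Bézout the gcd is a multiple of one period minus a multiple of the other. The subtracted
  -- multiple is added to the argument instead.
  periodic-gcd : ∀ {f : ℕ → A} a b → Recurs a f → Recurs b f → Recurs (gcd a b) f
  periodic-gcd {f} a b pa pb t = go (GCD.Bézout.identity (GCD.gcd-GCD a b))
    where
    go : GCD.Bézout.Identity (gcd a b) a b → f (t + gcd a b) ≡ f t
    go (GCD.Bézout.+- x y eq) = trans (sym (recurs-* b pb y (t + gcd a b))) (trans (cong f (trans (+-assoc t (gcd a b) (y * b)) (cong (λ z → t + z) eq))) (recurs-* a pa x t))
    go (GCD.Bézout.-+ x y eq) = trans (sym (recurs-* a pa x (t + gcd a b))) (trans (cong f (trans (+-assoc t (gcd a b) (x * a)) (cong (λ z → t + z) eq))) (recurs-* b pb y t))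

  index : List A → ℕ → Maybe A
  index []      _       = nothing
  index (x ∷ l) zero    = just x
  index (x ∷ l) (suc i) = index l i

  index-ext : ∀ {l l′} → length l ≡ length l′ → (∀ i → i < length l → index l i ≡ index l′ i) → l ≡ l′
  index-ext {[]}    {[]}      _ _ = refl
  index-ext {x ∷ l} {x′ ∷ l′} h e = cong₂ _∷_ (just-injective (e 0 (s≤s z≤n))) (index-ext (suc-injective h) λ i i< → e (suc i) (s≤s i<))
    where
    just-injective : ∀ {x y : A} → just x ≡ just y → x ≡ y
    just-injective refl = refl

  index-++ˡ : ∀ l l′ {i} → i < length l → index (l ++ l′) i ≡ index l i
  index-++ˡ (x ∷ l) l′ {zero}  _        = refl
  index-++ˡ (x ∷ l) l′ {suc i} (s≤s i<) = index-++ˡ l l′ i<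

  index-++ʳ : ∀ l l′ i → index (l ++ l′) (length l + i) ≡ index l′ i
  index-++ʳ []      l′ i = refl
  index-++ʳ (x ∷ l) l′ i = index-++ʳ l l′ i

  length-power : ∀ k (B : List A) → length (concat (replicate k B)) ≡ k * length B
  length-power zero    B = refl
  length-power (suc k) B = trans (List.length-++ B) (cong (λ x → length B + x) (length-power k B))

  index-power : ∀ k (B : List A) d .{{_ : NonZero d}} → length B ≡ d → ∀ i → i < k * d → index (concat (replicate k B)) i ≡ index B (i % d)
  index-power (suc k) B d refl i i< = go (i <? d)
    where
    go : Dec (i < d) → index (B ++ concat (replicate k B)) i ≡ index B (i % d)
    go (yes i<d) = trans (index-++ˡ B _ i<d) (cong (index B) (sym (DivMod.m<n⇒m%n≡m i<d)))
    go (no i≮d)  = begin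
      index (B ++ concat (replicate k B)) i              ≡⟨ cong (index (B ++ concat (replicate k B))) (sym (m+[n∸m]≡n (≮⇒≥ i≮d))) ⟩
      index (B ++ concat (replicate k B)) (d + (i ∸ d))  ≡⟨ index-++ʳ B _ (i ∸ d) ⟩
      index (concat (replicate k B)) (i ∸ d)             ≡⟨ index-power k B d refl (i ∸ d) (+-cancelˡ-< d _ _ (subst (_< d + k * d) (sym (m+[n∸m]≡n (≮⇒≥ i≮d))) i<)) ⟩
      index B ((i ∸ d) % d)                              ≡⟨ cong (index B) (trans (sym (DivMod.[m+n]%n≡m%n (i ∸ d) d)) (cong (_% d) (m∸n+n≡m (≮⇒≥ i≮d)))) ⟩
      index B (i % d)                                    ∎
      where open ≡-Reasoning

  index-applyUpTo : ∀ (f : ℕ → A) {i j} → i < j → index (applyUpTo f j) i ≡ just (f i)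
  index-applyUpTo f {zero}  (s≤s _)  = refl
  index-applyUpTo f {suc i} (s≤s i<) = index-applyUpTo (f ∘ suc) i<

  index-toList : ∀ {n} (v : Vec A n) (i : Fin n) → index (toList v) (toℕ i) ≡ just (lookup v i)
  index-toList (x ∷ v) zero    = refl
  index-toList (x ∷ v) (suc i) = index-toList v i

module _ {n : ℕ} .{{_ : NonZero n}} where

  index-per : ∀ {A : Set} (v : Vec A n) i → i < n → index (toList v) i ≡ just (per n v i)
  index-per v i i<n = trans (cong (index (toList v)) (sym (trans (toℕ-mod n i) (DivMod.m<n⇒m%n≡m i<n)))) (index-toList v (i mod n))

  rotate-per : ∀ k T t → per n (rotate n k T) t ≡ per n T (t + k)
  rotate-per k T t = per-unper n (λ t → trans (cong (per n T) (trans (+-assoc t n k) (trans (cong (λ x → t + x) (+-comm n k)) (sym (+-assoc t k n))))) (per-periodic n T (t + k))) t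

  Period : ℕ → Vec Multiset n → Set
  Period e T = ∀ t → per n T (t + e) ≡ per n T t

  rotate⇒Period : ∀ {e T} → rotate n e T ≡ T → Period e T
  rotate⇒Period {e} {T} h t = trans (sym (rotate-per e T t)) (cong (λ T → per n T t) h)

  Period⇒rotate : ∀ {e T} → Period e T → rotate n e T ≡ T
  Period⇒rotate {e} {T} p = per-injective n λ t → trans (rotate-per e T t) (p t)

  Multiset-≟ : (M N : Multiset) → Dec (M ≡ N)
  Multiset-≟ M N = go (List.≡-dec _≟_ (proj₁ M) (proj₁ N))
    where
    go : Dec (proj₁ M ≡ proj₁ N) → Dec (M ≡ N)
    go (yes e) = yes (Multiset-≡ e)
    go (no ¬e) = no (¬e ∘ cong proj₁)

  Shorter : Vec Multiset n → ℕ → Set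
  Shorter T e = 1 ≤ e × e ∣ n × rotate n e T ≡ T

  Shorter? : ∀ T e → Dec (Shorter T e)
  Shorter? T e = (1 ≤? e) ×-dec (e ∣? n) ×-dec V.≡-dec Multiset-≟ (rotate n e T) T

  -- A boolean equation has unique proofs, so this predicate cuts out a subset that can be counted.
  -- `HasMinimalPeriod` is a function type, whose proofs would have to be compared by function
  -- extensionality.
  IsMin : Vec Multiset n → Set
  IsMin T = does (anyUpTo? (Shorter? T) n) ≡ false

  IsMin? : ∀ T → Dec (IsMin T)
  IsMin? T = does (anyUpTo? (Shorter? T) n) Data.Bool.≟ false

  IsMin⇒ : ∀ {T} → IsMin T → ∀ e → e < n → ¬ Shorter T e
  IsMin⇒ {T} m e e<n s = go (anyUpTo? (Shorter? T) n) m
    where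
    go : (d : Dec (∃ λ e → e < n × Shorter T e)) → does d ≡ false → ⊥
    go (no ¬s) _ = ¬s (e , e<n , s)

  ⇒IsMin : ∀ {T} → (∀ e → e < n → ¬ Shorter T e) → IsMin T
  ⇒IsMin {T} h = go (anyUpTo? (Shorter? T) n)
    where
    go : (d : Dec (∃ λ e → e < n × Shorter T e)) → does d ≡ false
    go (yes (e , e<n , s)) = contradiction s (h e e<n)
    go (no _)              = refl

  -- The gcd of `e` and `n` is again a period and divides `n`, so by minimality it is `n`.
  min-period : ∀ {T} → IsMin T → ∀ e → Period e T → n ∣ e
  min-period {T} m e p = go (m≤n⇒m<n∨m≡n (Div.∣⇒≤ (GCD.gcd[m,n]∣n e n)))
    where
    g = gcd e n
    pos : 1 ≤ g
    pos = n≢0⇒n>0 λ g≡0 → ≢-nonZero⁻¹ n (Div.0∣⇒≡0 (subst (_∣ n) g≡0 (GCD.gcd[m,n]∣n e n)))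
    go : g < n ⊎ g ≡ n → n ∣ e
    go (inj₁ g<n) = contradiction (pos , GCD.gcd[m,n]∣n e n , Period⇒rotate (periodic-gcd e n p (per-periodic n T))) (IsMin⇒ m g g<n)
    go (inj₂ g≡n) = subst (_∣ e) g≡n (GCD.gcd[m,n]∣m e n)

  repetition⇒Period : ∀ d .{{_ : NonZero d}} {T} → d ∣ n → IsRepetitionOf d T → Period d T
  repetition⇒Period d {T} d∣n (B , k , len , eq) t = just-injective (trans (at (t + d)) (trans (cong (index B) (DivMod.[m+n]%n≡m%n t d)) (sym (at t))))
    where
    just-injective : ∀ {x y : Multiset} → just x ≡ just y → x ≡ y
    just-injective refl = refl
    kd≡n : k * d ≡ n
    kd≡n = trans (cong (k *_) (sym len)) (trans (sym (length-power k B)) (trans (cong length (sym eq)) (V.length-toList T)))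
    at : ∀ t → just (per n T t) ≡ index B (t % d)
    at t = begin
      just (per n T t)                            ≡⟨ cong just (sym (periodic-% n (per-periodic n T) t)) ⟩
      just (per n T (t % n))                      ≡⟨ sym (index-per T (t % n) (DivMod.m%n<n t n)) ⟩
      index (toList T) (t % n)                    ≡⟨ cong (λ l → index l (t % n)) eq ⟩
      index (concat (replicate k B)) (t % n)      ≡⟨ index-power k B d len (t % n) (subst (t % n <_) (sym kd≡n) (DivMod.m%n<n t n)) ⟩
      index B (t % n % d)                         ≡⟨ cong (index B) (DivMod.m∣n⇒o%n%m≡o%m d n t d∣n) ⟩
      index B (t % d)                             ∎
      where open ≡-Reasoning

  Period⇒repetition : ∀ d .{{_ : NonZero d}} {T} → d ∣ n → Period d T → IsRepetitionOf d T
  Period⇒repetition d {T} (divides k n≡kd) p = B , k , len , index-ext lengths λ i i< → at i (subst (i <_) (V.length-toList T) i<)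
    where
    B = applyUpTo (per n T) d
    len : length B ≡ d
    len = List.length-applyUpTo (per n T) d
    lengths : length (toList T) ≡ length (concat (replicate k B))
    lengths = trans (V.length-toList T) (trans n≡kd (trans (cong (k *_) (sym len)) (sym (length-power k B))))
    at : ∀ i → i < n → index (toList T) i ≡ index (concat (replicate k B)) i
    at i i<n = begin
      index (toList T) i                          ≡⟨ index-per T i i<n ⟩
      just (per n T i)                            ≡⟨ cong just (sym (periodic-% d p i)) ⟩
      just (per n T (i % d))                      ≡⟨ sym (index-applyUpTo (per n T) (DivMod.m%n<n i d)) ⟩
      index B (i % d)                             ≡⟨ sym (index-power k B d len i (subst (i <_) n≡kd i<n)) ⟩
      index (concat (replicate k B)) i            ∎
      where open ≡-Reasoning

  HasMinimalPeriod⇒IsMin : ∀ {T} → HasMinimalPeriod n T → IsMin T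
  HasMinimalPeriod⇒IsMin {T} m = ⇒IsMin λ { (suc e) e<n (_ , e∣n , r) → m (suc e) e∣n e<n (Period⇒repetition (suc e) e∣n (rotate⇒Period r)) }

  IsMin⇒HasMinimalPeriod : ∀ {T} → IsMin T → HasMinimalPeriod n T
  IsMin⇒HasMinimalPeriod {T} m zero    d∣n d<n _ = ≢-nonZero⁻¹ n (Div.0∣⇒≡0 d∣n)
  IsMin⇒HasMinimalPeriod {T} m (suc d) d∣n d<n r = IsMin⇒ m (suc d) d<n (s≤s z≤n , d∣n , Period⇒rotate (repetition⇒Period (suc d) d∣n r))

-- The siteswap conditions for a function on all times. Only `total` mentions the length of the
-- period, which eases the passage between a pattern and its blocks.
record Juggles (n b κ H : ℕ) (F : ℕ → Multiset) : Set where
  field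
    balance : Balanced H (proj₁ ∘ F)
    within  : ∀ t → All (Between H) (proj₁ (F t))
    total   : ∑ n (λ t → sumℕ (proj₁ (F t))) ≡ n * b
    cap     : ∀ t → size (F t) ≤ κ

Juggles-shift : ∀ {n b κ H F} → Recurs n F → ∀ k → Juggles n b κ H F → Juggles n b κ H (λ t → F (t + k))
Juggles-shift {n} {b} {κ} {H} {F} p k J = record
  { balance = λ t j H≤j → trans (landed-rotate (λ s h → count h (proj₁ (F s))) k t j) (trans (balance (t + k) j H≤j)
      (cong (size ∘ F) (trans (+-assoc t k j) (trans (cong (λ x → t + x) (+-comm k j)) (sym (+-assoc t j k))))))
  ; within  = λ t → within (t + k)
  ; total   = trans (∑-rotate n (λ t → sumℕ (proj₁ (F t))) (λ t → cong (sumℕ ∘ proj₁) (p t)) k) total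
  ; cap     = λ t → cap (t + k)
  }
  where open Juggles J

Juggles-multiple : ∀ {d b κ H F} → Recurs d F → ∀ k → Juggles d b κ H F → Juggles (k * d) b κ H F
Juggles-multiple {d} {b} {F = F} p k J = record
  { balance = balance ; within = within ; cap = cap
  ; total   = trans (∑-periods d (λ t → sumℕ (proj₁ (F t))) (λ t → cong (sumℕ ∘ proj₁) (p t)) k) (trans (cong (k *_) total) (sym (*-assoc k d b)))
  }
  where open Juggles J

Juggles-divisor : ∀ {d b κ H F} → Recurs d F → ∀ k .{{_ : NonZero k}} → Juggles (k * d) b κ H F → Juggles d b κ H F
Juggles-divisor {d} {b} {F = F} p k J = record
  { balance = balance ; within = within ; cap = cap
  ; total   = *-cancelˡ-≡ _ _ k (trans (sym (∑-periods d (λ t → sumℕ (proj₁ (F t))) (λ t → cong (sumℕ ∘ proj₁) (p t)) k)) (trans total (*-assoc k d b)))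
  }
  where open Juggles J

module _ {n b κ : ℕ} .{{_ : NonZero n}} where

  Siteswap-≡ : {S S′ : Siteswap n b κ} → proj₁ S ≡ proj₁ S′ → S ≡ S′
  Siteswap-≡ = Σ-≡ λ T → ×-prop ≡-prop (×-prop ≡-prop (VAll-prop λ _ → ≤-irrelevant))

  juggles : ∀ (S : Siteswap n b κ) H → n * b ≤ H → Juggles n b κ H (per n (proj₁ S))
  juggles S@(T , lands , total , caps) H nb≤H = record
    { balance = balanced S H nb≤H
    ; within  = between S H nb≤H
    ; total   = trans (sym (totalHeight-∑ T)) total
    ; cap     = λ t → VAll-lookup caps (t mod n)
    }

  fromJuggles : ∀ {H F} → Periodic n F → Juggles n b κ H F → Siteswap n b κ
  fromJuggles {H} {F} p J = T , balanced⇒landings H T within′ balance′ , trans (totalHeight-∑ T) (trans (∑-cong n λ t _ → cong sumℕ (h t)) total) ,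
    VAll-tabulate λ i → subst (λ M → size M ≤ κ) (sym (V.lookup∘tabulate (F ∘ toℕ) i)) (cap (toℕ i))
    where
    open Juggles J
    T = unper n F
    h : ∀ t → heights T t ≡ proj₁ (F t)
    h t = cong proj₁ (per-unper n p t)
    within′ : ∀ t → All (Between H) (heights T t)
    within′ t = subst (All (Between H)) (sym (h t)) (within t)
    balance′ : Balanced H (heights T)
    balance′ t j H≤j = trans (landed-cong (λ s i → cong (count i) (h s)) t j) (trans (balance t j H≤j) (cong length (sym (h (t + j)))))

MinimalSiteswap : (n b κ : ℕ) .{{_ : NonZero n}} → Set
MinimalSiteswap n b κ = Σ (Siteswap n b κ) (IsMin ∘ proj₁)

Minimal-≡ : ∀ {n b κ} .{{_ : NonZero n}} {S S′ : MinimalSiteswap n b κ} → proj₁ (proj₁ S) ≡ proj₁ (proj₁ S′) → S ≡ S′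
Minimal-≡ e = Σ-≡ (λ _ → ≡-prop) (Siteswap-≡ e)

least-below : ∀ {P : ℕ → Set} → (∀ e → Dec (P e)) → ∀ n → P n → ∃ λ e → P e × (∀ e′ → e′ < e → ¬ P e′)
least-below {P} P? n Pn = go n (<-wellFounded n) Pn
  where
  go : ∀ n → Acc _<_ n → P n → ∃ λ e → P e × (∀ e′ → e′ < e → ¬ P e′)
  go n (acc rec) Pn = next (anyUpTo? P? n)
    where
    next : Dec (∃ λ e → e < n × P e) → ∃ λ e → P e × (∀ e′ → e′ < e → ¬ P e′)
    next (yes (e , e<n , Pe)) = go e (rec e<n) Pe
    next (no ¬e)              = n , Pn , λ e e<n Pe → ¬e (e , e<n , Pe)

-- Siteswaps as repetitions of minimal blocks

module _ (b κ : ℕ) where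

  abstract
    mins : (n : ℕ) .{{_ : NonZero n}} → ℕ
    mins n = proj₁ (subset-finite (SiteswapCount.size-Siteswap n b κ) (IsMin? ∘ proj₁) λ _ → ≡-prop)

    size-Minimal : (n : ℕ) .{{_ : NonZero n}} → MinimalSiteswap n b κ ↔ Fin (mins n)
    size-Minimal n = proj₂ (subset-finite (SiteswapCount.size-Siteswap n b κ) (IsMin? ∘ proj₁) λ _ → ≡-prop)

  module _ (n : ℕ) .{{_ : NonZero n}} where
    private
      J : List ℕ
      J = filter (λ j → suc j ∣? n) (upTo n)

      J-divides : ∀ {j} → j ∈ J → suc j ∣ n
      J-divides j∈ = proj₂ (∈-filter⁻ (λ j → suc j ∣? n) {xs = upTo n} j∈)

      Blocks : Set
      Blocks = Σ ℕ λ j → j ∈ J × MinimalSiteswap (suc j) b κ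

      multiple-periodic : ∀ {A : Set} {f : ℕ → A} {d} .{{_ : NonZero d}} → d ∣ n → Periodic d f → Periodic n f
      multiple-periodic {f = f} {d} (divides k refl) p = periodic-* d p k

      repeated-Juggles : ∀ {d F} .{{_ : NonZero d}} → d ∣ n → Periodic d F → Juggles d b κ (n * b) F → Juggles n b κ (n * b) F
      repeated-Juggles {d} {F} (divides k eq) p K = subst (λ x → Juggles x b κ (n * b) F) (sym eq) (Juggles-multiple p k K)

      block-Juggles : ∀ {d F} .{{_ : NonZero d}} → d ∣ n → Periodic d F → Juggles n b κ (n * b) F → Juggles d b κ (n * b) F
      block-Juggles {F = F} (divides zero    eq) p K = contradiction eq (≢-nonZero⁻¹ n)
      block-Juggles {F = F} (divides (suc k) eq) p K = Juggles-divisor p (suc k) (subst (λ x → Juggles x b κ (n * b) F) eq K)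

      d*b≤ : ∀ {d} → d ∣ n → d * b ≤ n * b
      d*b≤ d∣n = *-monoˡ-≤ b (Div.∣⇒≤ d∣n)

      repeated : Blocks → Siteswap n b κ
      repeated (j , j∈ , S , _) = fromJuggles (multiple-periodic d∣n (per-periodic (suc j) (proj₁ S)))
        (repeated-Juggles d∣n (per-periodic (suc j) (proj₁ S)) (juggles S (n * b) (d*b≤ d∣n)))
        where d∣n = J-divides j∈

      repeated-per : ∀ ((j , j∈ , S , m) : Blocks) t → per n (proj₁ (repeated (j , j∈ , S , m))) t ≡ per (suc j) (proj₁ S) t
      repeated-per (j , j∈ , S , _) t = per-unper n (multiple-periodic (J-divides j∈) (per-periodic (suc j) (proj₁ S))) t

      -- Two blocks with the same repetition have each other's length as a period, so their minimal
      -- periods divide each other.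
      repeated-injective : ∀ {x x′} → repeated x ≡ repeated x′ → x ≡ x′
      repeated-injective {x@(j , j∈ , S , m)} {x′@(j′ , j∈′ , S′ , m′)} e = go (suc-injective (Div.∣-antisym j∣j′ j′∣j)) j∈ j∈′ S S′ m m′ alike
        where
        alike : ∀ t → per (suc j) (proj₁ S) t ≡ per (suc j′) (proj₁ S′) t
        alike t = trans (sym (repeated-per x t)) (trans (cong (λ z → per n (proj₁ z) t) e) (repeated-per x′ t))
        j∣j′ : suc j ∣ suc j′
        j∣j′ = min-period m (suc j′) λ t → trans (alike (t + suc j′)) (trans (per-periodic (suc j′) (proj₁ S′) t) (sym (alike t)))
        j′∣j : suc j′ ∣ suc j
        j′∣j = min-period m′ (suc j) λ t → trans (sym (alike (t + suc j))) (trans (per-periodic (suc j) (proj₁ S) t) (alike t))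
        go : ∀ {j j′} → j ≡ j′ → (j∈ : j ∈ J) (j∈′ : j′ ∈ J) (S : Siteswap (suc j) b κ) (S′ : Siteswap (suc j′) b κ) (m : IsMin (proj₁ S)) (m′ : IsMin (proj₁ S′)) →
          (∀ t → per (suc j) (proj₁ S) t ≡ per (suc j′) (proj₁ S′) t) → _≡_ {A = Blocks} (j , j∈ , S , m) (j′ , j∈′ , S′ , m′)
        go {j} refl j∈ j∈′ S S′ m m′ alike = cong₂ (λ i M → j , i , M) (unique⇒∈-prop (Unique.filter⁺ (λ j → suc j ∣? n) (Unique.upTo⁺ n)) j j∈ j∈′)
          (Minimal-≡ (per-injective (suc j) alike))

      -- The block is cut off at the least period; a shorter period of the block would be one of the
      -- whole pattern.
      repeated-surjective : ∀ S → Σ Blocks λ x → repeated x ≡ S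
      repeated-surjective S@(T , _) = go (least-below (Shorter? T) n (n≢0⇒n>0 (≢-nonZero⁻¹ n) , Div.∣-refl , Period⇒rotate (per-periodic n T)))
        where
        go : (∃ λ e → Shorter T e × (∀ e′ → e′ < e → ¬ Shorter T e′)) → Σ Blocks λ x → repeated x ≡ S
        go (suc j , (_ , d∣n , r) , least) = block , Siteswap-≡ (per-injective n λ t → trans (repeated-per block t) (per-unper d p t))
          where
          d = suc j
          p : Periodic d (per n T)
          p = rotate⇒Period r
          B : Siteswap d b κ
          B = fromJuggles p (block-Juggles d∣n p (juggles S (n * b) ≤-refl))
          minimal : IsMin (proj₁ B)
          minimal = ⇒IsMin λ e e<d (1≤e , e∣d , r′) → least e e<d (1≤e , Div.∣-trans e∣d d∣n , Period⇒rotate λ t →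
            trans (sym (per-unper d p (t + e))) (trans (rotate⇒Period r′ t) (per-unper d p t)))
          block : Blocks
          block = j , ∈-filter⁺ (λ j → suc j ∣? n) (∈-upTo⁺ (Div.∣⇒≤ d∣n)) d∣n , B , minimal

      blocks : Blocks ↔ Siteswap n b κ
      blocks = section⇒↔ {Blocks} {Siteswap n b κ} repeated (λ S → proj₁ (repeated-surjective S)) (λ S → proj₂ (repeated-surjective S))
        λ {x} {y} → repeated-injective {x} {y}

      size-Blocks : Blocks ↔ Fin (sumℕ (map (λ j → mins (suc j)) J))
      size-Blocks = size-Σ∈ J λ j _ → size-Minimal (suc j)

    ss-divisors : SiteswapCount.ss n b κ ≡ sumℕ (map (λ j → mins (suc j)) (filter (λ j → suc j ∣? n) (upTo n)))
    ss-divisors = size-unique (↔-trans blocks (SiteswapCount.size-Siteswap n b κ)) size-Blocks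

    turn : ℕ → MinimalSiteswap n b κ → MinimalSiteswap n b κ
    turn k (S@(T , _) , m) = fromJuggles (λ t → trans (cong (per n T) (trans (+-assoc t n k) (trans (cong (λ x → t + x) (+-comm n k)) (sym (+-assoc t k n))))) (per-periodic n T (t + k)))
        (Juggles-shift (per-periodic n T) k (juggles S (n * b) ≤-refl)) ,
      ⇒IsMin λ e e<n (1≤e , e∣n , r) → IsMin⇒ m e e<n (1≤e , e∣n , Period⇒rotate (unturn e (rotate⇒Period r)))
      where
      -- Going on for `k * n ∸ k` beats completes the rotation by `k` to whole periods and so undoes
      -- it.
      unturn : ∀ e → Period e (rotate n k T) → Period e T
      unturn e p t = begin
        per n T (t + e)                      ≡⟨ sym (periodic-* n (per-periodic n T) k (t + e)) ⟩
        per n T (t + e + k * n)              ≡⟨ cong (per n T) (trans (shuffle e) (cong (_+ k) refl)) ⟩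
        per n T (t + (k * n ∸ k) + e + k)    ≡⟨ sym (rotate-per k T (t + (k * n ∸ k) + e)) ⟩
        per n (rotate n k T) (t + (k * n ∸ k) + e) ≡⟨ p (t + (k * n ∸ k)) ⟩
        per n (rotate n k T) (t + (k * n ∸ k)) ≡⟨ rotate-per k T (t + (k * n ∸ k)) ⟩
        per n T (t + (k * n ∸ k) + k)        ≡⟨ cong (per n T) (trans (+-assoc t (k * n ∸ k) k) (cong (λ x → t + x) (m∸n+n≡m (m≤m*n k n)))) ⟩
        per n T (t + k * n)                  ≡⟨ periodic-* n (per-periodic n T) k t ⟩
        per n T t                            ∎
        where
        open ≡-Reasoning
        shuffle : ∀ e → t + e + k * n ≡ t + (k * n ∸ k) + e + k
        shuffle e = begin
          t + e + k * n                ≡⟨ cong (λ x → t + e + x) (sym (m∸n+n≡m (m≤m*n k n))) ⟩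
          t + e + (k * n ∸ k + k)      ≡⟨ sym (+-assoc (t + e) (k * n ∸ k) k) ⟩
          t + e + (k * n ∸ k) + k      ≡⟨ cong (_+ k) (trans (+-assoc t e _) (trans (cong (λ x → t + x) (+-comm e _)) (sym (+-assoc t _ e)))) ⟩
          t + (k * n ∸ k) + e + k      ∎

    turn-per : ∀ k S t → per n (proj₁ (proj₁ (turn k S))) t ≡ per n (proj₁ (proj₁ S)) (t + k)
    turn-per k ((T , _) , _) t = rotate-per k T t

-- Orbits of a free cyclic action

module Orbits {A : Set} {m : ℕ} (s : A ↔ Fin m) (n : ℕ) .{{_ : NonZero n}} (act : ℕ → A → A)
  (act-+ : ∀ k l a → act k (act l a) ≡ act (k + l) a) (act-periodic : ∀ a → Periodic n (λ k → act k a)) (act-0 : ∀ a → act 0 a ≡ a)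
  (free : ∀ a k → act k a ≡ a → n ∣ k) where

  private
    code : A → ℕ
    code a = toℕ (Inverse.to s a)

    code-injective : ∀ {a a′} → code a ≡ code a′ → a ≡ a′
    code-injective {a} {a′} e = trans (sym (Inverse.strictlyInverseʳ s a)) (trans (cong (Inverse.from s) (Fin.toℕ-injective e)) (Inverse.strictlyInverseʳ s a′))

    argmin : ∀ (f : ℕ → ℕ) k → ∃ λ i → ∀ j → j ≤ k → f i ≤ f j
    argmin f zero    = 0 , λ { zero _ → ≤-refl }
    argmin f (suc k) = go (argmin f k)
      where
      go : (∃ λ i → ∀ j → j ≤ k → f i ≤ f j) → ∃ λ i → ∀ j → j ≤ suc k → f i ≤ f j
      go (i , h) = pick (≤-total (f i) (f (suc k)))
        where
        pick : f i ≤ f (suc k) ⊎ f (suc k) ≤ f i → ∃ λ i → ∀ j → j ≤ suc k → f i ≤ f j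
        pick (inj₁ le) = i , λ j j≤ → [ (λ j<k → h j (≤-pred j<k)) , (λ { refl → le }) ]′ (m≤n⇒m<n∨m≡n j≤)
        pick (inj₂ le) = suc k , λ j j≤ → [ (λ j<k → ≤-trans le (h j (≤-pred j<k))) , (λ { refl → ≤-refl }) ]′ (m≤n⇒m<n∨m≡n j≤)

  -- Leads to the member of the orbit with the least code, which is a canonical representative. By
  -- periodicity the search up to `n` sees the whole orbit.
  shift : A → ℕ
  shift a = proj₁ (argmin (λ k → code (act k a)) n)

  rep : A → A
  rep a = act (shift a) a

  rep-least : ∀ a k → code (rep a) ≤ code (act k a)
  rep-least a k = ≤-trans (proj₂ (argmin (λ k → code (act k a)) n) (k % n) (<⇒≤ (DivMod.m%n<n k n))) (≤-reflexive (cong code (periodic-% n (act-periodic a) k)))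

  back : ∀ k a → ∃ λ l → act l (act k a) ≡ a
  back k a = k * n ∸ k , trans (act-+ (k * n ∸ k) k a) (trans (cong (λ x → act x a) (m∸n+n≡m (m≤m*n k n))) (trans (periodic-* n (act-periodic a) k 0) (act-0 a)))

  -- Both sides have the least code in the same orbit.
  rep-act : ∀ k a → rep (act k a) ≡ rep a
  rep-act k a = code-injective (≤-antisym
    (subst (λ x → code (rep (act k a)) ≤ code x) (trans (cong (act (shift a)) (proj₂ (back k a))) refl)
      (subst (λ x → code (rep (act k a)) ≤ code x) (sym (act-+ (shift a) (proj₁ (back k a)) (act k a))) (rep-least (act k a) (shift a + proj₁ (back k a)))))
    (subst (λ x → code (rep a) ≤ code x) (sym (act-+ (shift (act k a)) k a)) (rep-least a (shift (act k a) + k))))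

  Reps : Set
  Reps = Σ A λ a → rep a ≡ a

  private
    ≟-code : ∀ a a′ → Dec (a ≡ a′)
    ≟-code a a′ = go (code a ≟ code a′)
      where
      go : Dec (code a ≡ code a′) → Dec (a ≡ a′)
      go (yes e) = yes (code-injective e)
      go (no ¬e) = no (¬e ∘ cong code)

    abstract
      reps-finite : ∃ λ k → Reps ↔ Fin k
      reps-finite = subset-finite s (λ a → ≟-code (rep a) a) λ _ → ≡-prop

  orbits : ℕ
  orbits = proj₁ reps-finite

  private
    t : Reps ↔ Fin orbits
    t = proj₂ reps-finite

  repOf : A → Reps
  repOf a = rep a , rep-act (shift a) a

  abstract
    orbit : A → Fin orbits
    orbit a = Inverse.to t (repOf a)

    orbit-rep : ∀ i → ∃ λ a → orbit a ≡ i
    orbit-rep i = proj₁ (Inverse.from t i) , trans (cong (Inverse.to t) (Σ-≡ (λ _ → ≡-prop) (proj₂ (Inverse.from t i)))) (Inverse.strictlyInverseˡ t i)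

    orbit-act : ∀ k a → orbit (act k a) ≡ orbit a
    orbit-act k a = cong (Inverse.to t) (Σ-≡ (λ _ → ≡-prop) (rep-act k a))

    orbit-≡ : ∀ {a a′} → orbit a ≡ orbit a′ → ∃ λ k → a′ ≡ act k a
    orbit-≡ {a} {a′} e = proj₁ (back (shift a′) a′) + shift a ,
      trans (sym (proj₂ (back (shift a′) a′))) (trans (cong (act (proj₁ (back (shift a′) a′))) (sym reps)) (act-+ (proj₁ (back (shift a′) a′)) (shift a) a))
      where
      reps : rep a ≡ rep a′
      reps = cong proj₁ (trans (sym (Inverse.strictlyInverseʳ t (repOf a))) (trans (cong (Inverse.from t) e) (Inverse.strictlyInverseʳ t (repOf a′))))

  -- Freeness makes every element the rotation of its representative by exactly one residue modulo
  -- `n`.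
  n*orbits : n * orbits ≡ m
  n*orbits = trans (*-comm n orbits) (size-unique (↔-trans (↔-sym pairs) (size-× t (mk↔ₛ′ id id (λ _ → refl) (λ _ → refl)))) s)
    where
    pair : Reps × Fin n → A
    pair ((a , _) , k) = act (toℕ k) a
    pair-injective : ∀ {x x′} → pair x ≡ pair x′ → x ≡ x′
    pair-injective {(a , ra) , k} {(a′ , ra′) , k′} e = go (trans (sym ra) (trans (sym (rep-act (toℕ k) a)) (trans (cong rep e) (trans (rep-act (toℕ k′) a′) ra′)))) ra ra′ e
      where
      go : ∀ {a a′} → a ≡ a′ → (ra : rep a ≡ a) (ra′ : rep a′ ≡ a′) → act (toℕ k) a ≡ act (toℕ k′) a′ → _≡_ {A = Reps × Fin n} ((a , ra) , k) ((a′ , ra′) , k′)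
      go {a} refl ra ra′ e = cong₂ (λ r k → (a , r) , k) (≡-prop ra ra′) (Fin.toℕ-injective (begin
        toℕ k           ≡⟨ sym (DivMod.m<n⇒m%n≡m (Fin.toℕ<n k)) ⟩
        -- Both `l + toℕ k` and `l + toℕ k′` fix `a`, so both are multiples of `n`.
        toℕ k % n       ≡⟨ sym (%-cancel-+ n (toℕ k′) (toℕ k) l (trans (cong (_% n) (+-comm (toℕ k′) l)) (trans (trans (Div.n∣m⇒m%n≡0 _ n (free a (l + toℕ k′) loop)) (sym (Div.n∣m⇒m%n≡0 _ n (free a (l + toℕ k) loop′)))) (cong (_% n) (+-comm l (toℕ k)))))) ⟩
        toℕ k′ % n      ≡⟨ DivMod.m<n⇒m%n≡m (Fin.toℕ<n k′) ⟩
        toℕ k′          ∎))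
        where
        open ≡-Reasoning
        l = proj₁ (back (toℕ k) a)
        loop′ : act (l + toℕ k) a ≡ a
        loop′ = trans (sym (act-+ l (toℕ k) a)) (proj₂ (back (toℕ k) a))
        loop : act (l + toℕ k′) a ≡ a
        loop = trans (sym (act-+ l (toℕ k′) a)) (trans (cong (act l) (sym e)) (proj₂ (back (toℕ k) a)))
    unpair : A → Reps × Fin n
    unpair a = repOf a , (proj₁ (back (shift a) a) mod n)
    pair-unpair : ∀ a → pair (unpair a) ≡ a
    pair-unpair a = trans (cong (λ k → act k (rep a)) (toℕ-mod n (proj₁ (back (shift a) a)))) (trans (periodic-% n (act-periodic (rep a)) _) (proj₂ (back (shift a) a)))
    pairs : (Reps × Fin n) ↔ A
    pairs = section⇒↔ pair unpair pair-unpair pair-injective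

-- Juggling patterns as rotation orbits

module _ (n b κ : ℕ) .{{_ : NonZero n}} where
  private
    turn′ : ℕ → MinimalSiteswap n b κ → MinimalSiteswap n b κ
    turn′ = turn b κ n

    at : MinimalSiteswap n b κ → ℕ → Multiset
    at M = per n (proj₁ (proj₁ M))

    at-turn : ∀ k M t → at (turn′ k M) t ≡ at M (t + k)
    at-turn = turn-per b κ n

    turn-+ : ∀ k l M → turn′ k (turn′ l M) ≡ turn′ (k + l) M
    turn-+ k l M = Minimal-≡ (per-injective n λ t → trans (at-turn k (turn′ l M) t) (trans (at-turn l M (t + k)) (trans (cong (at M) (+-assoc t k l)) (sym (at-turn (k + l) M t)))))

    turn-periodic : ∀ M → Periodic n (λ k → turn′ k M)
    turn-periodic M k = Minimal-≡ (per-injective n λ t → trans (at-turn (k + n) M t)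
      (trans (cong (at M) (sym (+-assoc t k n))) (trans (per-periodic n (proj₁ (proj₁ M)) (t + k)) (sym (at-turn k M t)))))

    turn-0 : ∀ M → turn′ 0 M ≡ M
    turn-0 M = Minimal-≡ (per-injective n λ t → trans (at-turn 0 M t) (cong (at M) (+-identityʳ t)))

    turn-free : ∀ M k → turn′ k M ≡ M → n ∣ k
    turn-free M k e = min-period (proj₂ M) k λ t → trans (sym (at-turn k M t)) (cong (λ M → at M t) e)

  module Rotations = Orbits (size-Minimal b κ n) n turn′ turn-+ turn-periodic turn-0 turn-free

  minimal : MinSiteswap n b κ → MinimalSiteswap n b κ
  minimal (S , m) = S , HasMinimalPeriod⇒IsMin m

  jugglingPattern : MinSiteswap n b κ → Fin Rotations.orbits
  jugglingPattern = Rotations.orbit ∘ minimal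

  jugglingPattern-surjective : Surjective _≡_ _≡_ jugglingPattern
  jugglingPattern-surjective i = go (Rotations.orbit-rep i)
    where
    go : (∃ λ M → Rotations.orbit M ≡ i) → ∃ λ x → ∀ {z} → z ≡ x → jugglingPattern z ≡ i
    go ((S , m) , e) = (S , IsMin⇒HasMinimalPeriod m) , λ { refl → trans (cong Rotations.orbit (Minimal-≡ {S = minimal (S , IsMin⇒HasMinimalPeriod m)} {S′ = S , m} refl)) e }

  jugglingPattern-≡ : ∀ x y → (jugglingPattern x ≡ jugglingPattern y) ⇔ RotEquiv n (proj₁ (proj₁ x)) (proj₁ (proj₁ y))
  jugglingPattern-≡ x y = mk⇔ to from
    where
    to : jugglingPattern x ≡ jugglingPattern y → RotEquiv n (proj₁ (proj₁ x)) (proj₁ (proj₁ y))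
    to e = go (Rotations.orbit-≡ {minimal x} {minimal y} e)
      where
      go : (∃ λ k → minimal y ≡ turn′ k (minimal x)) → RotEquiv n (proj₁ (proj₁ x)) (proj₁ (proj₁ y))
      go (k , e) = k , cong (λ M → proj₁ (proj₁ M)) e
    from : RotEquiv n (proj₁ (proj₁ x)) (proj₁ (proj₁ y)) → jugglingPattern x ≡ jugglingPattern y
    from (k , e) = sym (trans (cong Rotations.orbit (Minimal-≡ {S = minimal y} {S′ = turn′ k (minimal x)} e)) (Rotations.orbit-act k (minimal x)))

-- The two counting formulas

module _ (b κ : ℕ) where
  private
    q : ℕ → ℤ
    -- A default; divisors are positive.
    q zero    = + 0
    q (suc j) = + mins b κ (suc j)

    sum-+ : ∀ (g : ℕ → ℕ) l → + sumℕ (map g l) ≡ sumℤ (map (λ j → + g j) l)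
    sum-+ g []      = refl
    sum-+ g (j ∷ l) = cong (λ x → + g j ℤ.+ x) (sum-+ g l)

    S-sum : ∀ d → S b κ (suc d) ≡ divisorSum q (suc d)
    S-sum d = begin
      S b κ (suc d)                                                                                   ≡⟨ sym (SiteswapCount.ss≡S (suc d) b κ) ⟩
      + SiteswapCount.ss (suc d) b κ                                                                  ≡⟨ cong +_ (ss-divisors b κ (suc d)) ⟩
      + sumℕ (map (λ j → mins b κ (suc j)) (filter (λ j → suc j ∣? suc d) (upTo (suc d))))            ≡⟨ sum-+ (λ j → mins b κ (suc j)) (filter (λ j → suc j ∣? suc d) (upTo (suc d))) ⟩
      sumℤ (map (λ j → + mins b κ (suc j)) (filter (λ j → suc j ∣? suc d) (upTo (suc d))))            ≡⟨ sumℤ-filter (λ j → suc j ∣? suc d) (λ j → + mins b κ (suc j)) id (suc d) ⟩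
      divisorSum q (suc d)                                                                            ∎
      where open ≡-Reasoning

  mobiusSum≡mins : ∀ n .{{_ : NonZero n}} → mobiusSum b κ n ≡ + mins b κ n
  mobiusSum≡mins zero    = contradiction refl (≢-nonZero⁻¹ 0)
  mobiusSum≡mins (suc n) = trans (sumℤ-filter (λ j → suc j ∣? suc n) (λ j → μ (suc n / suc j) ℤ.* S b κ (suc j)) id (suc n))
    (möbius-inversion (S b κ) q n S-sum)

theorem12 : (κ b n : ℕ) → 1 ≤ κ → .{{_ : NonZero n}} →
    (Σ ℕ λ ss → (Siteswap n b κ ↔ Fin ss) × (+ ss ≡ S b κ n))
    × (Σ ℕ λ jp → Σ (MinSiteswap n b κ → Fin jp) λ f →
    Surjective _≡_ _≡_ f
    × (∀ x y → (f x ≡ f y) ⇔ RotEquiv n (proj₁ (proj₁ x)) (proj₁ (proj₁ y)))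
    × (+ n ℤ.* + jp ≡ mobiusSum b κ n))
theorem12 κ b n _ =
  (SiteswapCount.ss n b κ , SiteswapCount.size-Siteswap n b κ , SiteswapCount.ss≡S n b κ) ,
  (Rotations.orbits n b κ , jugglingPattern n b κ , jugglingPattern-surjective n b κ , jugglingPattern-≡ n b κ ,
    trans (sym (ℤ.pos-* n (Rotations.orbits n b κ))) (trans (cong +_ (Rotations.n*orbits n b κ)) (sym (mobiusSum≡mins b κ n))))
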